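{- Let $p>3$ be a prime. Then $$\sum_{k=0}^{\frac{p-1}{2}} (4k+1) \left(\frac{(\frac12)_k}{k!}\right)^6\equiv p\cdot a_p \pmod{p^4},$$ where $a_p$ is the $p$-th Fourier coefficient of the weight $4$ modular form $\eta(2z)^4\eta(4z)^4=q\prod_{n\ge1}(1-q^{2n})^4(1-q^{4n})^4=\sum_{n\ge1}a_nq^n$, $q=e^{2\pi i z}$.
   Context: For $a\in\mathbb{C}$ and $k\in\mathbb{N}$, $(a)_k=a(a+1)\cdots(a+k-1)$ denotes the rising factorial, with $(a)_0=1$. A congruence $A\equiv B \pmod{p^m}$ between rational numbers means that $A-B\in p^m\mathbb{Z}_{(p)}$. -}

module Defs where

open import Data.Nat as ℕ using (ℕ; zero; suc; _∸_; _^_; NonZero)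
open import Data.Nat.Base using (_!)
open import Data.Nat.Properties using (_!≢0)
open import Data.Nat.Divisibility as ℕD using ()
open import Data.Nat.Coprimality using (Coprime)
open import Data.Integer as ℤ using (ℤ; +_)
open import Data.Integer.Divisibility using (_∣_)
open import Data.Rational as ℚ using (ℚ; ↥_; ↧ₙ_; _/_)
open import Data.List using (List; []; _∷_; replicate; zipWith; foldr)
open import Data.Product using (_×_)
open import Relation.Nullary using (yes; no)

rising : ℚ → ℕ → ℚ
rising a zero    = ℚ.1ℚ
rising a (suc k) = rising a k ℚ.* (a ℚ.+ ((+ k) / 1))

inv! : ℕ → ℚ
inv! k = (+ 1) / (k !)
  where instance _ = k !≢0

½ : ℚ
½ = (+ 1) / 2

powℚ : ℚ → ℕ → ℚ
powℚ x zero    = ℚ.1ℚ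
powℚ x (suc e) = x ℚ.* powℚ x e

sumTo : ℕ → (ℕ → ℚ) → ℚ
sumTo zero    f = f 0
sumTo (suc n) f = sumTo n f ℚ.+ f (suc n)

lhs : ℕ → ℚ
lhs n = sumTo n (λ k → ((+ (4 ℕ.* k ℕ.+ 1)) / 1) ℚ.* powℚ (rising ½ k ℚ.* inv! k) 6)

-- A ≡ B (mod p^m) for rationals: A - B ∈ p^m ℤ_(p).
-- Since ℚ is stored in lowest terms, this means the denominator of A - B is
-- prime to p and p^m divides its numerator.
_≡_[modℚ_^_] : ℚ → ℚ → ℕ → ℕ → Set
A ≡ B [modℚ p ^ m ] =
  Coprime p (↧ₙ (A ℚ.- B)) × ((+ (p ^ m)) ∣ (↥ (A ℚ.- B)))

-- Truncated power series over ℤ, represented as coefficient lists of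
-- length L (coefficients of q^0 … q^(L-1)).

Series : Set
Series = List ℤ

coeff : Series → ℕ → ℤ
coeff []       _       = + 0
coeff (c ∷ cs) zero    = c
coeff (c ∷ cs) (suc i) = coeff cs i

mulT : ℕ → Series → Series → Series
mulT L f g = go L 0
  where
    conv : ℕ → ℤ
    conv i = convAux i i
      where
        convAux : ℕ → ℕ → ℤ
        convAux zero    i = coeff f 0 ℤ.* coeff g i
        convAux (suc j) i = convAux j i ℤ.+ coeff f (suc j) ℤ.* coeff g (i ∸ suc j)
    go : ℕ → ℕ → Series
    go zero    _ = []
    go (suc r) i = conv i ∷ go r (suc i)

omqCoeff : ℕ → ℕ → ℤ
omqCoeff d i with i ℕ.≟ 0 | d ℕ.≟ i
... | yes _ | yes _ = + 0
... | yes _ | no  _ = + 1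
... | no  _ | yes _ = ℤ.- (+ 1)
... | no  _ | no  _ = + 0

oneMinusQ : ℕ → ℕ → Series
oneMinusQ L d = go L 0
  where
    go : ℕ → ℕ → Series
    go zero    _ = []
    go (suc r) i = omqCoeff d i ∷ go r (suc i)

oneT : ℕ → Series
oneT zero    = []
oneT (suc L) = + 1 ∷ replicate L (+ 0)

powT : ℕ → Series → ℕ → Series
powT L f zero    = oneT L
powT L f (suc e) = mulT L f (powT L f e)

etaProd : ℕ → ℕ → Series
etaProd L zero    = oneT L
etaProd L (suc n) =
  mulT L (etaProd L n)
    (mulT L (powT L (oneMinusQ L (2 ℕ.* suc n)) 4)
            (powT L (oneMinusQ L (4 ℕ.* suc n)) 4))

-- a_m : coefficient of q^m in η(2z)^4 η(4z)^4 = q ∏_{n≥1} (1-q^{2n})^4 (1-q^{4n})^4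
-- = coefficient of q^(m-1) in the infinite product; factors with n ≥ m
-- are ≡ 1 mod q^m, so the product over n = 1..m, truncated to length m, suffices.
a : ℕ → ℤ
a zero    = + 0
a (suc m) = coeff (etaProd (suc m) (suc m)) m

{-# OPTIONS --safe #-}

-- Write p = 2m + 1 and bₖ = (1/2)ₖ/k!.
--
-- The sum of fourth powers.  After q² ↦ q, a_p is the coefficient of qᵐ in h = ∏(1 - qⁿ)⁴(1 - q²ⁿ)⁴.  Let D = q d/dq,
-- W = ∏(1 - qⁿ)⁸(1 - q²ⁿ)⁻⁴, T = q∏(1 + qⁿ)²⁴ and E = DT/T.  A convolution identity for divisor sums of Liouville's
-- kind and its images under q ↦ -q and q ↦ q² give Halphen's differential system, hence E² = W²(1 + 64T) and
--   D³(W⁻¹Tˢ) = EW(s³Tˢ + 64(s + 1/2)³Tˢ⁺¹).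
-- So the terminating hypergeometric combination v = Σ_{j≤m} Cⱼ W⁻¹T^(-j-1/2) = const · q^(-p/2) + … satisfies
-- D³v = p³ · (p-integral series): its coefficients of q^(n-p/2) vanish modulo p³ for 0 < n ≤ m.  Comparing constant
-- terms of q^(1/2)h·v, where q^(1/2)h = W²T^(1/2), expresses a_p modulo p³ by the residues of W T^(-j) dq/q, which are
-- (-64)ʲbⱼ.  The result is a_p ≡ Σ bⱼ⁴ (mod p³), Morley's congruence supplying the normalisation.
--
-- The sum of sixth powers.  With parameters (1 ± p)/2 and (1 ± ip)/2, whose product of Pochhammer symbols differs from
-- the fourth power of (1/2)ₖ by a multiple of p⁴, Whipple's ₇F₆ transformation gives modulo p⁴
--   Σ (4k + 1)bₖ⁶ ≡ p Σ bⱼ⁴(1 - p²Σ_{i≤2j} i⁻²),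
-- and Σ bⱼ⁴ Σ_{i≤2j} i⁻² vanishes modulo p because its terms change sign under j ↦ m - j.

module Submission where

open import Defs
open import Data.Nat as ℕ using (ℕ; zero; suc; z≤n; s≤s; _!; _>_; _∸_; _/_)
import Data.Nat
import Data.Nat.Properties as ℕP
import Data.Nat.Divisibility as ℕD
import Data.Nat.DivMod as ℕDM
open import Data.Nat.Induction using (<-rec)
open import Data.Nat.Primality using (Prime; prime⇒irreducible)
open import Data.Nat.Coprimality using (Coprime; prime⇒coprime; coprime-Bézout; coprime?)
open import Data.Nat.GCD using (module Bézout)
import Data.Nat.Solver
open import Data.Integer as ℤ using (ℤ; +_; _+_; -_; _-_; 0ℤ; 1ℤ) renaming (_*_ to _·_)
import Data.Integer.Properties as ℤP
import Data.Integer.Divisibility as ℤD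
import Data.Integer.Solver
open import Data.Rational as ℚ using (ℚ; mkℚ; toℚᵘ; _/_; _*_)
import Data.Rational
import Data.Rational.Properties as ℚP
open import Data.Rational.Unnormalised as ℚᵘ using (ℚᵘ; mkℚᵘ; *≡*)
open import Data.List using ([]; _∷_; replicate)
open import Data.Maybe using (just; nothing)
open import Data.Product using (_×_; _,_; ∃)
open import Data.Sum using (_⊎_; inj₁; inj₂)
open import Data.Empty using (⊥-elim)
open import Level using (0ℓ)
open import Algebra.Bundles using (CommutativeRing)
open import Algebra.Structures using (IsCommutativeRing)
open import Algebra.Solver.Ring.AlmostCommutativeRing using (AlmostCommutativeRing; fromCommutativeRing; _-Raw-AlmostCommutative⟶_; Induced-equivalence)
import Algebra.Solver.Ring
open import Relation.Binary.Bundles using (Setoid)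
open import Relation.Binary.Definitions using (WeaklyDecidable)
open import Relation.Binary.Structures using (IsEquivalence)
open import Relation.Binary.PropositionalEquality
import Relation.Binary.Reasoning.Setoid as SetoidR
open import Relation.Nullary using (yes; no; recompute)

-- The modulus p³ reflects the order of the differential operator: D³ multiplies the coefficient of
-- q^(n-p/2) by (n - p/2)³, a unit at p for 0 < n ≤ m, while the one term that survives the
-- telescoping of D³v carries the factor (2m + 1)³ = p³. As the sixth-power sum is p times the
-- fourth-power sum, this is exactly the precision needed. In Whipple's transformation the
-- replacement costs only p⁴ because z⁴ - p⁴ = (z² - p²)(z² + p²); the parameter (1 - p)/2 = -m
-- makes the sums stop at m, and ip enters only through its square, so no complex number appears. No
-- theory of modular forms is used. Series are integral and compared modulo q^(m+1), and eta
-- quotients enter through their logarithmic derivatives. Hypergeometric terms modulo p⁴ are integer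
-- sequences given by first-order recurrences with invertible leading coefficient; two of them are
-- compared by the uniqueness of the solution, and their sums by telescoping certificates. The
-- assumption p > 3 makes 6 invertible, which forces the sum of 1/i² over 0 < i < p to vanish modulo
-- p.

module NS = Data.Nat.Solver.+-*-Solver
module ZS = Data.Integer.Solver.+-*-Solver
open ZS using () renaming (_:+_ to _⊹_; _:*_ to _⋆_; _:-_ to _∸′_; :-_ to ∸′_; _:=_ to _⊜_)

# : ∀ {n} → ℕ → ZS.Polynomial n
# k = ZS.con (+ k)

-- Power series

PS : Set
PS = ℕ → ℤ

tail : PS → PS
tail f n = f (suc n)

-- The operations are opaque outside this block, so that the ring solver meets them as atoms and
-- conversion checking never unfolds a convolution. The pointwise equations below give access to the
-- coefficients.
abstract
  infixl 6 _⊕_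
  infixl 7 _⊗_

  _⊕_ : PS → PS → PS
  (f ⊕ g) n = f n + g n

  ⊖_ : PS → PS
  (⊖ f) n = - f n

  -- From f = f 0 + q · tail f: the recursion runs on the left factor, so the ring laws become
  -- inductions without index arithmetic.
  _⊗_ : PS → PS → PS
  (f ⊗ g) zero    = f 0 · g 0
  (f ⊗ g) (suc n) = f 0 · g (suc n) + (tail f ⊗ g) n

  κ : ℤ → PS
  κ c zero    = c
  κ c (suc n) = 0ℤ

  -- Q e is qᵉ, D is q d/dq, and V and N are the substitutions q ↦ q² and q ↦ -q.
  Q : ℕ → PS
  Q zero    = κ 1ℤ
  Q (suc e) zero    = 0ℤ
  Q (suc e) (suc n) = Q e n

  D : PS → PS
  D f n = + n · f n

  V : PS → PS
  V f zero          = f 0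
  V f (suc zero)    = 0ℤ
  V f (suc (suc n)) = V (tail f) n

  sgn : ℕ → ℤ
  sgn zero    = 1ℤ
  sgn (suc n) = - sgn n

  N : PS → PS
  N f n = sgn n · f n

  sgn-zero : sgn 0 ≡ 1ℤ
  sgn-zero = refl

  sgn-suc : ∀ n → sgn (suc n) ≡ - sgn n
  sgn-suc n = refl

  ⊕-at : ∀ f g n → (f ⊕ g) n ≡ f n + g n
  ⊕-at f g n = refl

  ⊖-at : ∀ f n → (⊖ f) n ≡ - f n
  ⊖-at f n = refl

  κ-zero : ∀ c → κ c 0 ≡ c
  κ-zero c = refl

  κ-suc : ∀ c n → κ c (suc n) ≡ 0ℤ
  κ-suc c n = refl

  Q-zero : ∀ n → Q 0 n ≡ κ 1ℤ n
  Q-zero n = refl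

  Q-suc-zero : ∀ e → Q (suc e) 0 ≡ 0ℤ
  Q-suc-zero e = refl

  Q-suc-suc : ∀ e n → Q (suc e) (suc n) ≡ Q e n
  Q-suc-suc e n = refl

  N-at : ∀ f n → N f n ≡ sgn n · f n
  N-at f n = refl

  -- The bound on `i` is what lets `V` respect equality up to a given degree; `⊗-cong` has it for
  -- the same reason.
  V-congᵃ : ∀ {f g} n → (∀ i → i ℕ.≤ n → f i ≡ g i) → V f n ≡ V g n
  V-congᵃ zero          p = p 0 z≤n
  V-congᵃ (suc zero)    p = refl
  V-congᵃ (suc (suc n)) p = V-congᵃ n (λ i q → p (suc i) (s≤s (ℕP.m≤n⇒m≤1+n q)))

  D-at : ∀ f n → D f n ≡ + n · f n
  D-at f n = refl

  ⊗-zero : ∀ f g → (f ⊗ g) 0 ≡ f 0 · g 0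
  ⊗-zero f g = refl

  ⊗-suc : ∀ f g n → (f ⊗ g) (suc n) ≡ f 0 · g (suc n) + (tail f ⊗ g) n
  ⊗-suc f g n = refl

  ⊗-cong : ∀ {f f′ g g′} n → (∀ i → i ℕ.≤ n → f i ≡ f′ i) → (∀ i → i ℕ.≤ n → g i ≡ g′ i) →
           (f ⊗ g) n ≡ (f′ ⊗ g′) n
  ⊗-cong zero    p q = cong₂ _·_ (p 0 z≤n) (q 0 z≤n)
  ⊗-cong (suc n) p q = cong₂ _+_ (cong₂ _·_ (p 0 z≤n) (q (suc n) ℕP.≤-refl))
    (⊗-cong n (λ i i≤n → p (suc i) (s≤s i≤n)) (λ i i≤n → q i (ℕP.m≤n⇒m≤1+n i≤n)))

  ⊗-ext : ∀ {f f′ g g′} n → (∀ i → f i ≡ f′ i) → (∀ i → g i ≡ g′ i) → (f ⊗ g) n ≡ (f′ ⊗ g′) n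
  ⊗-ext n p q = ⊗-cong n (λ i _ → p i) (λ i _ → q i)

  scale : ℤ → PS → PS
  scale c f n = c · f n

  ⊗-zeroˡ : ∀ f n → ((λ _ → 0ℤ) ⊗ f) n ≡ 0ℤ
  ⊗-zeroˡ f zero    = refl
  ⊗-zeroˡ f (suc n) = trans (ℤP.+-identityˡ _) (⊗-zeroˡ f n)

  ⊗-scaleˡ : ∀ c f g n → (scale c f ⊗ g) n ≡ c · (f ⊗ g) n
  ⊗-scaleˡ c f g zero    = ℤP.*-assoc c (f 0) (g 0)
  ⊗-scaleˡ c f g (suc n) = trans (cong₂ _+_ (ℤP.*-assoc c (f 0) _) (⊗-scaleˡ c (tail f) g n))
    (sym (ℤP.*-distribˡ-+ c _ _))

  ⊗-distribʳ : ∀ f g h n → ((f ⊕ g) ⊗ h) n ≡ (f ⊗ h) n + (g ⊗ h) n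
  ⊗-distribʳ f g h zero    = ℤP.*-distribʳ-+ (h 0) (f 0) (g 0)
  ⊗-distribʳ f g h (suc n) = trans (cong (λ z → (f 0 + g 0) · h (suc n) + z) (⊗-distribʳ (tail f) (tail g) h n))
    (ZS.solve 5 (λ a b c x y → ((a ⊹ b) ⋆ c) ⊹ (x ⊹ y) ⊜ (a ⋆ c ⊹ x) ⊹ (b ⋆ c ⊹ y)) refl
      (f 0) (g 0) (h (suc n)) ((tail f ⊗ h) n) ((tail g ⊗ h) n))

  -- The same unfolding from the right factor. Commutativity follows by playing the two recursions
  -- against each other.
  ⊗-sucʳ : ∀ f g n → (f ⊗ g) (suc n) ≡ (f ⊗ tail g) n + f (suc n) · g 0
  ⊗-sucʳ f g zero    = refl
  ⊗-sucʳ f g (suc n) = trans (cong (λ z → f 0 · g (suc (suc n)) + z) (⊗-sucʳ (tail f) g n)) (sym (ℤP.+-assoc (f 0 · g (suc (suc n))) _ _))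

  ⊗-commᵃ : ∀ f g n → (f ⊗ g) n ≡ (g ⊗ f) n
  ⊗-commᵃ f g zero    = ℤP.*-comm (f 0) (g 0)
  ⊗-commᵃ f g (suc n) = trans (⊗-sucʳ f g n) (trans (ℤP.+-comm ((f ⊗ tail g) n) (f (suc n) · g 0))
    (cong₂ _+_ (ℤP.*-comm (f (suc n)) (g 0)) (⊗-commᵃ f (tail g) n)))

  ⊗-assocᵃ : ∀ f g h n → ((f ⊗ g) ⊗ h) n ≡ (f ⊗ (g ⊗ h)) n
  ⊗-assocᵃ f g h zero    = ℤP.*-assoc (f 0) (g 0) (h 0)
  ⊗-assocᵃ f g h (suc n) = trans (cong (λ z → f 0 · g 0 · h (suc n) + z)
      (trans (⊗-distribʳ (scale (f 0) (tail g)) (tail f ⊗ g) h n)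
        (cong₂ _+_ (⊗-scaleˡ (f 0) (tail g) h n) (⊗-assocᵃ (tail f) g h n))))
    (ZS.solve 5 (λ a b c x y → (a ⋆ b) ⋆ c ⊹ (a ⋆ x ⊹ y) ⊜ a ⋆ (b ⋆ c ⊹ x) ⊹ y) refl
      (f 0) (g 0) (h (suc n)) ((tail g ⊗ h) n) ((tail f ⊗ (g ⊗ h)) n))

  κ-⊗ᵃ : ∀ c f n → (κ c ⊗ f) n ≡ c · f n
  κ-⊗ᵃ c f zero    = refl
  κ-⊗ᵃ c f (suc n) = trans (cong (λ z → c · f (suc n) + z) (⊗-zeroˡ f n)) (ℤP.+-identityʳ _)

  -- From D(q f) = q(f + D f), the recursion behind the inductions on `D`.
  tailD : ∀ f n → tail (D f) n ≡ (tail f ⊕ D (tail f)) n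
  tailD f n = ZS.solve 2 (λ n x → (# 1 ⊹ n) ⋆ x ⊜ x ⊹ n ⋆ x) refl (+ n) (f (suc n))

  D-⊗ᵃ : ∀ f g n → D (f ⊗ g) n ≡ (D f ⊗ g) n + (f ⊗ D g) n
  D-⊗ᵃ f g zero    = ZS.solve 2 (λ x y → # 0 ⋆ (x ⋆ y) ⊜ (# 0 ⋆ x) ⋆ y ⊹ x ⋆ (# 0 ⋆ y)) refl (f 0) (g 0)
  D-⊗ᵃ f g (suc n) = trans lem (cong₂ _+_ (cong (λ z → 0ℤ · f 0 · g (suc n) + z) (sym (trans (⊗-ext n (tailD f) (λ _ → refl)) (⊗-distribʳ (tail f) (D (tail f)) g n)))) refl)
    where
    lem : + suc n · (f 0 · g (suc n) + (tail f ⊗ g) n) ≡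
          (0ℤ · f 0 · g (suc n) + ((tail f ⊗ g) n + (D (tail f) ⊗ g) n)) + (f 0 · (+ suc n · g (suc n)) + (tail f ⊗ D g) n)
    lem = trans (ZS.solve 4 (λ n x y z → (# 1 ⊹ n) ⋆ (x ⋆ y ⊹ z) ⊜ z ⊹ (x ⋆ ((# 1 ⊹ n) ⋆ y)) ⊹ n ⋆ z) refl (+ n) (f 0) (g (suc n)) ((tail f ⊗ g) n))
      (trans (cong (λ z → (tail f ⊗ g) n + f 0 · (+ suc n · g (suc n)) + z) (D-⊗ᵃ (tail f) g n))
        (ZS.solve 6 (λ k f0 y z u v → z ⊹ k ⊹ (u ⊹ v) ⊜ (# 0 ⋆ f0 ⋆ y ⊹ (z ⊹ u)) ⊹ (k ⊹ v)) refl (f 0 · (+ suc n · g (suc n))) (f 0) (g (suc n)) ((tail f ⊗ g) n) ((D (tail f) ⊗ g) n) ((tail f ⊗ D g) n)))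

  N-⊗ᵃ : ∀ f g n → N (f ⊗ g) n ≡ (N f ⊗ N g) n
  N-⊗ᵃ f g zero    = ZS.solve 2 (λ x y → # 1 ⋆ (x ⋆ y) ⊜ (# 1 ⋆ x) ⋆ (# 1 ⋆ y)) refl (f 0) (g 0)
  N-⊗ᵃ f g (suc n) = trans (ZS.solve 4 (λ e x y z → (∸′ e) ⋆ (x ⋆ y ⊹ z) ⊜ (# 1 ⋆ x) ⋆ ((∸′ e) ⋆ y) ⊹ (∸′ # 1) ⋆ (e ⋆ z)) refl (sgn n) (f 0) (g (suc n)) ((tail f ⊗ g) n))
    (cong (λ z → 1ℤ · f 0 · (- sgn n · g (suc n)) + z) (trans (cong (- 1ℤ ·_) (N-⊗ᵃ (tail f) g n))
      (trans (sym (⊗-scaleˡ (- 1ℤ) (N (tail f)) (N g) n))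
        (⊗-ext n (λ i → ZS.solve 2 (λ e x → ∸′ # 1 ⋆ (e ⋆ x) ⊜ (∸′ e) ⋆ x) refl (sgn i) (f (suc i))) (λ _ → refl)))))

  V-ext : ∀ {f g} n → (∀ i → f i ≡ g i) → V f n ≡ V g n
  V-ext zero          p = p 0
  V-ext (suc zero)    p = refl
  V-ext (suc (suc n)) p = V-ext n (λ i → p (suc i))

  V-⊕ᵃ : ∀ f g n → V (f ⊕ g) n ≡ V f n + V g n
  V-⊕ᵃ f g zero          = refl
  V-⊕ᵃ f g (suc zero)    = refl
  V-⊕ᵃ f g (suc (suc n)) = V-⊕ᵃ (tail f) (tail g) n

  V-scale : ∀ c f n → V (scale c f) n ≡ c · V f n
  V-scale c f zero          = refl
  V-scale c f (suc zero)    = sym (ℤP.*-zeroʳ c)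
  V-scale c f (suc (suc n)) = V-scale c (tail f) n

  V-⊗ᵃ : ∀ f g n → V (f ⊗ g) n ≡ (V f ⊗ V g) n
  V-⊗ᵃ f g zero          = refl
  V-⊗ᵃ f g (suc zero)    = ZS.solve 2 (λ x y → # 0 ⊜ x ⋆ # 0 ⊹ # 0 ⋆ y) refl (f 0) (g 0)
  V-⊗ᵃ f g (suc (suc n)) = trans (V-⊕ᵃ (scale (f 0) (tail g)) (tail f ⊗ g) n)
    (cong₂ _+_ (V-scale (f 0) (tail g) n) (trans (V-⊗ᵃ (tail f) g n) (sym (ℤP.+-identityˡ _))))

  -- The chain rule for q ↦ q².
  D-V : ∀ f n → D (V f) n ≡ + 2 · V (D f) n
  D-V f zero          = refl
  D-V f (suc zero)    = refl
  D-V f (suc (suc n)) = trans (trans (cong (_· V (tail f) n) (ℤP.pos-+ 2 n)) (ℤP.*-distribʳ-+ (V (tail f) n) (+ 2) (+ n)))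
    (trans (cong (λ z → + 2 · V (tail f) n + z) (D-V (tail f) n))
      (trans (sym (ℤP.*-distribˡ-+ (+ 2) (V (tail f) n) (V (D (tail f)) n)))
        (cong (+ 2 ·_) (trans (sym (V-⊕ᵃ (tail f) (D (tail f)) n)) (V-ext n (λ i → sym (tailD f i)))))))

  Q-⊗-suc : ∀ e f n → (Q (suc e) ⊗ f) (suc n) ≡ (Q e ⊗ f) n
  Q-⊗-suc e f n = ℤP.+-identityˡ _

  Q-+ᵃ : ∀ d e n → Q (d ℕ.+ e) n ≡ (Q d ⊗ Q e) n
  Q-+ᵃ zero    e n       = sym (trans (κ-⊗ᵃ 1ℤ (Q e) n) (ℤP.*-identityˡ _))
  Q-+ᵃ (suc d) e zero    = refl
  Q-+ᵃ (suc d) e (suc n) = trans (Q-+ᵃ d e n) (sym (Q-⊗-suc d (Q e) n))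

  D-Qᵃ : ∀ e n → D (Q e) n ≡ + e · Q e n
  D-Qᵃ zero zero = refl
  D-Qᵃ zero (suc n) = ℤP.*-zeroʳ (+ suc n)
  D-Qᵃ (suc e) zero = sym (ℤP.*-zeroʳ (+ suc e))
  D-Qᵃ (suc e) (suc n) = trans (tailD (Q (suc e)) n) (trans (cong (λ z → Q e n + z) (D-Qᵃ e n))
    (ZS.solve 2 (λ e x → x ⊹ e ⋆ x ⊜ (# 1 ⊹ e) ⋆ x) refl (+ e) (Q e n)))

  Q-big : ∀ e n → n ℕ.< e → Q e n ≡ 0ℤ
  Q-big (suc e) zero    _       = refl
  Q-big (suc e) (suc n) (s≤s p) = Q-big e n p

  N-Qᵃ : ∀ e n → N (Q e) n ≡ sgn e · Q e n
  N-Qᵃ zero zero = refl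
  N-Qᵃ zero (suc n) = ℤP.*-zeroʳ (- sgn n)
  N-Qᵃ (suc e) zero = sym (ℤP.*-zeroʳ (- sgn e))
  N-Qᵃ (suc e) (suc n) = trans (sym (ℤP.neg-distribˡ-* (sgn n) (Q e n)))
    (trans (cong -_ (N-Qᵃ e n)) (ℤP.neg-distribˡ-* (sgn e) (Q e n)))

  V-Qᵃ : ∀ e n → V (Q e) n ≡ Q (e ℕ.+ e) n
  V-Qᵃ zero    zero = refl
  V-Qᵃ zero    (suc zero) = refl
  V-Qᵃ zero    (suc (suc n)) = V-zero n where
    V-zero : ∀ n → V (λ _ → 0ℤ) n ≡ 0ℤ
    V-zero zero = refl
    V-zero (suc zero) = refl
    V-zero (suc (suc n)) = V-zero n
  V-Qᵃ (suc e) zero = refl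
  V-Qᵃ (suc e) (suc zero) rewrite ℕP.+-suc e e = refl
  V-Qᵃ (suc e) (suc (suc n)) rewrite ℕP.+-suc e e = V-Qᵃ e n

  κ-V : ∀ c n → V (κ c) n ≡ κ c n
  κ-V c zero = refl
  κ-V c (suc zero) = refl
  κ-V c (suc (suc n)) = trans (V-Q0 n) refl where
    V-Q0 : ∀ n → V (λ _ → 0ℤ) n ≡ 0ℤ
    V-Q0 zero = refl
    V-Q0 (suc zero) = refl
    V-Q0 (suc (suc n)) = V-Q0 n

  V-1 : ∀ f → V f 1 ≡ 0ℤ
  V-1 f = refl

  V-double : ∀ f n → V f (n ℕ.+ n) ≡ f n
  V-double f zero = refl
  V-double f (suc n) rewrite ℕP.+-suc n n = V-double (tail f) n

infixl 6 _⊝_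
_⊝_ : PS → PS → PS
f ⊝ g = f ⊕ ⊖ g

infixr 8 _↑_
_↑_ : PS → ℕ → PS
f ↑ zero  = κ 1ℤ
f ↑ suc n = f ⊗ f ↑ n

euler : ℕ → PS
euler zero    = κ 1ℤ
euler (suc K) = euler K ⊗ (κ 1ℤ ⊝ Q (suc K))

-- Indicators, signs and elementary sums of integers

lt : ℕ → ℕ → ℤ
lt _       zero    = 0ℤ
lt zero    (suc l) = 1ℤ
lt (suc k) (suc l) = lt k l

eq : ℕ → ℕ → ℤ
eq zero    zero    = 1ℤ
eq zero    (suc _) = 0ℤ
eq (suc _) zero    = 0ℤ
eq (suc k) (suc l) = eq k l

trichotomy : ∀ k l → lt k l + eq k l + lt l k ≡ 1ℤ
trichotomy zero    zero    = refl
trichotomy zero    (suc l) = refl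
trichotomy (suc k) zero    = refl
trichotomy (suc k) (suc l) = trichotomy k l

sgn-+ : ∀ a b → sgn (a ℕ.+ b) ≡ sgn a · sgn b
sgn-+ zero    b = sym (trans (cong (_· sgn b) sgn-zero) (ℤP.*-identityˡ (sgn b)))
sgn-+ (suc a) b = trans (sgn-suc (a ℕ.+ b)) (trans (cong -_ (sgn-+ a b))
  (trans (ℤP.neg-distribˡ-* (sgn a) (sgn b)) (cong (_· sgn b) (sym (sgn-suc a)))))

sgn-sq : ∀ a → sgn a · sgn a ≡ 1ℤ
sgn-sq zero    = cong₂ _·_ sgn-zero sgn-zero
sgn-sq (suc a) = trans (cong₂ _·_ (sgn-suc a) (sgn-suc a)) (trans (ZS.solve 1 (λ x → (∸′ x) ⋆ (∸′ x) ⊜ x ⋆ x) refl (sgn a)) (sgn-sq a))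

sgn-double : ∀ a → sgn (a ℕ.+ a) ≡ 1ℤ
sgn-double a = trans (sgn-+ a a) (sgn-sq a)

-- Twice the indicator of odd `k`; the factor 2 keeps it a polynomial in `sgn k`, which the ring
-- solver can handle.
odd : ℕ → ℤ
odd k = 1ℤ - sgn k

-- sumℤ and S start at the index 1, sum₀ at 0.
sumℤ : ℕ → (ℕ → ℤ) → ℤ
sumℤ zero    f = 0ℤ
sumℤ (suc K) f = sumℤ K f + f (suc K)

sumℤ-cong : ∀ K {f g : ℕ → ℤ} → (∀ n → n ℕ.≤ K → f n ≡ g n) → sumℤ K f ≡ sumℤ K g
sumℤ-cong zero    p = refl
sumℤ-cong (suc K) p = cong₂ _+_ (sumℤ-cong K (λ n q → p n (ℕP.m≤n⇒m≤1+n q))) (p (suc K) ℕP.≤-refl)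

lt-≤ : ∀ n d → n ℕ.≤ d → lt n (suc d) ≡ 1ℤ
lt-≤ zero    d       _       = refl
lt-≤ (suc n) (suc d) (s≤s p) = lt-≤ n d p

lt-> : ∀ n d → d ℕ.≤ n → lt n d ≡ 0ℤ
lt-> n       zero    _       = refl
lt-> (suc n) (suc d) (s≤s p) = lt-> n d p

sumℤ-lt : ∀ r d (h : ℕ → ℤ) → sumℤ (r ℕ.+ d) (λ n → lt n (suc d) · h n) ≡ sumℤ d h
sumℤ-lt zero    d h = sumℤ-cong d (λ n n≤d → trans (cong (_· h n) (lt-≤ n d n≤d)) (ℤP.*-identityˡ (h n)))
sumℤ-lt (suc r) d h = trans (cong₂ _+_ (sumℤ-lt r d h) (cong (_· h (suc r ℕ.+ d)) (lt-> (suc (r ℕ.+ d)) (suc d) (s≤s (ℕP.m≤n+m d r)))))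
  (trans (cong (λ z → sumℤ d h + z) (ℤP.*-zeroˡ (h (suc r ℕ.+ d)))) (ℤP.+-identityʳ (sumℤ d h)))

sumℤ-lt′ : ∀ M d (h : ℕ → ℤ) → suc d ℕ.≤ M → sumℤ M (λ n → lt n (suc d) · h n) ≡ sumℤ d h
sumℤ-lt′ M d h d<M = subst (λ z → sumℤ z (λ n → lt n (suc d) · h n) ≡ sumℤ d h) (ℕP.m∸n+n≡m (ℕP.≤-trans (ℕP.n≤1+n d) d<M)) (sumℤ-lt (M ∸ d) d h)

-- Used with c = d² and e = d - 1 for the alternating sum of d² + n² over n < d; the doubling avoids
-- a fraction in the closed form.
alternating-squares : ∀ x c e → + 2 · sumℤ e (λ n → x · (sgn n · (c + + n · + n))) ≡ x · (c · (sgn e - 1ℤ) + sgn e · (+ e · (1ℤ + + e)))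
alternating-squares x c zero = trans (ZS.solve 2 (λ x c → # 0 ⊜ x ⋆ (c ⋆ (# 1 ∸′ # 1) ⊹ # 1 ⋆ # 0)) refl x c)
  (cong (λ z → x · (c · (z - 1ℤ) + z · (0ℤ · (1ℤ + 0ℤ)))) (sym sgn-zero))
alternating-squares x c (suc e) = trans (ℤP.*-distribˡ-+ (+ 2) (sumℤ e _) _) (trans (cong₂ _+_ (alternating-squares x c e)
    (cong (λ z → + 2 · (x · (z · (c + + suc e · + suc e)))) (sgn-suc e)))
  (trans (ZS.solve 4 (λ x c σ e → x ⋆ (c ⋆ (σ ∸′ # 1) ⊹ σ ⋆ (e ⋆ (# 1 ⊹ e))) ⊹ # 2 ⋆ (x ⋆ ((∸′ σ) ⋆ (c ⊹ (# 1 ⊹ e) ⋆ (# 1 ⊹ e))))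
      ⊜ x ⋆ (c ⋆ ((∸′ σ) ∸′ # 1) ⊹ (∸′ σ) ⋆ ((# 1 ⊹ e) ⋆ (# 1 ⊹ (# 1 ⊹ e))))) refl x c (sgn e) (+ e))
    (cong (λ z → x · (c · (z - 1ℤ) + z · (+ suc e · (1ℤ + + suc e)))) (sym (sgn-suc e)))))

-- Four times the number of odd k ≤ e is 2e + 1 - (-1)ᵉ.
odd-count : ∀ x y e → + 2 · sumℤ e (λ k → odd k · x + y) ≡ x · (+ 2 · + e + 1ℤ - sgn e) + + 2 · + e · y
odd-count x y zero = trans (ZS.solve 2 (λ x y → # 0 ⊜ x ⋆ (# 1 ∸′ # 1) ⊹ # 0 ⋆ y) refl x y)
  (cong (λ z → x · (1ℤ - z) + 0ℤ · y) (sym sgn-zero))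
odd-count x y (suc e) = trans (ℤP.*-distribˡ-+ (+ 2) (sumℤ e _) _) (trans (cong₂ _+_ (odd-count x y e)
    (cong (λ z → + 2 · ((1ℤ - z) · x + y)) (sgn-suc e)))
  (trans (ZS.solve 4 (λ x y σ e → x ⋆ (# 2 ⋆ e ⊹ # 1 ∸′ σ) ⊹ # 2 ⋆ e ⋆ y ⊹ # 2 ⋆ ((# 1 ∸′ (∸′ σ)) ⋆ x ⊹ y)
      ⊜ x ⋆ (# 2 ⋆ (# 1 ⊹ e) ⊹ # 1 ∸′ (∸′ σ)) ⊹ # 2 ⋆ (# 1 ⊹ e) ⋆ y) refl x y (sgn e) (+ e))
    (cong (λ z → x · (+ 2 · + suc e + 1ℤ - z) + + 2 · + suc e · y) (sym (sgn-suc e)))))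

sgn-cancel : ∀ n m → sgn (n ℕ.+ (n ℕ.+ m)) ≡ sgn m
sgn-cancel n m = trans (cong sgn (sym (ℕP.+-assoc n n m))) (trans (sgn-+ (n ℕ.+ n) m) (trans (cong (_· sgn m) (sgn-double n)) (ℤP.*-identityˡ (sgn m))))

odd-cancel : ∀ l j → odd (l ℕ.+ j ℕ.+ l) ≡ odd j
odd-cancel l j = cong (λ z → 1ℤ - z) (trans (cong sgn (ℕP.+-comm (l ℕ.+ j) l)) (sgn-cancel l j))

-- A product is odd exactly when both factors are: (1 - (-1)ⁿᵏ)/2 is the product of (1 - (-1)ⁿ)/2
-- and (1 - (-1)ᵏ)/2.
sgn-* : ∀ n k → + 2 · sgn (n ℕ.* k) ≡ 1ℤ + sgn n + sgn k - sgn n · sgn k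
sgn-* zero    k = trans (cong (+ 2 ·_) sgn-zero) (trans (ZS.solve 1 (λ k → # 2 ⊜ # 1 ⊹ # 1 ⊹ k ∸′ # 1 ⋆ k) refl (sgn k))
  (cong (λ z → 1ℤ + z + sgn k - z · sgn k) (sym sgn-zero)))
sgn-* (suc n) k = trans (cong (+ 2 ·_) (sgn-+ k (n ℕ.* k))) (trans (ZS.solve 2 (λ a b → # 2 ⋆ (a ⋆ b) ⊜ a ⋆ (# 2 ⋆ b)) refl (sgn k) (sgn (n ℕ.* k)))
  (trans (cong (sgn k ·_) (sgn-* n k)) (trans (ZS.solve 2 (λ a b → b ⋆ (# 1 ⊹ a ⊹ b ∸′ a ⋆ b) ⊜ b ⊹ b ⋆ a ⊹ (b ⋆ b) ∸′ a ⋆ (b ⋆ b)) refl (sgn n) (sgn k))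
    (trans (cong (λ z → sgn k + sgn k · sgn n + z - sgn n · z) (sgn-sq k))
      (trans (ZS.solve 2 (λ a b → b ⊹ b ⋆ a ⊹ # 1 ∸′ a ⋆ # 1 ⊜ # 1 ⊹ (∸′ a) ⊹ b ∸′ (∸′ a) ⋆ b) refl (sgn n) (sgn k))
        (cong (λ z → 1ℤ + z + sgn k - z · sgn k) (sym (sgn-suc n))))))))

sum₀ : ℕ → (ℕ → ℤ) → ℤ
sum₀ zero    f = f 0
sum₀ (suc n) f = sum₀ n f + f (suc n)

cube : ℤ → ℤ
cube x = x · x · x

abstract
  Q-shift : ∀ e f n → (Q e ⊗ f) (e ℕ.+ n) ≡ f n
  Q-shift zero    f n = trans (⊗-cong n (λ i _ → Q-zero i) (λ _ _ → refl)) (trans (κ-⊗ᵃ 1ℤ f n) (ℤP.*-identityˡ (f n)))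
  Q-shift (suc e) f n = trans (Q-⊗-suc e f (e ℕ.+ n)) (Q-shift e f n)

-- The ring of power series modulo q^(M+1)

module Truncated (M : ℕ) where

  infix 4 _≈_
  -- At this precision infinite sums and products become finite ones of length `M`; in the
  -- application `M` is (p - 1)/2. A record rather than a function type lets both series be
  -- inferred.
  record _≈_ (f g : PS) : Set where
    constructor mk
    field at : ∀ n → n ℕ.≤ M → f n ≡ g n
  open _≈_ public

  ≈-refl : ∀ {f} → f ≈ f
  ≈-refl = mk λ _ _ → refl

  ≈-sym : ∀ {f g} → f ≈ g → g ≈ f
  ≈-sym p = mk λ n q → sym (at p n q)

  ≈-trans : ∀ {f g h} → f ≈ g → g ≈ h → f ≈ h
  ≈-trans p q = mk λ n r → trans (at p n r) (at q n r)

  ≈-equiv : IsEquivalence _≈_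
  ≈-equiv = record { refl = ≈-refl ; sym = ≈-sym ; trans = ≈-trans }

  abstract
    exact : ∀ {f g} → (∀ n → f n ≡ g n) → f ≈ g
    exact p = mk λ n _ → p n

    ⊕-cong : ∀ {f f′ g g′} → f ≈ f′ → g ≈ g′ → f ⊕ g ≈ f′ ⊕ g′
    ⊕-cong {f} {f′} {g} {g′} p q = mk λ n r → trans (⊕-at f g n) (trans (cong₂ _+_ (at p n r) (at q n r)) (sym (⊕-at f′ g′ n)))

    ⊖-cong : ∀ {f g} → f ≈ g → ⊖ f ≈ ⊖ g
    ⊖-cong {f} {g} p = mk λ n r → trans (⊖-at f n) (trans (cong -_ (at p n r)) (sym (⊖-at g n)))

    ⊗-cong′ : ∀ {f f′ g g′} → f ≈ f′ → g ≈ g′ → f ⊗ g ≈ f′ ⊗ g′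
    ⊗-cong′ p q = mk λ n r → ⊗-cong n (λ i s → at p i (ℕP.≤-trans s r)) (λ i s → at q i (ℕP.≤-trans s r))

    ⊕-assoc : ∀ f g h → (f ⊕ g) ⊕ h ≈ f ⊕ (g ⊕ h)
    ⊕-assoc f g h = exact λ n → trans (⊕-at (f ⊕ g) h n) (trans (cong (_+ h n) (⊕-at f g n))
      (trans (ℤP.+-assoc (f n) (g n) (h n)) (sym (trans (⊕-at f (g ⊕ h) n) (cong (λ z → f n + z) (⊕-at g h n))))))

    ⊕-comm : ∀ f g → f ⊕ g ≈ g ⊕ f
    ⊕-comm f g = exact λ n → trans (⊕-at f g n) (trans (ℤP.+-comm (f n) (g n)) (sym (⊕-at g f n)))

    κ0-at : ∀ n → κ 0ℤ n ≡ 0ℤ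
    κ0-at zero    = κ-zero 0ℤ
    κ0-at (suc n) = κ-suc 0ℤ n

    ⊕-identityˡ : ∀ f → κ 0ℤ ⊕ f ≈ f
    ⊕-identityˡ f = exact λ n → trans (⊕-at (κ 0ℤ) f n) (trans (cong (_+ f n) (κ0-at n)) (ℤP.+-identityˡ (f n)))

    ⊖-inverseˡ : ∀ f → ⊖ f ⊕ f ≈ κ 0ℤ
    ⊖-inverseˡ f = exact λ n → trans (⊕-at (⊖ f) f n) (trans (cong (_+ f n) (⊖-at f n)) (trans (ℤP.+-inverseˡ (f n)) (sym (κ0-at n))))

    ⊗-assoc : ∀ f g h → (f ⊗ g) ⊗ h ≈ f ⊗ (g ⊗ h)
    ⊗-assoc f g h = exact (⊗-assocᵃ f g h)

    ⊗-comm : ∀ f g → f ⊗ g ≈ g ⊗ f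
    ⊗-comm f g = exact (⊗-commᵃ f g)

    ⊗-identityˡ : ∀ f → κ 1ℤ ⊗ f ≈ f
    ⊗-identityˡ f = exact λ n → trans (κ-⊗ᵃ 1ℤ f n) (ℤP.*-identityˡ (f n))

    distribʳ : ∀ h f g → (f ⊕ g) ⊗ h ≈ f ⊗ h ⊕ g ⊗ h
    distribʳ h f g = exact λ n → trans (⊗-distribʳ f g h n) (sym (⊕-at (f ⊗ h) (g ⊗ h) n))

  ⊕-identityʳ : ∀ f → f ⊕ κ 0ℤ ≈ f
  ⊕-identityʳ f = ≈-trans (⊕-comm f (κ 0ℤ)) (⊕-identityˡ f)

  ⊖-inverseʳ : ∀ f → f ⊕ ⊖ f ≈ κ 0ℤ
  ⊖-inverseʳ f = ≈-trans (⊕-comm f (⊖ f)) (⊖-inverseˡ f)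

  ⊗-identityʳ : ∀ f → f ⊗ κ 1ℤ ≈ f
  ⊗-identityʳ f = ≈-trans (⊗-comm f (κ 1ℤ)) (⊗-identityˡ f)

  distribˡ : ∀ h f g → h ⊗ (f ⊕ g) ≈ h ⊗ f ⊕ h ⊗ g
  distribˡ h f g = ≈-trans (⊗-comm h (f ⊕ g)) (≈-trans (distribʳ h f g) (⊕-cong (⊗-comm f h) (⊗-comm g h)))

  isCommutativeRing : IsCommutativeRing _≈_ _⊕_ _⊗_ ⊖_ (κ 0ℤ) (κ 1ℤ)
  isCommutativeRing = record
    { isRing = record
      { +-isAbelianGroup = record
        { isGroup = record
          { isMonoid = record
            { isSemigroup = record
              { isMagma = record { isEquivalence = ≈-equiv ; ∙-cong = ⊕-cong }
              ; assoc = ⊕-assoc }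
            ; identity = ⊕-identityˡ , ⊕-identityʳ }
          ; inverse = ⊖-inverseˡ , ⊖-inverseʳ
          ; ⁻¹-cong = ⊖-cong }
        ; comm = ⊕-comm }
      ; *-cong = ⊗-cong′
      ; *-assoc = ⊗-assoc
      ; *-identity = ⊗-identityˡ , ⊗-identityʳ
      ; distrib = distribˡ , distribʳ }
    ; *-comm = ⊗-comm }

  seriesRing : CommutativeRing 0ℓ 0ℓ
  seriesRing = record { isCommutativeRing = isCommutativeRing }

  ≈-setoid : Setoid 0ℓ 0ℓ
  ≈-setoid = record { isEquivalence = ≈-equiv }

  module ≈R = SetoidR ≈-setoid
  open ≈R

  abstract
    κ-+ : ∀ a b → κ (a + b) ≈ κ a ⊕ κ b
    κ-+ a b = exact λ { zero → trans (κ-zero (a + b)) (sym (trans (⊕-at (κ a) (κ b) 0) (cong₂ _+_ (κ-zero a) (κ-zero b))))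
                      ; (suc n) → trans (κ-suc (a + b) n) (sym (trans (⊕-at (κ a) (κ b) (suc n)) (cong₂ _+_ (κ-suc a n) (κ-suc b n)))) }

    κ-* : ∀ a b → κ (a · b) ≈ κ a ⊗ κ b
    κ-* a b = exact λ { zero → trans (κ-zero (a · b)) (sym (trans (κ-⊗ᵃ a (κ b) 0) (cong (a ·_) (κ-zero b))))
                      ; (suc n) → trans (κ-suc (a · b) n) (sym (trans (κ-⊗ᵃ a (κ b) (suc n)) (trans (cong (a ·_) (κ-suc b n)) (ℤP.*-zeroʳ a)))) }

    κ-neg : ∀ a → κ (- a) ≈ ⊖ κ a
    κ-neg a = exact λ { zero → trans (κ-zero (- a)) (sym (trans (⊖-at (κ a) 0) (cong -_ (κ-zero a))))
                      ; (suc n) → trans (κ-suc (- a) n) (sym (trans (⊖-at (κ a) (suc n)) (cong -_ (κ-suc a n)))) }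

  ACR : AlmostCommutativeRing 0ℓ 0ℓ
  ACR = fromCommutativeRing seriesRing

  κ-morphism : ℤ.+-*-rawRing -Raw-AlmostCommutative⟶ ACR
  κ-morphism = record { ⟦_⟧ = κ ; +-homo = κ-+ ; *-homo = κ-* ; -‿homo = κ-neg ; 0-homo = ≈-refl ; 1-homo = ≈-refl }

  κ-dec : WeaklyDecidable (Induced-equivalence κ-morphism)
  κ-dec x y with x ℤ.≟ y
  ... | yes p = just (subst (λ z → κ x ≈ κ z) p ≈-refl)
  ... | no _  = nothing

  module RS = Algebra.Solver.Ring ℤ.+-*-rawRing ACR κ-morphism κ-dec
  open RS public using (solve; _:=_; _:+_; _:*_; _:-_; :-_; Polynomial) renaming (con to conℤ)

  con : ∀ {n} → ℕ → Polynomial n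
  con k = conℤ (+ k)

  abstract
    D-cong : ∀ {f g} → f ≈ g → D f ≈ D g
    D-cong {f} {g} p = mk λ n r → trans (D-at f n) (trans (cong (+ n ·_) (at p n r)) (sym (D-at g n)))

    D-⊕ : ∀ f g → D (f ⊕ g) ≈ D f ⊕ D g
    D-⊕ f g = exact λ n → trans (D-at (f ⊕ g) n) (trans (cong (+ n ·_) (⊕-at f g n)) (trans (ℤP.*-distribˡ-+ (+ n) (f n) (g n))
      (sym (trans (⊕-at (D f) (D g) n) (cong₂ _+_ (D-at f n) (D-at g n))))))

    D-⊗ : ∀ f g → D (f ⊗ g) ≈ D f ⊗ g ⊕ f ⊗ D g
    D-⊗ f g = exact λ n → trans (D-⊗ᵃ f g n) (sym (⊕-at (D f ⊗ g) (f ⊗ D g) n))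

    D-⊖ : ∀ f → D (⊖ f) ≈ ⊖ D f
    D-⊖ f = exact λ n → trans (D-at (⊖ f) n) (trans (cong (+ n ·_) (⊖-at f n)) (trans (sym (ℤP.neg-distribʳ-* (+ n) (f n))) (sym (trans (⊖-at (D f) n) (cong -_ (D-at f n))))))

    D-κ : ∀ c → D (κ c) ≈ κ 0ℤ
    D-κ c = exact λ { zero → trans (D-at (κ c) 0) (sym (κ0-at 0)) ; (suc n) → trans (D-at (κ c) (suc n)) (trans (cong (+ suc n ·_) (κ-suc c n)) (trans (ℤP.*-zeroʳ (+ suc n)) (sym (κ0-at (suc n))))) }

  D-κ⊗ : ∀ c f → D (κ c ⊗ f) ≈ κ c ⊗ D f
  D-κ⊗ c f = ≈-trans (D-⊗ (κ c) f) (≈-trans (⊕-cong (⊗-cong′ (D-κ c) ≈-refl) ≈-refl)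
    (solve 3 (λ c f d → con 0 :* f :+ c :* d := c :* d) ≈-refl (κ c) f (D f)))

  abstract
    N-cong : ∀ {f g} → f ≈ g → N f ≈ N g
    N-cong {f} {g} p = mk λ n r → trans (N-at f n) (trans (cong (sgn n ·_) (at p n r)) (sym (N-at g n)))

    N-⊕ : ∀ f g → N (f ⊕ g) ≈ N f ⊕ N g
    N-⊕ f g = exact λ n → trans (N-at (f ⊕ g) n) (trans (cong (sgn n ·_) (⊕-at f g n)) (trans (ℤP.*-distribˡ-+ (sgn n) (f n) (g n))
      (sym (trans (⊕-at (N f) (N g) n) (cong₂ _+_ (N-at f n) (N-at g n))))))

    N-⊗ : ∀ f g → N (f ⊗ g) ≈ N f ⊗ N g
    N-⊗ f g = exact (N-⊗ᵃ f g)

    N-κ : ∀ c → N (κ c) ≈ κ c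
    N-κ c = exact λ { zero → trans (N-at (κ c) 0) (trans (cong (_· κ c 0) sgn-zero) (ℤP.*-identityˡ (κ c 0)))
                    ; (suc n) → trans (N-at (κ c) (suc n)) (trans (cong (sgn (suc n) ·_) (κ-suc c n)) (trans (ℤP.*-zeroʳ (sgn (suc n))) (sym (κ-suc c n)))) }

    N-D : ∀ f → N (D f) ≈ D (N f)
    N-D f = exact λ n → trans (N-at (D f) n) (trans (cong (sgn n ·_) (D-at f n)) (trans (ZS.solve 3 (λ e n x → e ⋆ (n ⋆ x) ⊜ n ⋆ (e ⋆ x)) refl (sgn n) (+ n) (f n))
      (sym (trans (D-at (N f) n) (cong (+ n ·_) (N-at f n))))))

    N-Q : ∀ e → N (Q e) ≈ κ (sgn e) ⊗ Q e
    N-Q e = exact λ n → trans (N-Qᵃ e n) (sym (κ-⊗ᵃ (sgn e) (Q e) n))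

    V-cong : ∀ {f g} → f ≈ g → V f ≈ V g
    V-cong p = mk λ n r → V-congᵃ n (λ i i≤n → at p i (ℕP.≤-trans i≤n r))

    V-⊕ : ∀ f g → V (f ⊕ g) ≈ V f ⊕ V g
    V-⊕ f g = exact λ n → trans (V-⊕ᵃ f g n) (sym (⊕-at (V f) (V g) n))

    V-⊗ : ∀ f g → V (f ⊗ g) ≈ V f ⊗ V g
    V-⊗ f g = exact (V-⊗ᵃ f g)

    V-κ : ∀ c → V (κ c) ≈ κ c
    V-κ c = exact (κ-V c)

    V-D : ∀ f → D (V f) ≈ κ (+ 2) ⊗ V (D f)
    V-D f = exact λ n → trans (D-V f n) (sym (κ-⊗ᵃ (+ 2) (V (D f)) n))

    V-Q : ∀ e → V (Q e) ≈ Q (e ℕ.+ e)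
    V-Q e = exact (V-Qᵃ e)

    Q-+ : ∀ d e → Q (d ℕ.+ e) ≈ Q d ⊗ Q e
    Q-+ d e = exact (Q-+ᵃ d e)

    D-Q : ∀ e → D (Q e) ≈ κ (+ e) ⊗ Q e
    D-Q e = exact λ n → trans (D-Qᵃ e n) (sym (κ-⊗ᵃ (+ e) (Q e) n))

    Q-vanish : ∀ e → M ℕ.< e → Q e ≈ κ 0ℤ
    Q-vanish e M<e = mk λ n r → trans (Q-big e n (ℕP.≤-<-trans r M<e)) (sym (κ0-at n))

    κ-cancel : ∀ c → .{{_ : ℤ.NonZero c}} → ∀ {f g} → κ c ⊗ f ≈ κ c ⊗ g → f ≈ g
    κ-cancel c {f} {g} p = mk λ n r → ℤP.*-cancelˡ-≡ c (f n) (g n) (trans (sym (κ-⊗ᵃ c f n)) (trans (at p n r) (κ-⊗ᵃ c g n)))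

    κ-⊗ : ∀ c f n → (κ c ⊗ f) n ≡ c · f n
    κ-⊗ = κ-⊗ᵃ

  -- Finite sums of series and their rearrangement

  S : ℕ → (ℕ → PS) → PS
  S zero    f = κ 0ℤ
  S (suc K) f = S K f ⊕ f (suc K)

  S-cong : ∀ K {f g} → (∀ i → f (suc i) ≈ g (suc i)) → S K f ≈ S K g
  S-cong zero    p = ≈-refl
  S-cong (suc K) p = ⊕-cong (S-cong K p) (p K)

  S-⊕ : ∀ K f g → S K (λ i → f i ⊕ g i) ≈ S K f ⊕ S K g
  S-⊕ zero    f g = solve 0 (con 0 := con 0 :+ con 0) ≈-refl
  S-⊕ (suc K) f g = ≈-trans (⊕-cong (S-⊕ K f g) ≈-refl)
    (solve 4 (λ a b c d → (a :+ b) :+ (c :+ d) := (a :+ c) :+ (b :+ d)) ≈-refl (S K f) (S K g) (f (suc K)) (g (suc K)))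

  S-⊗ˡ : ∀ K c f → S K (λ i → c ⊗ f i) ≈ c ⊗ S K f
  S-⊗ˡ zero    c f = solve 1 (λ c → con 0 := c :* con 0) ≈-refl c
  S-⊗ˡ (suc K) c f = ≈-trans (⊕-cong (S-⊗ˡ K c f) ≈-refl) (≈-sym (distribˡ c (S K f) (f (suc K))))

  S-⊗ʳ : ∀ K c f → S K (λ i → f i ⊗ c) ≈ S K f ⊗ c
  S-⊗ʳ K c f = ≈-trans (S-cong K (λ i → ⊗-comm (f (suc i)) c)) (≈-trans (S-⊗ˡ K c f) (⊗-comm c (S K f)))

  S-zero : ∀ K {f} → (∀ i → f (suc i) ≈ κ 0ℤ) → S K f ≈ κ 0ℤ
  S-zero zero    p = ≈-refl
  S-zero (suc K) p = ≈-trans (⊕-cong (S-zero K p) (p K)) (⊕-identityˡ (κ 0ℤ))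

  S-swap : ∀ K L (F : ℕ → ℕ → PS) → S K (λ i → S L (λ j → F i j)) ≈ S L (λ j → S K (λ i → F i j))
  S-swap zero    L F = ≈-sym (S-zero L (λ _ → ≈-refl))
  S-swap (suc K) L F = ≈-trans (⊕-cong (S-swap K L F) ≈-refl) (≈-sym (S-⊕ L _ _))

  S-head : ∀ K f → S (suc K) f ≈ f 1 ⊕ S K (λ i → f (suc i))
  S-head zero    f = ⊕-comm (κ 0ℤ) (f 1)
  S-head (suc K) f = ≈-trans (⊕-cong (S-head K f) ≈-refl) (⊕-assoc _ _ _)

  S-D : ∀ K f → D (S K f) ≈ S K (λ i → D (f i))
  S-D zero    f = D-κ 0ℤ
  S-D (suc K) f = ≈-trans (D-⊕ _ _) (⊕-cong (S-D K f) ≈-refl)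

  S-V : ∀ K f → V (S K f) ≈ S K (λ i → V (f i))
  S-V zero    f = V-κ 0ℤ
  S-V (suc K) f = ≈-trans (V-⊕ _ _) (⊕-cong (S-V K f) ≈-refl)

  S-N : ∀ K f → N (S K f) ≈ S K (λ i → N (f i))
  S-N zero    f = N-κ 0ℤ
  S-N (suc K) f = ≈-trans (N-⊕ _ _) (⊕-cong (S-N K f) ≈-refl)

  S-κ : ∀ K (f : ℕ → ℤ) → S K (λ i → κ (f i)) ≈ κ (sumℤ K f)
  S-κ zero    f = ≈-refl
  S-κ (suc K) f = ≈-trans (⊕-cong (S-κ K f) ≈-refl) (≈-sym (κ-+ _ _))

  -- The tail of such a family is invisible modulo q^(M+1), so `S M` stands for the full infinite
  -- sum and may be reindexed freely.
  Vanishing : (ℕ → PS) → Set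
  Vanishing f = ∀ l → M ℕ.< l → f l ≈ κ 0ℤ

  S-extend : ∀ K f → Vanishing f → S (K ℕ.+ M) f ≈ S M f
  S-extend zero    f v = ≈-refl
  S-extend (suc K) f v = ≈-trans (⊕-cong (S-extend K f v) (v (suc K ℕ.+ M) (s≤s (ℕP.m≤n+m M K)))) (⊕-identityʳ _)

  -- The substitution l = k + j. Both sums have `M` terms although the range is shifted: the surplus
  -- terms vanish.
  S-upper : ∀ k f → Vanishing f → S M (λ l → κ (lt k l) ⊗ f l) ≈ S M (λ j → f (k ℕ.+ j))
  S-upper zero    f v = S-cong M (λ i → ⊗-identityˡ _)
  S-upper (suc k) f v = begin
    S M (λ l → κ (lt (suc k) l) ⊗ f l)
      ≈⟨ S-extend 1 _ (λ l M<l → ≈-trans (⊗-cong′ ≈-refl (v l M<l)) (z0 _)) ⟨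
    S (suc M) (λ l → κ (lt (suc k) l) ⊗ f l)
      ≈⟨ S-head M _ ⟩
    κ 0ℤ ⊗ f 1 ⊕ S M (λ l → κ (lt k l) ⊗ f (suc l))
      ≈⟨ solve 2 (λ a b → con 0 :* a :+ b := b) ≈-refl (f 1) _ ⟩
    S M (λ l → κ (lt k l) ⊗ f (suc l))
      ≈⟨ S-upper k (λ l → f (suc l)) (λ l M<l → v (suc l) (ℕP.m≤n⇒m≤1+n M<l)) ⟩
    S M (λ j → f (suc (k ℕ.+ j))) ∎
    where
    z0 : ∀ c → c ⊗ κ 0ℤ ≈ κ 0ℤ
    z0 c = solve 1 (λ c → c :* con 0 := con 0) ≈-refl c

  S-eq : ∀ k f → Vanishing f → S M (λ l → κ (eq (suc k) l) ⊗ f l) ≈ f (suc k)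
  S-eq k f v = ≈-trans (lem M k f) (absorb k)
    where
    lem : ∀ K k f → S K (λ l → κ (eq (suc k) l) ⊗ f l) ≈ κ (lt k K) ⊗ f (suc k)
    lem zero k f = solve 1 (λ c → con 0 := con 0 :* c) ≈-refl (f (suc k))
    lem (suc K) zero f = ≈-trans (S-head K _) (≈-trans (⊕-cong ≈-refl (S-zero K (λ i → solve 1 (λ a → con 0 :* a := con 0) ≈-refl (f (suc (suc i)))))) (⊕-identityʳ _))
    lem (suc K) (suc k) f = ≈-trans (S-head K _) (≈-trans (solve 2 (λ a b → con 0 :* a :+ b := b) ≈-refl (f 1) _) (lem K k (λ l → f (suc l))))
    lt-yes : ∀ k K → k ℕ.< K → lt k K ≡ 1ℤ
    lt-yes zero    (suc K) _ = refl
    lt-yes (suc k) (suc K) (s≤s p) = lt-yes k K p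
    absorb : ∀ k → κ (lt k M) ⊗ f (suc k) ≈ f (suc k)
    absorb k with ℕP.<-≤-connex k M
    ... | inj₁ k<M rewrite lt-yes k M k<M = ⊗-identityˡ _
    ... | inj₂ M≤k = ≈-trans (⊗-cong′ ≈-refl (v (suc k) (s≤s M≤k))) (≈-trans (solve 1 (λ c → c :* con 0 := con 0) ≈-refl _) (≈-sym (v (suc k) (s≤s M≤k))))

  S-trichotomy : (H : ℕ → ℕ → PS) → (∀ k → Vanishing (H (suc k))) → (∀ l → Vanishing (λ k → H k (suc l))) →
    S M (λ k → S M (λ l → H k l)) ≈
      S M (λ k → S M (λ j → H k (k ℕ.+ j))) ⊕ S M (λ k → H k k) ⊕ S M (λ j → S M (λ l → H (l ℕ.+ j) l))
  S-trichotomy H v₁ v₂ = begin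
    S M (λ k → S M (λ l → H k l))
      ≈⟨ S-cong M (λ k → ≈-trans (S-cong M (λ l → split (suc k) (suc l))) (≈-trans (S-⊕ M _ _) (⊕-cong (S-⊕ M _ _) ≈-refl))) ⟩
    S M (λ k → S M (λ l → κ (lt k l) ⊗ H k l) ⊕ S M (λ l → κ (eq k l) ⊗ H k l) ⊕ S M (λ l → κ (lt l k) ⊗ H k l))
      ≈⟨ ≈-trans (S-⊕ M _ _) (⊕-cong (S-⊕ M _ _) ≈-refl) ⟩
    S M (λ k → S M (λ l → κ (lt k l) ⊗ H k l)) ⊕ S M (λ k → S M (λ l → κ (eq k l) ⊗ H k l)) ⊕ S M (λ k → S M (λ l → κ (lt l k) ⊗ H k l))
      ≈⟨ ⊕-cong (⊕-cong (S-cong M (λ k → S-upper (suc k) (H (suc k)) (v₁ k))) (S-cong M (λ k → S-eq k (H (suc k)) (v₁ k))))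
           (≈-trans (S-swap M M _) (≈-trans (S-cong M (λ l → S-upper (suc l) (λ k → H k (suc l)) (v₂ l))) (S-swap M M _))) ⟩
    S M (λ k → S M (λ j → H k (k ℕ.+ j))) ⊕ S M (λ k → H k k) ⊕ S M (λ j → S M (λ l → H (l ℕ.+ j) l)) ∎
    where
    split : ∀ k l → H k l ≈ κ (lt k l) ⊗ H k l ⊕ κ (eq k l) ⊗ H k l ⊕ κ (lt l k) ⊗ H k l
    split k l = ≈-sym (≈-trans (solve 4 (λ a b c h → a :* h :+ b :* h :+ c :* h := (a :+ b :+ c) :* h) ≈-refl (κ (lt k l)) (κ (eq k l)) (κ (lt l k)) (H k l))
      (≈-trans (⊗-cong′ (≈-trans (⊕-cong (≈-sym (κ-+ _ _)) ≈-refl) (≈-trans (≈-sym (κ-+ _ _)) (subst (λ z → κ z ≈ κ 1ℤ) (sym (trichotomy k l)) ≈-refl))) ≈-refl) (⊗-identityˡ _)))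

  -- 1 + (-1)ⁿ is twice the indicator of even n.
  S-even : ∀ f → Vanishing f → S M (λ n → κ (1ℤ + sgn n) ⊗ f n) ≈ κ (+ 2) ⊗ S M (λ n → f (n ℕ.+ n))
  S-even f v = ≈-trans (≈-sym (S-extend M _ (λ l M<l → ≈-trans (⊗-cong′ ≈-refl (v l M<l)) (solve 1 (λ c → c :* con 0 := con 0) ≈-refl _)))) (lem M)
    where
    lem : ∀ K → S (K ℕ.+ K) (λ n → κ (1ℤ + sgn n) ⊗ f n) ≈ κ (+ 2) ⊗ S K (λ n → f (n ℕ.+ n))
    lem zero = solve 0 (con 0 := con 2 :* con 0) ≈-refl
    lem (suc K) rewrite ℕP.+-suc K K | sgn-suc (suc (K ℕ.+ K)) | sgn-suc (K ℕ.+ K) | sgn-double K =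
      ≈-trans (⊕-cong (⊕-cong (lem K) ≈-refl) ≈-refl)
        (solve 3 (λ a b c → con 2 :* a :+ con 0 :* b :+ con 2 :* c := con 2 :* (a :+ c)) ≈-refl _ _ _)

  -- Liouville's identity

  infix 7.5 _·Q_
  _·Q_ : ℤ → ℕ → PS
  c ·Q e = κ c ⊗ Q e

  ·Q-vanish : ∀ c e → M ℕ.< e → c ·Q e ≈ κ 0ℤ
  ·Q-vanish c e M<e = ≈-trans (⊗-cong′ ≈-refl (Q-vanish e M<e)) (solve 1 (λ c → c :* con 0 := con 0) ≈-refl (κ c))

  ·Q-cong : ∀ {c d e f} → c ≡ d → e ≡ f → c ·Q e ≈ d ·Q f
  ·Q-cong refl refl = ≈-refl

  Q-≡ : ∀ {d e} → d ≡ e → Q d ≈ Q e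
  Q-≡ refl = ≈-refl

  ·Q-+ : ∀ c d e → c ·Q e ⊕ d ·Q e ≈ (c + d) ·Q e
  ·Q-+ c d e = ≈-trans (≈-sym (distribʳ (Q e) (κ c) (κ d))) (⊗-cong′ (≈-sym (κ-+ c d)) ≈-refl)

  ·Q-* : ∀ c d e → κ c ⊗ d ·Q e ≈ (c · d) ·Q e
  ·Q-* c d e = ≈-trans (≈-sym (⊗-assoc (κ c) (κ d) (Q e))) (⊗-cong′ (≈-sym (κ-* c d)) ≈-refl)

  quad : (ℕ → ℕ → ℕ → ℕ → PS) → PS
  quad F = S M λ n → S M λ m → S M λ k → S M λ l → F n m k l

  quad-cong : ∀ {F G} → (∀ n m k l → F (suc n) (suc m) (suc k) (suc l) ≈ G (suc n) (suc m) (suc k) (suc l)) → quad F ≈ quad G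
  quad-cong p = S-cong M λ n → S-cong M λ m → S-cong M λ k → S-cong M λ l → p n m k l

  quad-swap : ∀ F → quad F ≈ quad (λ n m k l → F m n l k)
  quad-swap F = ≈-trans (S-swap M M (λ n m → S M λ k → S M λ l → F n m k l)) (S-cong M λ m → S-cong M λ n → S-swap M M (F (suc n) (suc m)))

  quad-transpose : ∀ F → quad F ≈ quad (λ k l n m → F n m k l)
  quad-transpose F = begin
    quad F
      ≈⟨ S-cong M (λ n → S-swap M M (λ m k → S M λ l → F (suc n) m k l)) ⟩
    (S M λ n → S M λ k → S M λ m → S M λ l → F n m k l)
      ≈⟨ S-cong M (λ n → S-cong M λ k → S-swap M M (λ m l → F (suc n) m (suc k) l)) ⟩
    (S M λ n → S M λ k → S M λ l → S M λ m → F n m k l)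
      ≈⟨ S-swap M M (λ n k → S M λ l → S M λ m → F n m k l) ⟩
    (S M λ k → S M λ n → S M λ l → S M λ m → F n m k l)
      ≈⟨ S-cong M (λ k → S-swap M M (λ n l → S M λ m → F n m (suc k) l)) ⟩
    (S M λ k → S M λ l → S M λ n → S M λ m → F n m k l) ∎

  quad-⊕ : ∀ F G → quad (λ n m k l → F n m k l ⊕ G n m k l) ≈ quad F ⊕ quad G
  quad-⊕ F G = begin
    quad (λ n m k l → F n m k l ⊕ G n m k l)
      ≈⟨ S-cong M (λ n → S-cong M λ m → S-cong M λ k → S-⊕ M (F (suc n) (suc m) (suc k)) (G (suc n) (suc m) (suc k))) ⟩
    (S M λ n → S M λ m → S M λ k → S M (F n m k) ⊕ S M (G n m k))
      ≈⟨ S-cong M (λ n → S-cong M λ m → S-⊕ M (λ k → S M (F (suc n) (suc m) k)) (λ k → S M (G (suc n) (suc m) k))) ⟩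
    (S M λ n → S M λ m → (S M λ k → S M (F n m k)) ⊕ (S M λ k → S M (G n m k)))
      ≈⟨ S-cong M (λ n → S-⊕ M (λ m → S M λ k → S M (F (suc n) m k)) (λ m → S M λ k → S M (G (suc n) m k))) ⟩
    (S M λ n → (S M λ m → S M λ k → S M (F n m k)) ⊕ (S M λ m → S M λ k → S M (G n m k)))
      ≈⟨ S-⊕ M _ _ ⟩
    quad F ⊕ quad G ∎

  S²-⊕₃ : ∀ (F G H : ℕ → ℕ → PS) → (S M λ i → S M λ j → F i j ⊕ G i j ⊕ H i j) ≈
    (S M λ i → S M λ j → F i j) ⊕ (S M λ i → S M λ j → G i j) ⊕ (S M λ i → S M λ j → H i j)
  S²-⊕₃ F G H = begin
    (S M λ i → S M λ j → F i j ⊕ G i j ⊕ H i j)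
      ≈⟨ S-cong M (λ i → ≈-trans (S-⊕ M (λ j → F (suc i) j ⊕ G (suc i) j) (H (suc i))) (⊕-cong (S-⊕ M (F (suc i)) (G (suc i))) ≈-refl)) ⟩
    (S M λ i → S M (F i) ⊕ S M (G i) ⊕ S M (H i))
      ≈⟨ ≈-trans (S-⊕ M (λ i → S M (F i) ⊕ S M (G i)) (λ i → S M (H i))) (⊕-cong (S-⊕ M (λ i → S M (F i)) (λ i → S M (G i))) ≈-refl) ⟩
    (S M λ i → S M λ j → F i j) ⊕ (S M λ i → S M λ j → G i j) ⊕ (S M λ i → S M λ j → H i j) ∎

  -- Sums over the quadruples (n, m, k, l) of positive integers, weighted by q^(nk + ml); the suffixes restrict to
  -- k < l, k > l, k = l and so on, the larger of the two being written as the smaller plus a new variable.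
  Weight : Set
  Weight = ℕ → ℕ → ℕ → ℕ → ℤ

  all kl< kl> kl= nm> nm< nm= : Weight → PS
  all c = quad λ n m k l → c n m k l ·Q (n ℕ.* k ℕ.+ m ℕ.* l)
  kl< c = quad λ n m k j → c n m k (k ℕ.+ j) ·Q (n ℕ.* k ℕ.+ m ℕ.* (k ℕ.+ j))
  kl> c = quad λ n m j l → c n m (l ℕ.+ j) l ·Q (n ℕ.* (l ℕ.+ j) ℕ.+ m ℕ.* l)
  kl= c = S M λ n → S M λ m → S M λ k → c n m k k ·Q (n ℕ.* k ℕ.+ m ℕ.* k)
  nm< c = quad λ n i k l → c n (n ℕ.+ i) k l ·Q (n ℕ.* k ℕ.+ (n ℕ.+ i) ℕ.* l)
  nm> c = quad λ i m k l → c (m ℕ.+ i) m k l ·Q ((m ℕ.+ i) ℕ.* k ℕ.+ m ℕ.* l)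
  nm= c = S M λ n → S M λ k → S M λ l → c n n k l ·Q (n ℕ.* k ℕ.+ n ℕ.* l)

  big₁ : ∀ n k r → M ℕ.< k → M ℕ.< suc n ℕ.* k ℕ.+ r
  big₁ n k r M<k = ℕP.<-≤-trans M<k (ℕP.≤-trans (ℕP.m≤m+n k (n ℕ.* k)) (ℕP.m≤m+n (suc n ℕ.* k) r))

  big₂ : ∀ n k r → M ℕ.< k → M ℕ.< r ℕ.+ suc n ℕ.* k
  big₂ n k r M<k = ℕP.<-≤-trans M<k (ℕP.≤-trans (ℕP.m≤m+n k (n ℕ.* k)) (ℕP.m≤n+m (suc n ℕ.* k) r))

  big₁′ : ∀ n k r → M ℕ.< n → M ℕ.< n ℕ.* suc k ℕ.+ r
  big₁′ n k r M<n rewrite ℕP.*-comm n (suc k) = big₁ k n r M<n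

  big₂′ : ∀ n k r → M ℕ.< n → M ℕ.< r ℕ.+ n ℕ.* suc k
  big₂′ n k r M<n rewrite ℕP.*-comm n (suc k) = big₂ k n r M<n

  split-kl : ∀ c → all c ≈ kl< c ⊕ kl= c ⊕ kl> c
  split-kl c = ≈-trans (S-cong M λ n → S-cong M λ m →
      S-trichotomy (λ k l → c (suc n) (suc m) k l ·Q (suc n ℕ.* k ℕ.+ suc m ℕ.* l))
        (λ k l M<l → ·Q-vanish _ _ (big₂ m l (suc n ℕ.* suc k) M<l))
        (λ l k M<k → ·Q-vanish _ _ (big₁ n k (suc m ℕ.* suc l) M<k)))
    (S²-⊕₃ (λ n m → S M λ k → S M λ j → c n m k (k ℕ.+ j) ·Q (n ℕ.* k ℕ.+ m ℕ.* (k ℕ.+ j)))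
           (λ n m → S M λ k → c n m k k ·Q (n ℕ.* k ℕ.+ m ℕ.* k))
           (λ n m → S M λ j → S M λ l → c n m (l ℕ.+ j) l ·Q (n ℕ.* (l ℕ.+ j) ℕ.+ m ℕ.* l)))

  split-nm : ∀ c → all c ≈ nm< c ⊕ nm= c ⊕ nm> c
  split-nm c = begin
    all c
      ≈⟨ quad-transpose (λ n m k l → c n m k l ·Q (n ℕ.* k ℕ.+ m ℕ.* l)) ⟩
    (S M λ k → S M λ l → S M λ n → S M λ m → c n m k l ·Q (n ℕ.* k ℕ.+ m ℕ.* l))
      ≈⟨ S-cong M (λ k → S-cong M λ l → S-trichotomy (λ n m → c n m (suc k) (suc l) ·Q (n ℕ.* suc k ℕ.+ m ℕ.* suc l))
           (λ n m M<m → ·Q-vanish _ _ (big₂′ m l (suc n ℕ.* suc k) M<m))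
           (λ m n M<n → ·Q-vanish _ _ (big₁′ n k (suc m ℕ.* suc l) M<n))) ⟩
    (S M λ k → S M λ l → F₁ k l ⊕ F₂ k l ⊕ F₃ k l)
      ≈⟨ S²-⊕₃ F₁ F₂ F₃ ⟩
    (S M λ k → S M λ l → F₁ k l) ⊕ (S M λ k → S M λ l → F₂ k l) ⊕ (S M λ k → S M λ l → F₃ k l)
      ≈⟨ ⊕-cong (⊕-cong (quad-transpose (λ k l n i → c n (n ℕ.+ i) k l ·Q (n ℕ.* k ℕ.+ (n ℕ.+ i) ℕ.* l)))
           (≈-trans (S-cong M λ k → S-swap M M (λ l n → G (suc k) l n)) (S-swap M M (λ k n → S M λ l → G k l n))))
           (quad-transpose (λ k l i m → c (m ℕ.+ i) m k l ·Q ((m ℕ.+ i) ℕ.* k ℕ.+ m ℕ.* l))) ⟩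
    nm< c ⊕ nm= c ⊕ nm> c ∎
    where
    G : ℕ → ℕ → ℕ → PS
    G k l n = c n n k l ·Q (n ℕ.* k ℕ.+ n ℕ.* l)
    F₁ F₂ F₃ : ℕ → ℕ → PS
    F₁ k l = S M λ n → S M λ i → c n (n ℕ.+ i) k l ·Q (n ℕ.* k ℕ.+ (n ℕ.+ i) ℕ.* l)
    F₂ k l = S M λ n → G k l n
    F₃ k l = S M λ i → S M λ m → c (m ℕ.+ i) m k l ·Q ((m ℕ.+ i) ℕ.* k ℕ.+ m ℕ.* l)

  -- nk + m(k + j) = (m + n)k + mj
  shear< : ∀ {c c′} → (∀ n m k j → c n m k (k ℕ.+ j) ≡ c′ (m ℕ.+ n) m k j) → kl< c ≈ nm> c′
  shear< p = quad-cong λ n m k j → ·Q-cong (p (suc n) (suc m) (suc k) (suc j))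
    (NS.solve 4 (λ n m k j → n NS.:* k NS.:+ m NS.:* (k NS.:+ j) NS.:= (m NS.:+ n) NS.:* k NS.:+ m NS.:* j) refl (suc n) (suc m) (suc k) (suc j))

  -- n(l + j) + ml = nj + (n + m)l
  shear> : ∀ {c c′} → (∀ n m j l → c n m (l ℕ.+ j) l ≡ c′ n (n ℕ.+ m) j l) → kl> c ≈ nm< c′
  shear> p = quad-cong λ n m j l → ·Q-cong (p (suc n) (suc m) (suc j) (suc l))
    (NS.solve 4 (λ n m j l → n NS.:* (l NS.:+ j) NS.:+ m NS.:* l NS.:= n NS.:* j NS.:+ (n NS.:+ m) NS.:* l) refl (suc n) (suc m) (suc j) (suc l))

  swap-nm : ∀ {c c′} → (∀ n m k l → c n m k l ≡ c′ m n l k) → nm< c ≈ nm> c′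
  swap-nm {c} {c′} p = ≈-trans (quad-swap (λ n i k l → c n (n ℕ.+ i) k l ·Q (n ℕ.* k ℕ.+ (n ℕ.+ i) ℕ.* l))) (quad-cong λ i n l k → ·Q-cong (p (suc n) (suc n ℕ.+ suc i) (suc k) (suc l)) (ℕP.+-comm (suc n ℕ.* suc k) _))

  swap-kl : ∀ {c c′} → (∀ n m k l → c n m k l ≡ c′ m n l k) → kl> c ≈ kl< c′
  swap-kl {c} {c′} p = ≈-trans (quad-swap (λ n m j l → c n m (l ℕ.+ j) l ·Q (n ℕ.* (l ℕ.+ j) ℕ.+ m ℕ.* l))) (quad-cong λ n m k j → ·Q-cong (p (suc m) (suc n) (suc k ℕ.+ suc j) (suc k)) (ℕP.+-comm (suc m ℕ.* (suc k ℕ.+ suc j)) _))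

  all-+ : ∀ c d → all (λ n m k l → c n m k l + d n m k l) ≈ all c ⊕ all d
  all-+ c d = ≈-trans (quad-cong λ n m k l → ≈-sym (·Q-+ _ _ _)) (quad-⊕ _ _)

  kl<-+ : ∀ c d → kl< (λ n m k l → c n m k l + d n m k l) ≈ kl< c ⊕ kl< d
  kl<-+ c d = ≈-trans (quad-cong λ n m k l → ≈-sym (·Q-+ _ _ _)) (quad-⊕ _ _)

  nm>-+ : ∀ c d → nm> (λ n m k l → c n m k l + d n m k l) ≈ nm> c ⊕ nm> d
  nm>-+ c d = ≈-trans (quad-cong λ n m k l → ≈-sym (·Q-+ _ _ _)) (quad-⊕ _ _)

  -- The difference c₁ - c₂ is 4 · odd k · (-1)ᵐ · nm, four times the weight of a product of two
  -- Lambert series. The weights α are what the shears make of `c₁` and `c₂`, and `δ` is built to be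
  -- invariant under a shear.
  α₁ α₂ α₃ δ c₁ c₂ : Weight
  α₁ n m k l = odd k · sgn m · (+ n · + n)
  α₂ n m k l = odd (k ℕ.+ l) · sgn (n ℕ.+ m) · (+ n · + n)
  α₃ n m k l = odd (k ℕ.+ l) · sgn (n ℕ.+ m) · (+ m · + m)
  δ n m k l  = α₁ n m k l + α₂ n m k l
  c₁ n m k l = odd k · sgn m · ((+ n + + m) · (+ n + + m))
  c₂ n m k l = odd k · sgn m · ((+ n - + m) · (+ n - + m))

  α₃-α₂ : ∀ n m k l → α₃ n m k l ≡ α₂ m n l k
  α₃-α₂ n m k l = cong₂ (λ x y → odd x · sgn y · (+ m · + m)) (ℕP.+-comm k l) (ℕP.+-comm n m)

  -- On k < l the shear turns n + m into the new n, which gives `α₁`. On k > l it turns n + m into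
  -- the new m and the parity of k into that of the new k + l, which gives `α₃`, the transpose of
  -- `α₂`.
  all-c₁ : all c₁ ≈ nm> α₁ ⊕ kl= c₁ ⊕ nm> α₂
  all-c₁ = ≈-trans (split-kl c₁) (⊕-cong (⊕-cong
    (shear< {c₁} {α₁} (λ n m k j → cong (λ z → odd k · sgn m · (+ z · + z)) (ℕP.+-comm n m))) ≈-refl)
    (≈-trans (shear> {c₁} {α₃} (λ n m j l → cong₂ (λ x y → odd x · y · (+ (n ℕ.+ m) · + (n ℕ.+ m))) (ℕP.+-comm l j) (sym (sgn-cancel n m)))) (swap-nm {α₃} {α₂} α₃-α₂)))

  -- The shears run backwards: the difference of n and m becomes a variable of its own, and the
  -- diagonal n = m has weight zero.
  all-c₂ : all c₂ ≈ kl< α₂ ⊕ kl< α₁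
  all-c₂ = ≈-trans (split-nm c₂) (≈-trans (⊕-cong (⊕-cong
      (≈-trans (≈-sym (shear> {α₃} {c₂} (λ n m j l → cong₂ (λ x y → x · sgn (n ℕ.+ m) · y) (odd-cancel l j)
        (ZS.solve 2 (λ n m → m ⋆ m ⊜ (n ∸′ (n ⊹ m)) ⋆ (n ∸′ (n ⊹ m))) refl (+ n) (+ m))))) (swap-kl {α₃} {α₂} α₃-α₂))
      (S-zero M λ n → S-zero M λ k → S-zero M λ l → ≈-trans (·Q-cong
        (ZS.solve 2 (λ x n → x ⋆ ((n ∸′ n) ⋆ (n ∸′ n)) ⊜ # 0) refl (odd (suc k) · sgn (suc n)) (+ suc n)) refl)
        (solve 1 (λ q → con 0 :* q := con 0) ≈-refl (Q (suc n ℕ.* suc k ℕ.+ suc n ℕ.* suc l)))))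
      (≈-sym (shear< {α₁} {c₂} (λ n m k j → cong (odd k · sgn m ·_) (ZS.solve 2 (λ n m → n ⋆ n ⊜ ((m ⊹ n) ∸′ m) ⋆ ((m ⊹ n) ∸′ m)) refl (+ n) (+ m))))))
    (⊕-cong (⊕-identityʳ _) ≈-refl))

  -- The shear exchanges `α₁` and `α₂`.
  δ-invariant : kl> δ ≈ nm< δ
  δ-invariant = shear> {δ} {δ} λ n m j l → trans (ℤP.+-comm (α₁ n m (l ℕ.+ j) l) (α₂ n m (l ℕ.+ j) l))
    (cong₂ _+_ (cong (λ z → z · sgn (n ℕ.+ m) · (+ n · + n)) (odd-cancel l j))
      (cong₂ (λ x y → odd x · y · (+ n · + n)) (ℕP.+-comm l j) (sym (sgn-cancel n m))))

  -- Splitting `all δ` in both ways and cancelling the invariant part turns nm> δ - kl< δ into kl= δ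
  -- - nm= δ. Thus the difference of the two full sums lives on the diagonals k = l and n = m.
  c₁-c₂ : all c₁ ⊕ nm= δ ≈ all c₂ ⊕ (kl= c₁ ⊕ kl= δ)
  c₁-c₂ = begin
    all c₁ ⊕ nm= δ
      ≈⟨ ⊕-cong all-c₁ ≈-refl ⟩
    nm> α₁ ⊕ kl= c₁ ⊕ nm> α₂ ⊕ nm= δ
      ≈⟨ solve 5 (λ a b c d x → a :+ b :+ c :+ d := ((x :+ d) :+ (a :+ c)) :+ b :- x) ≈-refl (nm> α₁) (kl= c₁) (nm> α₂) (nm= δ) (nm< δ) ⟩
    nm< δ ⊕ nm= δ ⊕ (nm> α₁ ⊕ nm> α₂) ⊕ kl= c₁ ⊝ nm< δ
      ≈⟨ ⊕-cong (⊕-cong (⊕-cong ≈-refl (≈-sym (nm>-+ α₁ α₂))) ≈-refl) ≈-refl ⟩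
    nm< δ ⊕ nm= δ ⊕ nm> δ ⊕ kl= c₁ ⊝ nm< δ
      ≈⟨ ⊕-cong (⊕-cong (≈-trans (≈-sym (split-nm δ)) (split-kl δ)) ≈-refl) ≈-refl ⟩
    kl< δ ⊕ kl= δ ⊕ kl> δ ⊕ kl= c₁ ⊝ nm< δ
      ≈⟨ ⊕-cong (⊕-cong (⊕-cong (⊕-cong (kl<-+ α₁ α₂) ≈-refl) δ-invariant) ≈-refl) ≈-refl ⟩
    kl< α₁ ⊕ kl< α₂ ⊕ kl= δ ⊕ nm< δ ⊕ kl= c₁ ⊝ nm< δ
      ≈⟨ solve 5 (λ a b c d x → a :+ b :+ c :+ d :+ x :- d := (b :+ a) :+ (x :+ c)) ≈-refl (kl< α₁) (kl< α₂) (kl= δ) (nm< δ) (kl= c₁) ⟩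
    (kl< α₂ ⊕ kl< α₁) ⊕ (kl= c₁ ⊕ kl= δ)
      ≈⟨ ⊕-cong (≈-sym all-c₂) ≈-refl ⟩
    all c₂ ⊕ (kl= c₁ ⊕ kl= δ) ∎

  -- Lambert series and the evaluation of the diagonals

  lambert : (ℕ → ℕ → ℤ) → PS
  lambert f = S M λ n → S M λ k → f n k ·Q (n ℕ.* k)

  lambert-cong : ∀ {f g} → (∀ n k → f (suc n) (suc k) ≡ g (suc n) (suc k)) → lambert f ≈ lambert g
  lambert-cong p = S-cong M λ n → S-cong M λ k → ·Q-cong (p n k) refl

  lambert-+ : ∀ f g → lambert (λ n k → f n k + g n k) ≈ lambert f ⊕ lambert g
  lambert-+ f g = ≈-trans (S-cong M λ n → ≈-trans (S-cong M λ k → ≈-sym (·Q-+ _ _ _)) (S-⊕ M (λ k → f (suc n) k ·Q (suc n ℕ.* k)) (λ k → g (suc n) k ·Q (suc n ℕ.* k))))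
    (S-⊕ M (λ n → S M λ k → f n k ·Q (n ℕ.* k)) (λ n → S M λ k → g n k ·Q (n ℕ.* k)))

  lambert-* : ∀ c f → lambert (λ n k → c · f n k) ≈ κ c ⊗ lambert f
  lambert-* c f = ≈-trans (S-cong M λ n → ≈-trans (S-cong M λ k → ≈-sym (·Q-* _ _ _)) (S-⊗ˡ M (κ c) (λ k → f (suc n) k ·Q (suc n ℕ.* k))))
    (S-⊗ˡ M (κ c) (λ n → S M λ k → f n k ·Q (n ℕ.* k)))

  lambert-D : ∀ f → D (lambert f) ≈ lambert (λ n k → + n · + k · f n k)
  lambert-D f = ≈-trans (S-D M (λ n → S M λ k → f n k ·Q (n ℕ.* k))) (S-cong M λ n → ≈-trans (S-D M (λ k → f (suc n) k ·Q (suc n ℕ.* k))) (S-cong M λ k →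
    ≈-trans (D-κ⊗ (f (suc n) (suc k)) _) (≈-trans (⊗-cong′ ≈-refl (D-Q (suc n ℕ.* suc k)))
      (≈-trans (·Q-* _ _ _) (·Q-cong (trans (ℤP.*-comm (f (suc n) (suc k)) (+ (suc n ℕ.* suc k))) (cong (_· f (suc n) (suc k)) (ℤP.pos-* (suc n) (suc k)))) refl)))))

  lambert-⊗ : ∀ f g → lambert f ⊗ lambert g ≈ all (λ n m k l → f n k · g m l)
  lambert-⊗ f g = begin
    lambert f ⊗ lambert g
      ≈⟨ S-⊗ʳ M (lambert g) _ ⟨
    (S M λ n → (S M λ k → f n k ·Q (n ℕ.* k)) ⊗ lambert g)
      ≈⟨ S-cong M (λ n → S-⊗ˡ M (S M λ k → f (suc n) k ·Q (suc n ℕ.* k)) (λ m → S M λ l → g m l ·Q (m ℕ.* l))) ⟨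
    (S M λ n → S M λ m → (S M λ k → f n k ·Q (n ℕ.* k)) ⊗ (S M λ l → g m l ·Q (m ℕ.* l)))
      ≈⟨ S-cong M (λ n → S-cong M λ m → S-⊗ʳ M (S M λ l → g (suc m) l ·Q (suc m ℕ.* l)) (λ k → f (suc n) k ·Q (suc n ℕ.* k))) ⟨
    (S M λ n → S M λ m → S M λ k → f n k ·Q (n ℕ.* k) ⊗ (S M λ l → g m l ·Q (m ℕ.* l)))
      ≈⟨ S-cong M (λ n → S-cong M λ m → S-cong M λ k → S-⊗ˡ M (f (suc n) (suc k) ·Q (suc n ℕ.* suc k)) (λ l → g (suc m) l ·Q (suc m ℕ.* l))) ⟨
    (S M λ n → S M λ m → S M λ k → S M λ l → f n k ·Q (n ℕ.* k) ⊗ g m l ·Q (m ℕ.* l))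
      ≈⟨ quad-cong (λ n m k l → ≈-trans (solve 4 (λ a b c d → (a :* b) :* (c :* d) := (a :* c) :* (b :* d)) ≈-refl _ _ _ _)
           (⊗-cong′ (≈-sym (κ-* _ _)) (≈-sym (Q-+ (suc n ℕ.* suc k) (suc m ℕ.* suc l))))) ⟩
    all (λ n m k l → f n k · g m l) ∎

  diagonal : (ℕ → ℕ → ℤ) → ℕ → ℤ
  diagonal h d = sumℤ M λ n → lt n d · h n d

  -- The exponent depends on n and m through d = n + m only, so the sum over n < d can be carried
  -- out inside the coefficient.
  collect : (h : ℕ → ℕ → ℕ → ℤ) → (S M λ n → S M λ m → S M λ k → h n (n ℕ.+ m) k ·Q ((n ℕ.+ m) ℕ.* k)) ≈
    lambert (λ d k → diagonal (λ n d → h n d k) d)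
  collect h = begin
    (S M λ n → S M λ m → S M λ k → h n (n ℕ.+ m) k ·Q ((n ℕ.+ m) ℕ.* k))
      ≈⟨ S-cong M (λ n → S-upper (suc n) (λ d → S M λ k → h (suc n) d k ·Q (d ℕ.* k)) (λ d M<d → S-zero M λ k → ·Q-vanish _ _ (subst (M ℕ.<_) (ℕP.+-identityʳ _) (big₁′ d k 0 M<d)))) ⟨
    (S M λ n → S M λ d → κ (lt n d) ⊗ (S M λ k → h n d k ·Q (d ℕ.* k)))
      ≈⟨ S-swap M M (λ n d → κ (lt n d) ⊗ (S M λ k → h n d k ·Q (d ℕ.* k))) ⟩
    (S M λ d → S M λ n → κ (lt n d) ⊗ (S M λ k → h n d k ·Q (d ℕ.* k)))
      ≈⟨ S-cong M (λ d → S-cong M λ n → ≈-trans (≈-sym (S-⊗ˡ M (κ (lt (suc n) (suc d))) (λ k → h (suc n) (suc d) k ·Q (suc d ℕ.* k)))) (S-cong M λ k → ·Q-* _ _ _)) ⟩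
    (S M λ d → S M λ n → S M λ k → (lt n d · h n d k) ·Q (d ℕ.* k))
      ≈⟨ S-cong M (λ d → S-swap M M (λ n k → (lt n (suc d) · h n (suc d) k) ·Q (suc d ℕ.* k))) ⟩
    (S M λ d → S M λ k → S M λ n → (lt n d · h n d k) ·Q (d ℕ.* k))
      ≈⟨ S-cong M (λ d → S-cong M λ k → ≈-trans (S-⊗ʳ M (Q (suc d ℕ.* suc k)) (λ n → κ (lt n (suc d) · h n (suc d) (suc k)))) (⊗-cong′ (S-κ M (λ n → lt n (suc d) · h n (suc d) (suc k))) ≈-refl)) ⟩
    lambert (λ d k → diagonal (λ n d → h n d k) d) ∎

  kl=-collect : ∀ c (h : ℕ → ℕ → ℕ → ℤ) → (∀ n m k → c n m k k ≡ h n (n ℕ.+ m) k) → kl= c ≈ lambert (λ d k → diagonal (λ n d → h n d k) d)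
  kl=-collect c h p = ≈-trans (S-cong M λ n → S-cong M λ m → S-cong M λ k → ·Q-cong (p (suc n) (suc m) (suc k)) (sym (ℕP.*-distribʳ-+ (suc k) (suc n) (suc m)))) (collect h)

  nm=-collect : ∀ c (h : ℕ → ℕ → ℕ → ℤ) → (∀ n k l → c n n k l ≡ h k (k ℕ.+ l) n) → nm= c ≈ lambert (λ n d → diagonal (λ k d → h k d n) d)
  nm=-collect c h p = begin
    nm= c
      ≈⟨ S-swap M M (λ n k → S M λ l → c n n k l ·Q (n ℕ.* k ℕ.+ n ℕ.* l)) ⟩
    (S M λ k → S M λ n → S M λ l → c n n k l ·Q (n ℕ.* k ℕ.+ n ℕ.* l))
      ≈⟨ S-cong M (λ k → S-swap M M (λ n l → c n n (suc k) l ·Q (n ℕ.* suc k ℕ.+ n ℕ.* l))) ⟩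
    (S M λ k → S M λ l → S M λ n → c n n k l ·Q (n ℕ.* k ℕ.+ n ℕ.* l))
      ≈⟨ S-cong M (λ k → S-cong M λ l → S-cong M λ n → ·Q-cong (p (suc n) (suc k) (suc l)) (trans (sym (ℕP.*-distribˡ-+ (suc n) (suc k) (suc l))) (ℕP.*-comm (suc n) (suc k ℕ.+ suc l)))) ⟩
    (S M λ k → S M λ l → S M λ n → h k (k ℕ.+ l) n ·Q ((k ℕ.+ l) ℕ.* n))
      ≈⟨ collect h ⟩
    (S M λ d → S M λ n → diagonal (λ k d → h k d n) d ·Q (d ℕ.* n))
      ≈⟨ S-swap M M (λ d n → diagonal (λ k d → h k d n) d ·Q (d ℕ.* n)) ⟩
    (S M λ n → S M λ d → diagonal (λ k d → h k d n) d ·Q (d ℕ.* n))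
      ≈⟨ S-cong M (λ n → S-cong M λ d → ·Q-cong refl (ℕP.*-comm (suc d) (suc n))) ⟩
    lambert (λ n d → diagonal (λ k d → h k d n) d) ∎

  S-cong-≤ : ∀ K {f g} → (∀ i → suc i ℕ.≤ K → f (suc i) ≈ g (suc i)) → S K f ≈ S K g
  S-cong-≤ zero    p = ≈-refl
  S-cong-≤ (suc K) p = ⊕-cong (S-cong-≤ K (λ i q → p i (ℕP.m≤n⇒m≤1+n q))) (p K ℕP.≤-refl)

  lambert-cong-≤ : ∀ {f g} → (∀ n k → suc n ℕ.≤ M → suc k ℕ.≤ M → f (suc n) (suc k) ≡ g (suc n) (suc k)) → lambert f ≈ lambert g
  lambert-cong-≤ p = S-cong-≤ M λ n n≤M → S-cong-≤ M λ k k≤M → ·Q-cong (p n k n≤M k≤M) refl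

  -- The weight of c₁ + δ on k = l with d = n + m, and the weight of δ on n = m with d = k + l.
  h₁ h₂ : ℕ → ℕ → ℕ → ℤ
  h₁ n d k = odd k · sgn d · (sgn n · (+ d · + d + + n · + n))
  h₂ k d n = odd k · (+ n · + n · sgn n) + + n · + n · odd d

  diagonal-h₁ : ∀ d k → suc d ℕ.≤ M → + 2 · diagonal (λ n d → h₁ n d k) (suc d) ≡ odd k · (+ suc d - + suc d · + suc d · (+ 2 + sgn (suc d)))
  diagonal-h₁ d k d<M = trans (cong (+ 2 ·_) (sumℤ-lt′ M d _ d<M)) (trans (alternating-squares (odd k · sgn (suc d)) (+ suc d · + suc d) d)
    (trans (cong (λ z → odd k · z · (+ suc d · + suc d · (sgn d - 1ℤ) + sgn d · (+ d · (1ℤ + + d)))) (sgn-suc d))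
     (trans (ZS.solve 3 (λ o σ d → o ⋆ (∸′ σ) ⋆ ((# 1 ⊹ d) ⋆ (# 1 ⊹ d) ⋆ (σ ∸′ # 1) ⊹ σ ⋆ (d ⋆ (# 1 ⊹ d))) ⊜
         o ⋆ ((# 1 ⊹ d) ⋆ (# 1 ⊹ d) ⋆ (σ ∸′ σ ⋆ σ) ∸′ (σ ⋆ σ) ⋆ (d ⋆ (# 1 ⊹ d)))) refl (odd k) (sgn d) (+ d))
      (trans (cong (λ z → odd k · (+ suc d · + suc d · (sgn d - z) - z · (+ d · + suc d))) (sgn-sq d))
       (trans (ZS.solve 3 (λ o σ d → o ⋆ ((# 1 ⊹ d) ⋆ (# 1 ⊹ d) ⋆ (σ ∸′ # 1) ∸′ # 1 ⋆ (d ⋆ (# 1 ⊹ d))) ⊜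
          o ⋆ ((# 1 ⊹ d) ∸′ (# 1 ⊹ d) ⋆ (# 1 ⊹ d) ⋆ (# 2 ⊹ (∸′ σ)))) refl (odd k) (sgn d) (+ d))
        (cong (λ z → odd k · (+ suc d - + suc d · + suc d · (+ 2 + z))) (sym (sgn-suc d))))))))

  diagonal-h₂ : ∀ d n → suc d ℕ.≤ M → + 2 · diagonal (λ k d → h₂ k d n) (suc d) ≡
    + n · + n · sgn n · (+ 2 · + suc d - 1ℤ + sgn (suc d)) + + 2 · (+ suc d - 1ℤ) · (+ n · + n · odd (suc d))
  diagonal-h₂ d n d<M = trans (cong (+ 2 ·_) (sumℤ-lt′ M d _ d<M)) (trans (odd-count (+ n · + n · sgn n) (+ n · + n · odd (suc d)) d)
    (trans (ZS.solve 4 (λ x y σ d → x ⋆ (# 2 ⋆ d ⊹ # 1 ∸′ σ) ⊹ # 2 ⋆ d ⋆ y ⊜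
        x ⋆ (# 2 ⋆ (# 1 ⊹ d) ∸′ # 1 ⊹ (∸′ σ)) ⊹ # 2 ⋆ (# 1 ⊹ d ∸′ # 1) ⋆ y) refl (+ n · + n · sgn n) (+ n · + n · odd (suc d)) (sgn d) (+ d))
      (cong (λ z → + n · + n · sgn n · (+ 2 · + suc d - 1ℤ + z) + + 2 · (+ suc d - 1ℤ) · (+ n · + n · odd (suc d))) (sym (sgn-suc d)))))

  diagonal-kl : kl= c₁ ⊕ kl= δ ≈ lambert (λ d k → diagonal (λ n d → h₁ n d k) d)
  diagonal-kl = ≈-trans (≈-sym (kl=-+ c₁ δ)) (kl=-collect (λ n m k l → c₁ n m k l + δ n m k l) h₁ λ n m k →
    trans (cong (λ z → odd k · sgn m · ((+ n + + m) · (+ n + + m)) + (odd k · sgn m · (+ n · + n) + (1ℤ - z) · sgn (n ℕ.+ m) · (+ n · + n))) (sgn-double k))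
     (trans (cong (λ z → odd k · z · ((+ n + + m) · (+ n + + m)) + (odd k · z · (+ n · + n) + 0ℤ · sgn (n ℕ.+ m) · (+ n · + n))) (sgn-diff n m))
      (ZS.solve 5 (λ o σ τ n m → o ⋆ (σ ⋆ τ) ⋆ ((n ⊹ m) ⋆ (n ⊹ m)) ⊹ (o ⋆ (σ ⋆ τ) ⋆ (n ⋆ n) ⊹ # 0 ⋆ σ ⋆ (n ⋆ n)) ⊜
         o ⋆ σ ⋆ (τ ⋆ ((n ⊹ m) ⋆ (n ⊹ m) ⊹ n ⋆ n))) refl (odd k) (sgn (n ℕ.+ m)) (sgn n) (+ n) (+ m))))
    where
    sgn-diff : ∀ n m → sgn m ≡ sgn (n ℕ.+ m) · sgn n
    sgn-diff n m = sym (trans (cong (_· sgn n) (sgn-+ n m)) (trans (ZS.solve 2 (λ x y → x ⋆ y ⋆ x ⊜ (x ⋆ x) ⋆ y) refl (sgn n) (sgn m))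
      (trans (cong (_· sgn m) (sgn-sq n)) (ℤP.*-identityˡ (sgn m)))))
    kl=-+ : ∀ c d → kl= (λ n m k l → c n m k l + d n m k l) ≈ kl= c ⊕ kl= d
    kl=-+ c d = begin
      kl= (λ n m k l → c n m k l + d n m k l)
        ≈⟨ S-cong M (λ n → S-cong M λ m → ≈-trans (S-cong M λ k → ≈-sym (·Q-+ _ _ _)) (S-⊕ M (λ k → c (suc n) (suc m) k k ·Q (suc n ℕ.* k ℕ.+ suc m ℕ.* k)) (λ k → d (suc n) (suc m) k k ·Q (suc n ℕ.* k ℕ.+ suc m ℕ.* k)))) ⟩
      (S M λ n → S M λ m → (S M λ k → c n m k k ·Q (n ℕ.* k ℕ.+ m ℕ.* k)) ⊕ (S M λ k → d n m k k ·Q (n ℕ.* k ℕ.+ m ℕ.* k)))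
        ≈⟨ S-cong M (λ n → S-⊕ M (λ m → S M λ k → c (suc n) m k k ·Q (suc n ℕ.* k ℕ.+ m ℕ.* k)) (λ m → S M λ k → d (suc n) m k k ·Q (suc n ℕ.* k ℕ.+ m ℕ.* k))) ⟩
      (S M λ n → (S M λ m → S M λ k → c n m k k ·Q (n ℕ.* k ℕ.+ m ℕ.* k)) ⊕ (S M λ m → S M λ k → d n m k k ·Q (n ℕ.* k ℕ.+ m ℕ.* k)))
        ≈⟨ S-⊕ M _ _ ⟩
      kl= c ⊕ kl= d ∎

  diagonal-nm : nm= δ ≈ lambert (λ n d → diagonal (λ k d → h₂ k d n) d)
  diagonal-nm = nm=-collect δ h₂ λ n k l →
    trans (cong (λ z → odd k · sgn n · (+ n · + n) + odd (k ℕ.+ l) · z · (+ n · + n)) (sgn-double n))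
      (ZS.solve 4 (λ o σ n p → o ⋆ σ ⋆ (n ⋆ n) ⊹ p ⋆ # 1 ⋆ (n ⋆ n) ⊜ o ⋆ (n ⋆ n ⋆ σ) ⊹ n ⋆ n ⋆ p) refl (odd k) (sgn n) (+ n) (odd (k ℕ.+ l)))

  oddN sgnN : ℕ → ℕ → ℤ
  oddN n k = odd k · + n
  sgnN n k = sgn n · + n

  -- The two diagonals are explicit polynomials in n, k and their signs. In the combination that
  -- occurs, every term other than `oddN` carries the factor nk, which is what `D` produces.
  Liouville-identity : κ (+ 8) ⊗ (lambert oddN ⊗ lambert sgnN) ≈ lambert oddN ⊝ κ (+ 2) ⊗ D (lambert sgnN ⊕ lambert oddN)
  Liouville-identity = begin
    κ (+ 8) ⊗ (lambert oddN ⊗ lambert sgnN)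
      ≈⟨ ≈-trans (solve 2 (λ a b → con 8 :* (a :* b) := con 2 :* ((con 4 :* a) :* b)) ≈-refl (lambert oddN) (lambert sgnN)) (⊗-cong′ ≈-refl (⊗-cong′ (≈-sym (lambert-* (+ 4) oddN)) ≈-refl)) ⟩
    κ (+ 2) ⊗ (lambert (λ n k → + 4 · oddN n k) ⊗ lambert sgnN)
      ≈⟨ ⊗-cong′ ≈-refl (lambert-⊗ (λ n k → + 4 · oddN n k) sgnN) ⟩
    κ (+ 2) ⊗ all e₄
      ≈⟨ solve 3 (λ e c n → con 2 :* e := con 2 :* ((c :+ e :+ n) :- (c :+ n))) ≈-refl (all e₄) (all c₂) (nm= δ) ⟩
    κ (+ 2) ⊗ ((all c₂ ⊕ all e₄ ⊕ nm= δ) ⊝ (all c₂ ⊕ nm= δ))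
      ≈⟨ ⊗-cong′ ≈-refl (⊕-cong (≈-trans (⊕-cong (≈-trans (≈-sym (all-+ c₂ e₄)) (quad-cong λ n m k l → ·Q-cong (c₂+e₄ (suc n) (suc m) (suc k) (suc l)) refl)) ≈-refl) c₁-c₂) ≈-refl) ⟩
    κ (+ 2) ⊗ ((all c₂ ⊕ (kl= c₁ ⊕ kl= δ)) ⊝ (all c₂ ⊕ nm= δ))
      ≈⟨ solve 3 (λ c k n → con 2 :* ((c :+ k) :- (c :+ n)) := con 2 :* k :+ conℤ (- + 2) :* n) ≈-refl (all c₂) (kl= c₁ ⊕ kl= δ) (nm= δ) ⟩
    κ (+ 2) ⊗ (kl= c₁ ⊕ kl= δ) ⊕ κ (- + 2) ⊗ nm= δ
      ≈⟨ ⊕-cong (≈-trans (⊗-cong′ ≈-refl diagonal-kl) (≈-sym (lambert-* (+ 2) g₁))) (≈-trans (⊗-cong′ ≈-refl diagonal-nm) (≈-sym (lambert-* (- + 2) g₂))) ⟩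
    lambert (λ n k → + 2 · g₁ n k) ⊕ lambert (λ n k → (- + 2) · g₂ n k)
      ≈⟨ lambert-+ (λ n k → + 2 · g₁ n k) (λ n k → (- + 2) · g₂ n k) ⟨
    lambert (λ n k → + 2 · g₁ n k + (- + 2) · g₂ n k)
      ≈⟨ lambert-cong-≤ final ⟩
    lambert (λ n k → oddN n k + (- + 2) · (+ n · + k · (sgnN n k + oddN n k)))
      ≈⟨ ≈-trans (lambert-+ oddN (λ n k → (- + 2) · (+ n · + k · (sgnN n k + oddN n k)))) (⊕-cong ≈-refl (lambert-* (- + 2) (λ n k → + n · + k · (sgnN n k + oddN n k)))) ⟩
    lambert oddN ⊕ κ (- + 2) ⊗ lambert (λ n k → + n · + k · (sgnN n k + oddN n k))
      ≈⟨ ⊕-cong ≈-refl (⊗-cong′ ≈-refl (≈-trans (≈-sym (lambert-D (λ n k → sgnN n k + oddN n k))) (D-cong (lambert-+ sgnN oddN)))) ⟩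
    lambert oddN ⊕ κ (- + 2) ⊗ D (lambert sgnN ⊕ lambert oddN)
      ≈⟨ solve 2 (λ a b → a :+ conℤ (- + 2) :* b := a :- con 2 :* b) ≈-refl (lambert oddN) (D (lambert sgnN ⊕ lambert oddN)) ⟩
    lambert oddN ⊝ κ (+ 2) ⊗ D (lambert sgnN ⊕ lambert oddN) ∎
    where
    e₄ : Weight
    e₄ n m k l = + 4 · oddN n k · sgnN m l
    g₁ g₂ : ℕ → ℕ → ℤ
    g₁ d k = diagonal (λ n d → h₁ n d k) d
    g₂ n d = diagonal (λ k d → h₂ k d n) d
    c₂+e₄ : ∀ n m k l → c₂ n m k l + e₄ n m k l ≡ c₁ n m k l
    c₂+e₄ n m k l = ZS.solve 4 (λ o σ n m → o ⋆ σ ⋆ ((n ∸′ m) ⋆ (n ∸′ m)) ⊹ # 4 ⋆ (o ⋆ n) ⋆ (σ ⋆ m) ⊜ o ⋆ σ ⋆ ((n ⊹ m) ⋆ (n ⊹ m))) refl (odd k) (sgn m) (+ n) (+ m)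
    final : ∀ n k → suc n ℕ.≤ M → suc k ℕ.≤ M → + 2 · g₁ (suc n) (suc k) + (- + 2) · g₂ (suc n) (suc k) ≡
      oddN (suc n) (suc k) + (- + 2) · (+ suc n · + suc k · (sgnN (suc n) (suc k) + oddN (suc n) (suc k)))
    final n k n≤M k≤M = trans (cong₂ _+_ (diagonal-h₁ n (suc k) n≤M)
        (trans (sym (ℤP.neg-distribˡ-* (+ 2) (g₂ (suc n) (suc k)))) (cong -_ (diagonal-h₂ k (suc n) k≤M))))
      (ZS.solve 4 (λ χ ν n k → (# 1 ∸′ χ) ⋆ (n ∸′ n ⋆ n ⋆ (# 2 ⊹ ν)) ⊹
           (∸′ (n ⋆ n ⋆ ν ⋆ (# 2 ⋆ k ∸′ # 1 ⊹ χ) ⊹ # 2 ⋆ (k ∸′ # 1) ⋆ (n ⋆ n ⋆ (# 1 ∸′ χ)))) ⊜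
           (# 1 ∸′ χ) ⋆ n ⊹ ∸′ # 2 ⋆ (n ⋆ k ⋆ (ν ⋆ n ⊹ (# 1 ∸′ χ) ⋆ n))) refl
        (sgn (suc k)) (sgn (suc n)) (+ suc n) (+ suc k))

  -- The generating function of the divisor sums σ(n); the Eisenstein series E₂ is 1 - 24s.
  s : PS
  s = lambert (λ n k → + n)

  V-s : V s ≈ (S M λ n → S M λ k → + n ·Q (n ℕ.* k ℕ.+ n ℕ.* k))
  V-s = ≈-trans (S-V M (λ n → S M λ k → + n ·Q (n ℕ.* k))) (S-cong M λ n → ≈-trans (S-V M (λ k → + suc n ·Q (suc n ℕ.* k))) (S-cong M λ k →
    ≈-trans (V-⊗ _ _) (⊗-cong′ (V-κ _) (V-Q _))))

  V-V-s : V (V s) ≈ (S M λ n → S M λ k → + n ·Q ((n ℕ.+ n) ℕ.* (k ℕ.+ k)))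
  V-V-s = ≈-trans (V-cong V-s) (≈-trans (S-V M (λ n → S M λ k → + n ·Q (n ℕ.* k ℕ.+ n ℕ.* k))) (S-cong M λ n → ≈-trans (S-V M (λ k → + suc n ·Q (suc n ℕ.* k ℕ.+ suc n ℕ.* k))) (S-cong M λ k →
    ≈-trans (V-⊗ _ _) (⊗-cong′ (V-κ _) (≈-trans (V-Q _) (Q-≡ (NS.solve 2 (λ n k → n NS.:* k NS.:+ n NS.:* k NS.:+ (n NS.:* k NS.:+ n NS.:* k) NS.:= (n NS.:+ n) NS.:* (k NS.:+ k)) refl (suc n) (suc k))))))))

  even-k : ∀ (f : ℕ → ℤ) → lambert (λ n k → (1ℤ + sgn k) · f n) ≈ κ (+ 2) ⊗ (S M λ n → S M λ k → f n ·Q (n ℕ.* (k ℕ.+ k)))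
  even-k f = ≈-trans (S-cong M λ n → ≈-trans (S-cong M λ k → ≈-sym (·Q-* _ _ _))
      (S-even (λ k → f (suc n) ·Q (suc n ℕ.* k)) (λ k M<k → ·Q-vanish _ _ (subst (M ℕ.<_) (ℕP.+-identityʳ _) (big₁ n k 0 M<k)))))
    (S-⊗ˡ M (κ (+ 2)) (λ n → S M λ k → f n ·Q (n ℕ.* (k ℕ.+ k))))

  even-n : ∀ (f : ℕ → ℕ → ℤ) → lambert (λ n k → (1ℤ + sgn n) · f n k) ≈ κ (+ 2) ⊗ (S M λ n → S M λ k → f (n ℕ.+ n) k ·Q ((n ℕ.+ n) ℕ.* k))
  even-n f = ≈-trans (S-cong M λ n → ≈-trans (S-cong M λ k → ≈-sym (·Q-* _ _ _)) (S-⊗ˡ M (κ (1ℤ + sgn (suc n))) (λ k → f (suc n) k ·Q (suc n ℕ.* k))))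
      (S-even (λ n → S M λ k → f n k ·Q (n ℕ.* k)) (λ n M<n → S-zero M λ k → ·Q-vanish _ _ (subst (M ℕ.<_) (ℕP.+-identityʳ _) (big₁′ n k 0 M<n))))

  even-k-s : lambert (λ n k → (1ℤ + sgn k) · + n) ≈ κ (+ 2) ⊗ V s
  even-k-s = ≈-trans (even-k (λ n → + n)) (⊗-cong′ ≈-refl (≈-trans (S-cong M λ n → S-cong M λ k → ·Q-cong refl (ℕP.*-distribˡ-+ (suc n) (suc k) (suc k))) (≈-sym V-s)))

  even-n-s : lambert (λ n k → (1ℤ + sgn n) · + n) ≈ κ (+ 4) ⊗ V s
  even-n-s = ≈-trans (even-n (λ n k → + n)) (≈-trans (⊗-cong′ ≈-refl (≈-trans (S-cong M λ n → ≈-trans (S-cong M λ k → ≈-trans (·Q-cong (ZS.solve 1 (λ n → n ⊹ n ⊜ # 2 ⋆ n) refl (+ suc n)) (ℕP.*-distribʳ-+ (suc k) (suc n) (suc n))) (≈-sym (·Q-* (+ 2) (+ suc n) _)))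
      (S-⊗ˡ M (κ (+ 2)) (λ k → + suc n ·Q (suc n ℕ.* k ℕ.+ suc n ℕ.* k)))) (≈-trans (S-⊗ˡ M (κ (+ 2)) (λ n → S M λ k → + n ·Q (n ℕ.* k ℕ.+ n ℕ.* k))) (⊗-cong′ ≈-refl (≈-sym V-s)))))
    (solve 1 (λ a → con 2 :* (con 2 :* a) := con 4 :* a) ≈-refl (V s)))

  lambert-oddN : lambert oddN ≈ κ (+ 2) ⊗ (s ⊝ V s)
  lambert-oddN = ≈-trans (lambert-cong {oddN} {λ n k → + 2 · + n + (- 1ℤ) · ((1ℤ + sgn k) · + n)} (λ n k → ZS.solve 2 (λ χ n → (# 1 ∸′ χ) ⋆ n ⊜ # 2 ⋆ n ⊹ ∸′ # 1 ⋆ ((# 1 ⊹ χ) ⋆ n)) refl (sgn (suc k)) (+ suc n)))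
    (≈-trans (lambert-+ (λ n k → + 2 · + n) (λ n k → (- 1ℤ) · ((1ℤ + sgn k) · + n)))
    (≈-trans (⊕-cong (lambert-* (+ 2) (λ n k → + n)) (≈-trans (lambert-* (- 1ℤ) (λ n k → (1ℤ + sgn k) · + n)) (⊗-cong′ ≈-refl even-k-s)))
      (solve 2 (λ a b → con 2 :* a :+ conℤ (- 1ℤ) :* (con 2 :* b) := con 2 :* (a :- b)) ≈-refl s (V s))))

  lambert-sgnN : lambert sgnN ≈ κ (+ 4) ⊗ V s ⊝ s
  lambert-sgnN = ≈-trans (lambert-cong {sgnN} {λ n k → (1ℤ + sgn n) · + n + (- 1ℤ) · + n} (λ n k → ZS.solve 2 (λ χ n → χ ⋆ n ⊜ (# 1 ⊹ χ) ⋆ n ⊹ ∸′ # 1 ⋆ n) refl (sgn (suc n)) (+ suc n)))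
    (≈-trans (lambert-+ (λ n k → (1ℤ + sgn n) · + n) (λ n k → (- 1ℤ) · + n))
    (≈-trans (⊕-cong even-n-s (lambert-* (- 1ℤ) (λ n k → + n)))
      (solve 2 (λ a b → con 4 :* b :+ conℤ (- 1ℤ) :* a := con 4 :* b :- a) ≈-refl s (V s))))

  -- Liouville's identity with both Lambert series expressed by `s` and `V s`: a quadratic relation
  -- between E₂(q), E₂(q²) and their derivatives.
  halphen : D s ⊕ κ (+ 2) ⊗ D (V s) ≈ (s ⊝ V s) ⊗ (κ 1ℤ ⊕ κ (+ 8) ⊗ s ⊝ κ (+ 32) ⊗ V s)
  halphen = κ-cancel (+ 2) (begin
    κ (+ 2) ⊗ (D s ⊕ κ (+ 2) ⊗ D (V s))
      ≈⟨ ⊗-cong′ ≈-refl (≈-trans (⊕-cong ≈-refl (≈-sym (D-κ⊗ (+ 2) (V s)))) (≈-trans (≈-sym (D-⊕ s (κ (+ 2) ⊗ V s))) (D-cong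
           (≈-trans (solve 2 (λ a b → a :+ con 2 :* b := (con 4 :* b :- a) :+ con 2 :* (a :- b)) ≈-refl s (V s)) (⊕-cong (≈-sym lambert-sgnN) (≈-sym lambert-oddN)))))) ⟩
    κ (+ 2) ⊗ D (lambert sgnN ⊕ lambert oddN)
      ≈⟨ solve 2 (λ a b → b := a :- (a :- b)) ≈-refl (lambert oddN) (κ (+ 2) ⊗ D (lambert sgnN ⊕ lambert oddN)) ⟩
    lambert oddN ⊝ (lambert oddN ⊝ κ (+ 2) ⊗ D (lambert sgnN ⊕ lambert oddN))
      ≈⟨ ⊕-cong ≈-refl (⊖-cong Liouville-identity) ⟨
    lambert oddN ⊝ κ (+ 8) ⊗ (lambert oddN ⊗ lambert sgnN)
      ≈⟨ ⊕-cong lambert-oddN (⊖-cong (⊗-cong′ ≈-refl (⊗-cong′ lambert-oddN lambert-sgnN))) ⟩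
    κ (+ 2) ⊗ (s ⊝ V s) ⊝ κ (+ 8) ⊗ (κ (+ 2) ⊗ (s ⊝ V s) ⊗ (κ (+ 4) ⊗ V s ⊝ s))
      ≈⟨ solve 2 (λ a b → con 2 :* (a :- b) :- con 8 :* (con 2 :* (a :- b) :* (con 4 :* b :- a)) := con 2 :* ((a :- b) :* (con 1 :+ con 8 :* a :- con 32 :* b))) ≈-refl s (V s) ⟩
    κ (+ 2) ⊗ ((s ⊝ V s) ⊗ (κ 1ℤ ⊕ κ (+ 8) ⊗ s ⊝ κ (+ 32) ⊗ V s)) ∎)

  -- Halphen's system

  s₂ s₄ : PS
  s₂ = V s
  s₄ = V s₂

  N-s₂ : N s₂ ≈ s₂
  N-s₂ = ≈-trans (N-cong V-s) (≈-trans (S-N M (λ n → S M λ k → + n ·Q (n ℕ.* k ℕ.+ n ℕ.* k))) (≈-trans (S-cong M λ n → ≈-trans (S-N M (λ k → + suc n ·Q (suc n ℕ.* k ℕ.+ suc n ℕ.* k))) (S-cong M λ k →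
    ≈-trans (N-⊗ _ _) (⊗-cong′ (N-κ _) (≈-trans (N-Q _) (≈-trans (⊗-cong′ (subst (λ z → κ z ≈ κ 1ℤ) (sym (sgn-double (suc n ℕ.* suc k))) ≈-refl) ≈-refl) (⊗-identityˡ _)))))) (≈-sym V-s)))

  even-nk : lambert (λ n k → (1ℤ + sgn n) · ((1ℤ + sgn k) · + n)) ≈ κ (+ 8) ⊗ s₄
  even-nk = begin
    lambert (λ n k → (1ℤ + sgn n) · ((1ℤ + sgn k) · + n))
      ≈⟨ even-n (λ n k → (1ℤ + sgn k) · + n) ⟩
    κ (+ 2) ⊗ (S M λ n → S M λ k → ((1ℤ + sgn k) · + (n ℕ.+ n)) ·Q ((n ℕ.+ n) ℕ.* k))
      ≈⟨ ⊗-cong′ ≈-refl (S-cong M λ n → ≈-trans (S-cong M λ k → ≈-sym (·Q-* _ _ _))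
           (S-even (λ k → + (suc n ℕ.+ suc n) ·Q ((suc n ℕ.+ suc n) ℕ.* k)) (λ k M<k → ·Q-vanish _ _ (subst (M ℕ.<_) (ℕP.+-identityʳ _) (big₁ (n ℕ.+ suc n) k 0 M<k))))) ⟩
    κ (+ 2) ⊗ (S M λ n → κ (+ 2) ⊗ (S M λ k → + (n ℕ.+ n) ·Q ((n ℕ.+ n) ℕ.* (k ℕ.+ k))))
      ≈⟨ ⊗-cong′ ≈-refl (S-cong M λ n → ⊗-cong′ ≈-refl (≈-trans (S-cong M λ k → ≈-trans (·Q-cong (ZS.solve 1 (λ n → n ⊹ n ⊜ # 2 ⋆ n) refl (+ suc n)) refl) (≈-sym (·Q-* (+ 2) (+ suc n) _)))
           (S-⊗ˡ M (κ (+ 2)) (λ k → + suc n ·Q ((suc n ℕ.+ suc n) ℕ.* (k ℕ.+ k)))))) ⟩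
    κ (+ 2) ⊗ (S M λ n → κ (+ 2) ⊗ (κ (+ 2) ⊗ (S M λ k → + n ·Q ((n ℕ.+ n) ℕ.* (k ℕ.+ k)))))
      ≈⟨ ⊗-cong′ ≈-refl (≈-trans (S-⊗ˡ M (κ (+ 2)) (λ n → κ (+ 2) ⊗ (S M λ k → + n ·Q ((n ℕ.+ n) ℕ.* (k ℕ.+ k))))) (⊗-cong′ ≈-refl (≈-trans (S-⊗ˡ M (κ (+ 2)) (λ n → S M λ k → + n ·Q ((n ℕ.+ n) ℕ.* (k ℕ.+ k)))) (⊗-cong′ ≈-refl (≈-sym V-V-s))))) ⟩
    κ (+ 2) ⊗ (κ (+ 2) ⊗ (κ (+ 2) ⊗ s₄))
      ≈⟨ solve 1 (λ a → con 2 :* (con 2 :* (con 2 :* a)) := con 8 :* a) ≈-refl s₄ ⟩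
    κ (+ 8) ⊗ s₄ ∎

  -- By `sgn-*` the sign (-1)ⁿᵏ is a combination of the conditions that n is even, k is even, or
  -- both; these parts of `s` are multiples of `s₂` and `s₄`.
  N-s : N s ≈ κ (+ 6) ⊗ s₂ ⊝ κ (+ 4) ⊗ s₄ ⊝ s
  N-s = κ-cancel (+ 2) (begin
    κ (+ 2) ⊗ N s
      ≈⟨ ⊗-cong′ ≈-refl (≈-trans (S-N M (λ n → S M λ k → + n ·Q (n ℕ.* k))) (S-cong M λ n → ≈-trans (S-N M (λ k → + suc n ·Q (suc n ℕ.* k))) (S-cong M λ k →
           ≈-trans (N-⊗ _ _) (≈-trans (⊗-cong′ (N-κ _) (N-Q _)) (·Q-* _ _ _))))) ⟩
    κ (+ 2) ⊗ lambert (λ n k → + n · sgn (n ℕ.* k))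
      ≈⟨ lambert-* (+ 2) (λ n k → + n · sgn (n ℕ.* k)) ⟨
    lambert (λ n k → + 2 · (+ n · sgn (n ℕ.* k)))
      ≈⟨ lambert-cong {λ n k → + 2 · (+ n · sgn (n ℕ.* k))} {λ n k → F₁ n k + F₂ n k + F₃ n k + F₄ n k} (λ n k → lem (suc n) (suc k)) ⟩
    lambert (λ n k → F₁ n k + F₂ n k + F₃ n k + F₄ n k)
      ≈⟨ ≈-trans (lambert-+ (λ n k → F₁ n k + F₂ n k + F₃ n k) F₄) (⊕-cong (≈-trans (lambert-+ (λ n k → F₁ n k + F₂ n k) F₃) (⊕-cong (lambert-+ F₁ F₂) ≈-refl)) ≈-refl) ⟩
    lambert F₁ ⊕ lambert F₂ ⊕ lambert F₃ ⊕ lambert F₄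
      ≈⟨ ⊕-cong (⊕-cong (⊕-cong (≈-trans (lambert-* (+ 2) (λ n k → (1ℤ + sgn n) · + n)) (⊗-cong′ ≈-refl even-n-s))
           (≈-trans (lambert-* (+ 2) (λ n k → (1ℤ + sgn k) · + n)) (⊗-cong′ ≈-refl even-k-s)))
           (≈-trans (lambert-* (- 1ℤ) (λ n k → (1ℤ + sgn n) · ((1ℤ + sgn k) · + n))) (⊗-cong′ ≈-refl even-nk)))
           (lambert-* (- + 2) (λ n k → + n)) ⟩
    κ (+ 2) ⊗ (κ (+ 4) ⊗ s₂) ⊕ κ (+ 2) ⊗ (κ (+ 2) ⊗ s₂) ⊕ κ (- 1ℤ) ⊗ (κ (+ 8) ⊗ s₄) ⊕ κ (- + 2) ⊗ s
      ≈⟨ solve 3 (λ a b c → con 2 :* (con 4 :* b) :+ con 2 :* (con 2 :* b) :+ conℤ (- 1ℤ) :* (con 8 :* c) :+ conℤ (- + 2) :* a := con 2 :* (con 6 :* b :- con 4 :* c :- a)) ≈-refl s s₂ s₄ ⟩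
    κ (+ 2) ⊗ (κ (+ 6) ⊗ s₂ ⊝ κ (+ 4) ⊗ s₄ ⊝ s) ∎)
    where
    F₁ F₂ F₃ F₄ : ℕ → ℕ → ℤ
    F₁ n k = + 2 · ((1ℤ + sgn n) · + n)
    F₂ n k = + 2 · ((1ℤ + sgn k) · + n)
    F₃ n k = (- 1ℤ) · ((1ℤ + sgn n) · ((1ℤ + sgn k) · + n))
    F₄ n k = (- + 2) · + n
    lem : ∀ n k → + 2 · (+ n · sgn (n ℕ.* k)) ≡ F₁ n k + F₂ n k + F₃ n k + F₄ n k
    lem n k = trans (ZS.solve 2 (λ n x → # 2 ⋆ (n ⋆ x) ⊜ n ⋆ (# 2 ⋆ x)) refl (+ n) (sgn (n ℕ.* k)))
      (trans (cong (+ n ·_) (sgn-* n k)) (ZS.solve 3 (λ n a b → n ⋆ (# 1 ⊹ a ⊹ b ∸′ a ⋆ b) ⊜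
        # 2 ⋆ ((# 1 ⊹ a) ⋆ n) ⊹ # 2 ⋆ ((# 1 ⊹ b) ⋆ n) ⊹ ∸′ # 1 ⋆ ((# 1 ⊹ a) ⋆ ((# 1 ⊹ b) ⋆ n)) ⊹ ∸′ # 2 ⋆ n) refl (+ n) (sgn n) (sgn k)))

  -- The right-hand sides of `halphen` and of its images under `N` and `V`: three linear equations
  -- for the derivatives of `s`, `s₂` and `s₄`.
  A₁ A₂ A₃ : PS
  A₁ = (s ⊝ s₂) ⊗ (κ 1ℤ ⊕ κ (+ 8) ⊗ s ⊝ κ (+ 32) ⊗ s₂)
  A₂ = (κ (+ 5) ⊗ s₂ ⊝ κ (+ 4) ⊗ s₄ ⊝ s) ⊗ (κ 1ℤ ⊕ κ (+ 16) ⊗ s₂ ⊝ κ (+ 32) ⊗ s₄ ⊝ κ (+ 8) ⊗ s)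
  A₃ = κ (+ 2) ⊗ ((s₂ ⊝ s₄) ⊗ (κ 1ℤ ⊕ κ (+ 8) ⊗ s₂ ⊝ κ (+ 32) ⊗ s₄))

  ⊝-cong : ∀ {f f′ g g′} → f ≈ f′ → g ≈ g′ → f ⊝ g ≈ f′ ⊝ g′
  ⊝-cong p q = ⊕-cong p (⊖-cong q)

  D-⊝ : ∀ f g → D (f ⊝ g) ≈ D f ⊝ D g
  D-⊝ f g = ≈-trans (D-⊕ f (⊖ g)) (⊕-cong ≈-refl (D-⊖ g))

  -- Subtraction is written as multiplication by -1, so that compatibility with sums, products and
  -- constants is all that has to be known of `φ`.
  A₁-map : (φ : PS → PS) → (∀ {f g} → f ≈ g → φ f ≈ φ g) → (∀ f g → φ (f ⊕ g) ≈ φ f ⊕ φ g) →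
    (∀ f g → φ (f ⊗ g) ≈ φ f ⊗ φ g) → (∀ c → φ (κ c) ≈ κ c) →
    φ (D s) ⊕ κ (+ 2) ⊗ φ (D s₂) ≈ (φ s ⊝ φ s₂) ⊗ (κ 1ℤ ⊕ κ (+ 8) ⊗ φ s ⊝ κ (+ 32) ⊗ φ s₂)
  A₁-map φ c a m k = begin
    φ (D s) ⊕ κ (+ 2) ⊗ φ (D s₂)
      ≈⟨ ≈-trans (a _ _) (⊕-cong ≈-refl (φκ (+ 2) (D s₂))) ⟨
    φ (D s ⊕ κ (+ 2) ⊗ D s₂)
      ≈⟨ c (≈-trans halphen (solve 2 (λ x y → (x :- y) :* (con 1 :+ con 8 :* x :- con 32 :* y) := (x :+ conℤ (- 1ℤ) :* y) :* (con 1 :+ con 8 :* x :+ conℤ (- + 32) :* y)) ≈-refl s s₂)) ⟩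
    φ ((s ⊕ κ (- 1ℤ) ⊗ s₂) ⊗ (κ 1ℤ ⊕ κ (+ 8) ⊗ s ⊕ κ (- + 32) ⊗ s₂))
      ≈⟨ ≈-trans (m _ _) (⊗-cong′ (≈-trans (a _ _) (⊕-cong ≈-refl (φκ _ _))) (≈-trans (a _ _) (⊕-cong (≈-trans (a _ _) (⊕-cong (k _) (φκ _ _))) (φκ _ _)))) ⟩
    (φ s ⊕ κ (- 1ℤ) ⊗ φ s₂) ⊗ (κ 1ℤ ⊕ κ (+ 8) ⊗ φ s ⊕ κ (- + 32) ⊗ φ s₂)
      ≈⟨ solve 2 (λ x y → (x :- y) :* (con 1 :+ con 8 :* x :- con 32 :* y) := (x :+ conℤ (- 1ℤ) :* y) :* (con 1 :+ con 8 :* x :+ conℤ (- + 32) :* y)) ≈-refl (φ s) (φ s₂) ⟨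
    (φ s ⊝ φ s₂) ⊗ (κ 1ℤ ⊕ κ (+ 8) ⊗ φ s ⊝ κ (+ 32) ⊗ φ s₂) ∎
    where
    φκ : ∀ d f → φ (κ d ⊗ f) ≈ κ d ⊗ φ f
    φκ d f = ≈-trans (m _ _) (⊗-cong′ (k d) ≈-refl)

  eq₁ : D s ⊕ κ (+ 2) ⊗ D s₂ ≈ A₁
  eq₁ = halphen

  eq₂ : κ (+ 8) ⊗ D s₂ ⊝ κ (+ 4) ⊗ D s₄ ⊝ D s ≈ A₂
  eq₂ = begin
    κ (+ 8) ⊗ D s₂ ⊝ κ (+ 4) ⊗ D s₄ ⊝ D s
      ≈⟨ solve 3 (λ a b c → con 8 :* b :- con 4 :* c :- a := con 6 :* b :- con 4 :* c :- a :+ con 2 :* b) ≈-refl (D s) (D s₂) (D s₄) ⟩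
    κ (+ 6) ⊗ D s₂ ⊝ κ (+ 4) ⊗ D s₄ ⊝ D s ⊕ κ (+ 2) ⊗ D s₂
      ≈⟨ ⊕-cong (≈-trans (D-⊝ _ _) (⊝-cong (≈-trans (D-⊝ _ _) (⊝-cong (D-κ⊗ (+ 6) s₂) (D-κ⊗ (+ 4) s₄))) ≈-refl)) ≈-refl ⟨
    D (κ (+ 6) ⊗ s₂ ⊝ κ (+ 4) ⊗ s₄ ⊝ s) ⊕ κ (+ 2) ⊗ D s₂
      ≈⟨ ⊕-cong (≈-trans (N-D s) (D-cong N-s)) (⊗-cong′ ≈-refl (≈-trans (N-D s₂) (D-cong N-s₂))) ⟨
    N (D s) ⊕ κ (+ 2) ⊗ N (D s₂)
      ≈⟨ A₁-map N N-cong N-⊕ N-⊗ N-κ ⟩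
    (N s ⊝ N s₂) ⊗ (κ 1ℤ ⊕ κ (+ 8) ⊗ N s ⊝ κ (+ 32) ⊗ N s₂)
      ≈⟨ ⊗-cong′ (⊝-cong N-s N-s₂) (⊝-cong (⊕-cong ≈-refl (⊗-cong′ ≈-refl N-s)) (⊗-cong′ ≈-refl N-s₂)) ⟩
    (κ (+ 6) ⊗ s₂ ⊝ κ (+ 4) ⊗ s₄ ⊝ s ⊝ s₂) ⊗ (κ 1ℤ ⊕ κ (+ 8) ⊗ (κ (+ 6) ⊗ s₂ ⊝ κ (+ 4) ⊗ s₄ ⊝ s) ⊝ κ (+ 32) ⊗ s₂)
      ≈⟨ solve 3 (λ a b c → (con 6 :* b :- con 4 :* c :- a :- b) :* (con 1 :+ con 8 :* (con 6 :* b :- con 4 :* c :- a) :- con 32 :* b)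
           := (con 5 :* b :- con 4 :* c :- a) :* (con 1 :+ con 16 :* b :- con 32 :* c :- con 8 :* a)) ≈-refl s s₂ s₄ ⟩
    A₂ ∎

  eq₃ : D s₂ ⊕ κ (+ 2) ⊗ D s₄ ≈ A₃
  eq₃ = begin
    D s₂ ⊕ κ (+ 2) ⊗ D s₄
      ≈⟨ ⊕-cong (V-D s) (⊗-cong′ ≈-refl (V-D s₂)) ⟩
    κ (+ 2) ⊗ V (D s) ⊕ κ (+ 2) ⊗ (κ (+ 2) ⊗ V (D s₂))
      ≈⟨ distribˡ (κ (+ 2)) _ _ ⟨
    κ (+ 2) ⊗ (V (D s) ⊕ κ (+ 2) ⊗ V (D s₂))
      ≈⟨ ⊗-cong′ ≈-refl (A₁-map V V-cong V-⊕ V-⊗ V-κ) ⟩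
    A₃ ∎

  -- Classically `Y` is the fourth power of the theta series (Jacobi's four-square theorem), `Z` is
  -- the sum of σ(n)qⁿ over odd n, and `E` is 2E₂(q²) - E₂(q). The ring generated by `u`, `E` and
  -- `X` is closed under `D`; `u` and `E` will be the logarithmic derivatives of `W` and `T`.
  Y Z X u E : PS
  Y = κ 1ℤ ⊕ κ (+ 8) ⊗ s ⊝ κ (+ 32) ⊗ s₄
  Z = s ⊝ κ (+ 3) ⊗ s₂ ⊕ κ (+ 2) ⊗ s₄
  X = Y ⊗ Z
  u = κ (- + 8) ⊗ (s ⊝ s₂)
  E = κ 1ℤ ⊕ κ (+ 24) ⊗ s ⊝ κ (+ 48) ⊗ s₂

  -- 4 D(s - s₂) = 3A₁ - A₂ - 2A₃
  D-u : κ (+ 2) ⊗ D u ≈ u ⊗ u ⊝ κ (+ 16) ⊗ X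
  D-u = begin
    κ (+ 2) ⊗ D u
      ≈⟨ ⊗-cong′ ≈-refl (≈-trans (D-κ⊗ (- + 8) _) (⊗-cong′ ≈-refl (D-⊝ s s₂))) ⟩
    κ (+ 2) ⊗ (κ (- + 8) ⊗ (D s ⊝ D s₂))
      ≈⟨ solve 3 (λ a b c → con 2 :* (conℤ (- + 8) :* (a :- b)) := conℤ (- + 4) :* (con 3 :* (a :+ con 2 :* b) :- (con 8 :* b :- con 4 :* c :- a) :- con 2 :* (b :+ con 2 :* c))) ≈-refl (D s) (D s₂) (D s₄) ⟩
    κ (- + 4) ⊗ (κ (+ 3) ⊗ (D s ⊕ κ (+ 2) ⊗ D s₂) ⊝ (κ (+ 8) ⊗ D s₂ ⊝ κ (+ 4) ⊗ D s₄ ⊝ D s) ⊝ κ (+ 2) ⊗ (D s₂ ⊕ κ (+ 2) ⊗ D s₄))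
      ≈⟨ ⊗-cong′ ≈-refl (⊝-cong (⊝-cong (⊗-cong′ ≈-refl eq₁) eq₂) (⊗-cong′ ≈-refl eq₃)) ⟩
    κ (- + 4) ⊗ (κ (+ 3) ⊗ A₁ ⊝ A₂ ⊝ κ (+ 2) ⊗ A₃)
      ≈⟨ solve 3 (λ a b c →
           conℤ (- + 4) :* (con 3 :* ((a :- b) :* (con 1 :+ con 8 :* a :- con 32 :* b)) :- (con 5 :* b :- con 4 :* c :- a) :* (con 1 :+ con 16 :* b :- con 32 :* c :- con 8 :* a) :- con 2 :* (con 2 :* ((b :- c) :* (con 1 :+ con 8 :* b :- con 32 :* c))))
           := (conℤ (- + 8) :* (a :- b)) :* (conℤ (- + 8) :* (a :- b)) :- con 16 :* ((con 1 :+ con 8 :* a :- con 32 :* c) :* (a :- con 3 :* b :+ con 2 :* c))) ≈-refl s s₂ s₄ ⟩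
    u ⊗ u ⊝ κ (+ 16) ⊗ X ∎

  D-E : D E ≈ u ⊗ E ⊕ κ (+ 32) ⊗ X
  D-E = begin
    D E
      ≈⟨ ≈-trans (D-⊝ _ _) (⊝-cong (≈-trans (D-⊕ _ _) (≈-trans (⊕-cong (D-κ 1ℤ) (D-κ⊗ (+ 24) s)) (⊕-identityˡ _))) (D-κ⊗ (+ 48) s₂)) ⟩
    κ (+ 24) ⊗ D s ⊝ κ (+ 48) ⊗ D s₂
      ≈⟨ solve 2 (λ a b → con 24 :* a :- con 48 :* b := conℤ (- + 8) :* (a :+ con 2 :* b) :- con 2 :* (con 2 :* (conℤ (- + 8) :* (a :- b)))) ≈-refl (D s) (D s₂) ⟩
    κ (- + 8) ⊗ (D s ⊕ κ (+ 2) ⊗ D s₂) ⊝ κ (+ 2) ⊗ (κ (+ 2) ⊗ (κ (- + 8) ⊗ (D s ⊝ D s₂)))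
      ≈⟨ ⊝-cong (⊗-cong′ ≈-refl eq₁) (⊗-cong′ ≈-refl (≈-trans (⊗-cong′ ≈-refl (≈-sym (≈-trans (D-κ⊗ (- + 8) _) (⊗-cong′ ≈-refl (D-⊝ s s₂))))) D-u)) ⟩
    κ (- + 8) ⊗ A₁ ⊝ κ (+ 2) ⊗ (u ⊗ u ⊝ κ (+ 16) ⊗ X)
      ≈⟨ solve 3 (λ a b x → conℤ (- + 8) :* ((a :- b) :* (con 1 :+ con 8 :* a :- con 32 :* b)) :- con 2 :* ((conℤ (- + 8) :* (a :- b)) :* (conℤ (- + 8) :* (a :- b)) :- con 16 :* x)
           := (conℤ (- + 8) :* (a :- b)) :* (con 1 :+ con 24 :* a :- con 48 :* b) :+ con 32 :* x) ≈-refl s s₂ X ⟩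
    u ⊗ E ⊕ κ (+ 32) ⊗ X ∎

  -- `Y` and `Z` divide their own derivatives, as eta quotients do; therefore so does their product
  -- `X`.
  D-Y : D Y ≈ κ (- + 8) ⊗ (κ (+ 5) ⊗ s₂ ⊝ κ (+ 4) ⊗ s₄ ⊝ s) ⊗ Y
  D-Y = begin
    D Y
      ≈⟨ ≈-trans (D-⊝ _ _) (⊝-cong (≈-trans (D-⊕ _ _) (≈-trans (⊕-cong (D-κ 1ℤ) (D-κ⊗ (+ 8) s)) (⊕-identityˡ _))) (D-κ⊗ (+ 32) s₄)) ⟩
    κ (+ 8) ⊗ D s ⊝ κ (+ 32) ⊗ D s₄
      ≈⟨ solve 3 (λ a b c → con 8 :* a :- con 32 :* c := con 8 :* (a :+ con 2 :* b) :- con 16 :* (b :+ con 2 :* c)) ≈-refl (D s) (D s₂) (D s₄) ⟩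
    κ (+ 8) ⊗ (D s ⊕ κ (+ 2) ⊗ D s₂) ⊝ κ (+ 16) ⊗ (D s₂ ⊕ κ (+ 2) ⊗ D s₄)
      ≈⟨ ⊝-cong (⊗-cong′ ≈-refl eq₁) (⊗-cong′ ≈-refl eq₃) ⟩
    κ (+ 8) ⊗ A₁ ⊝ κ (+ 16) ⊗ A₃
      ≈⟨ solve 3 (λ a b c → con 8 :* ((a :- b) :* (con 1 :+ con 8 :* a :- con 32 :* b)) :- con 16 :* (con 2 :* ((b :- c) :* (con 1 :+ con 8 :* b :- con 32 :* c)))
           := conℤ (- + 8) :* (con 5 :* b :- con 4 :* c :- a) :* (con 1 :+ con 8 :* a :- con 32 :* c)) ≈-refl s s₂ s₄ ⟩
    κ (- + 8) ⊗ (κ (+ 5) ⊗ s₂ ⊝ κ (+ 4) ⊗ s₄ ⊝ s) ⊗ Y ∎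

  D-Z : D Z ≈ Z ⊗ (κ 1ℤ ⊕ κ (+ 8) ⊗ s₂ ⊝ κ (+ 32) ⊗ s₄)
  D-Z = κ-cancel (+ 2) (begin
    κ (+ 2) ⊗ D Z
      ≈⟨ ⊗-cong′ ≈-refl (≈-trans (D-⊕ _ _) (⊕-cong (≈-trans (D-⊝ _ _) (⊝-cong ≈-refl (D-κ⊗ (+ 3) s₂))) (D-κ⊗ (+ 2) s₄))) ⟩
    κ (+ 2) ⊗ (D s ⊝ κ (+ 3) ⊗ D s₂ ⊕ κ (+ 2) ⊗ D s₄)
      ≈⟨ solve 3 (λ a b c → con 2 :* (a :- con 3 :* b :+ con 2 :* c) := (a :+ con 2 :* b) :- (con 8 :* b :- con 4 :* c :- a)) ≈-refl (D s) (D s₂) (D s₄) ⟩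
    (D s ⊕ κ (+ 2) ⊗ D s₂) ⊝ (κ (+ 8) ⊗ D s₂ ⊝ κ (+ 4) ⊗ D s₄ ⊝ D s)
      ≈⟨ ⊝-cong eq₁ eq₂ ⟩
    A₁ ⊝ A₂
      ≈⟨ solve 3 (λ a b c → (a :- b) :* (con 1 :+ con 8 :* a :- con 32 :* b) :- (con 5 :* b :- con 4 :* c :- a) :* (con 1 :+ con 16 :* b :- con 32 :* c :- con 8 :* a)
           := con 2 :* ((a :- con 3 :* b :+ con 2 :* c) :* (con 1 :+ con 8 :* b :- con 32 :* c))) ≈-refl s s₂ s₄ ⟩
    κ (+ 2) ⊗ (Z ⊗ (κ 1ℤ ⊕ κ (+ 8) ⊗ s₂ ⊝ κ (+ 32) ⊗ s₄)) ∎)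

  D-X : D X ≈ (κ (+ 2) ⊗ u ⊕ E) ⊗ X
  D-X = begin
    D X
      ≈⟨ ≈-trans (D-⊗ Y Z) (⊕-cong (⊗-cong′ D-Y ≈-refl) (⊗-cong′ ≈-refl D-Z)) ⟩
    κ (- + 8) ⊗ (κ (+ 5) ⊗ s₂ ⊝ κ (+ 4) ⊗ s₄ ⊝ s) ⊗ Y ⊗ Z ⊕ Y ⊗ (Z ⊗ (κ 1ℤ ⊕ κ (+ 8) ⊗ s₂ ⊝ κ (+ 32) ⊗ s₄))
      ≈⟨ solve 5 (λ a b c y z → conℤ (- + 8) :* (con 5 :* b :- con 4 :* c :- a) :* y :* z :+ y :* (z :* (con 1 :+ con 8 :* b :- con 32 :* c))
           := (con 2 :* (conℤ (- + 8) :* (a :- b)) :+ (con 1 :+ con 24 :* a :- con 48 :* b)) :* (y :* z)) ≈-refl s s₂ s₄ Y Z ⟩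
    (κ (+ 2) ⊗ u ⊕ E) ⊗ X ∎

  -- Eta quotients

  D-injective : ∀ {f g} → D f ≈ D g → f 0 ≡ g 0 → f ≈ g
  D-injective {f} {g} p q = mk λ { zero _ → q ; (suc n) r → ℤP.*-cancelˡ-≡ (+ suc n) (f (suc n)) (g (suc n)) (trans (sym (D-at f (suc n))) (trans (at p (suc n) r) (D-at g (suc n)))) }

  ⊗-last : ∀ β y n → (∀ j → j ℕ.< n → y j ≡ 0ℤ) → (β ⊗ y) n ≡ β 0 · y n
  ⊗-last β y zero    z = ⊗-zero β y
  ⊗-last β y (suc n) z = trans (⊗-suc β y n) (trans (cong (λ t → β 0 · y (suc n) + t)
      (trans (⊗-cong n (λ _ _ → refl) (λ i i≤n → z i (s≤s i≤n))) (trans (⊗-commᵃ (tail β) (λ _ → 0ℤ) n) (⊗-zeroˡ (tail β) n))))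
    (ℤP.+-identityʳ _))

  -- At the first non-zero coefficient the equation reads n · y n = y n, so a non-zero solution has
  -- order 1 and its coefficient at 1 decides.
  log-unique : ∀ {β y} → D y ≈ β ⊗ y → β 0 ≡ 1ℤ → y 1 ≡ 0ℤ → y ≈ κ 0ℤ
  log-unique {β} {y} p b y₁ = mk λ n n≤M → trans (<-rec (λ n → n ℕ.≤ M → y n ≡ 0ℤ) step n n≤M) (sym (κ0-at n))
    where
    eqn : ∀ n → n ℕ.≤ M → (∀ j → j ℕ.< n → y j ≡ 0ℤ) → + n · y n ≡ y n
    eqn n n≤M z = trans (sym (D-at y n)) (trans (at p n n≤M) (trans (⊗-last β y n z) (trans (cong (_· y n) b) (ℤP.*-identityˡ (y n)))))
    step : ∀ n → (∀ {j} → j ℕ.< n → j ℕ.≤ M → y j ≡ 0ℤ) → n ℕ.≤ M → y n ≡ 0ℤ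
    step zero          rec n≤M = sym (trans (sym (ℤP.*-zeroˡ (y 0))) (eqn 0 n≤M (λ _ ())))
    step (suc zero)    rec n≤M = y₁
    step (suc (suc n)) rec n≤M = ℤP.*-cancelˡ-≡ (+ suc n) (y (suc (suc n))) 0ℤ (trans
      (ZS.solve 2 (λ n y → (# 1 ⊹ n) ⋆ y ⊜ (# 1 ⊹ (# 1 ⊹ n)) ⋆ y ∸′ y) refl (+ n) (y (suc (suc n))))
      (trans (cong (_- y (suc (suc n))) (eqn (suc (suc n)) n≤M (λ j j<n → rec j<n (ℕP.≤-trans (ℕP.<⇒≤ j<n) n≤M))))
        (trans (ℤP.+-inverseʳ (y (suc (suc n)))) (sym (ℤP.*-zeroʳ (+ suc n))))))

  -- `ℓ` is the logarithmic derivative of `f`, expressed without division.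
  LD : PS → PS → Set
  LD f ℓ = D f ≈ ℓ ⊗ f

  LD-⊗ : ∀ {f g ℓ m} → LD f ℓ → LD g m → LD (f ⊗ g) (ℓ ⊕ m)
  LD-⊗ {f} {g} {ℓ} {m} p q = ≈-trans (D-⊗ f g) (≈-trans (⊕-cong (⊗-cong′ p ≈-refl) (⊗-cong′ ≈-refl q))
    (solve 4 (λ f g ℓ m → ℓ :* f :* g :+ f :* (m :* g) := (ℓ :+ m) :* (f :* g)) ≈-refl f g ℓ m))

  LD-cong : ∀ {f ℓ m} → ℓ ≈ m → LD f ℓ → LD f m
  LD-cong p q = ≈-trans q (⊗-cong′ p ≈-refl)

  LD-inv : ∀ {f g ℓ} → f ⊗ g ≈ κ 1ℤ → LD f ℓ → LD g (⊖ ℓ)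
  LD-inv {f} {g} {ℓ} p q = begin
    D g
      ≈⟨ ⊗-identityˡ (D g) ⟨
    κ 1ℤ ⊗ D g
      ≈⟨ ⊗-cong′ p ≈-refl ⟨
    f ⊗ g ⊗ D g
      ≈⟨ solve 4 (λ f g d ℓ → f :* g :* d := (ℓ :* f :* g :+ f :* d) :* g :- (ℓ :* (f :* g)) :* g) ≈-refl f g (D g) ℓ ⟩
    (ℓ ⊗ f ⊗ g ⊕ f ⊗ D g) ⊗ g ⊝ ℓ ⊗ (f ⊗ g) ⊗ g
      ≈⟨ ⊝-cong (⊗-cong′ (≈-trans (≈-sym (≈-trans (D-⊗ f g) (⊕-cong (⊗-cong′ q ≈-refl) ≈-refl))) (≈-trans (D-cong p) (D-κ 1ℤ))) ≈-refl) (⊗-cong′ (⊗-cong′ ≈-refl p) ≈-refl) ⟩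
    κ 0ℤ ⊗ g ⊝ ℓ ⊗ κ 1ℤ ⊗ g
      ≈⟨ solve 2 (λ g ℓ → con 0 :* g :- ℓ :* con 1 :* g := (:- ℓ) :* g) ≈-refl g ℓ ⟩
    ⊖ ℓ ⊗ g ∎

  ↑-cong : ∀ {f g} n → f ≈ g → f ↑ n ≈ g ↑ n
  ↑-cong zero    p = ≈-refl
  ↑-cong (suc n) p = ⊗-cong′ p (↑-cong n p)

  LD-↑ : ∀ {f ℓ} n → LD f ℓ → LD (f ↑ n) (κ (+ n) ⊗ ℓ)
  LD-↑ {f} {ℓ} zero    p = ≈-trans (D-κ 1ℤ) (solve 1 (λ ℓ → con 0 := con 0 :* ℓ :* con 1) ≈-refl ℓ)
  LD-↑ {f} {ℓ} (suc n) p = LD-cong (≈-trans (solve 2 (λ n ℓ → ℓ :+ n :* ℓ := (con 1 :+ n) :* ℓ) ≈-refl (κ (+ n)) ℓ) (⊗-cong′ (≈-sym (κ-+ 1ℤ (+ n))) ≈-refl)) (LD-⊗ p (LD-↑ n p))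

  ↑-inv : ∀ {f g} n → f ⊗ g ≈ κ 1ℤ → f ↑ n ⊗ g ↑ n ≈ κ 1ℤ
  ↑-inv zero p = ⊗-identityˡ (κ 1ℤ)
  ↑-inv {f} {g} (suc n) p = ≈-trans (solve 4 (λ f g x y → f :* x :* (g :* y) := (f :* g) :* (x :* y)) ≈-refl f g (f ↑ n) (g ↑ n))
    (≈-trans (⊗-cong′ p (↑-inv n p)) (⊗-identityˡ (κ 1ℤ)))

  ⊗-inv : ∀ {f g f′ g′} → f ⊗ f′ ≈ κ 1ℤ → g ⊗ g′ ≈ κ 1ℤ → (f ⊗ g) ⊗ (f′ ⊗ g′) ≈ κ 1ℤ
  ⊗-inv {f} {g} {f′} {g′} p q = ≈-trans (solve 4 (λ f g x y → f :* g :* (x :* y) := (f :* x) :* (g :* y)) ≈-refl f g f′ g′) (≈-trans (⊗-cong′ p q) (⊗-identityˡ (κ 1ℤ)))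

  ↑-0 : ∀ {f} n → f 0 ≡ 1ℤ → (f ↑ n) 0 ≡ 1ℤ
  ↑-0 zero    p = κ-zero 1ℤ
  ↑-0 (suc n) p = trans (⊗-zero _ _) (cong₂ _·_ p (↑-0 n p))

  ⊗-0 : ∀ {f g} → f 0 ≡ 1ℤ → g 0 ≡ 1ℤ → (f ⊗ g) 0 ≡ 1ℤ
  ⊗-0 p q = trans (⊗-zero _ _) (cong₂ _·_ p q)

  -- For n > 0, 1 + `geo n` is the inverse of 1 - qⁿ up to q^M.
  geo : ℕ → PS
  geo n = S M λ k → Q (n ℕ.* k)

  euler⁻¹ : ℕ → PS
  euler⁻¹ zero    = κ 1ℤ
  euler⁻¹ (suc K) = euler⁻¹ K ⊗ (κ 1ℤ ⊕ geo (suc K))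

  geo-inv : ∀ n → (κ 1ℤ ⊝ Q (suc n)) ⊗ (κ 1ℤ ⊕ geo (suc n)) ≈ κ 1ℤ
  -- The geometric sum telescopes to 1 - q^((n+1)(M+1)), and this exponent exceeds `M`.
  geo-inv n = ≈-trans (lem M) (≈-trans (⊕-cong ≈-refl (⊖-cong (Q-vanish _ (ℕP.m≤m+n (suc M) (n ℕ.* suc M))))) (solve 0 (con 1 :- con 0 := con 1) ≈-refl))
    where
    lem : ∀ K → (κ 1ℤ ⊝ Q (suc n)) ⊗ (κ 1ℤ ⊕ S K λ k → Q (suc n ℕ.* k)) ≈ κ 1ℤ ⊝ Q (suc n ℕ.* suc K)
    lem zero = ≈-trans (solve 1 (λ q → (con 1 :- q) :* (con 1 :+ con 0) := con 1 :- q) ≈-refl (Q (suc n))) (⊝-cong ≈-refl (Q-≡ (sym (ℕP.*-identityʳ (suc n)))))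
    lem (suc K) = ≈-trans (solve 3 (λ q x y → (con 1 :- q) :* (con 1 :+ (x :+ y)) := (con 1 :- q) :* (con 1 :+ x) :+ y :- q :* y) ≈-refl (Q (suc n)) (S K λ k → Q (suc n ℕ.* k)) (Q (suc n ℕ.* suc K)))
      (≈-trans (⊝-cong (⊕-cong (lem K) ≈-refl) (≈-trans (≈-sym (Q-+ (suc n) (suc n ℕ.* suc K))) (Q-≡ (sym (ℕP.*-suc (suc n) (suc K))))))
        (solve 2 (λ y z → con 1 :- y :+ y :- z := con 1 :- z) ≈-refl _ _))

  euler-inv : ∀ K → euler K ⊗ euler⁻¹ K ≈ κ 1ℤ
  euler-inv zero    = ⊗-identityˡ (κ 1ℤ)
  euler-inv (suc K) = ⊗-inv (euler-inv K) (geo-inv K)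

  LD-factor : ∀ n → LD (κ 1ℤ ⊝ Q (suc n)) (⊖ (κ (+ suc n) ⊗ geo (suc n)))
  LD-factor n = begin
    D (κ 1ℤ ⊝ Q (suc n))
      ≈⟨ ≈-trans (D-⊝ _ _) (⊝-cong (D-κ 1ℤ) (D-Q (suc n))) ⟩
    κ 0ℤ ⊝ κ (+ suc n) ⊗ Q (suc n)
      ≈⟨ solve 3 (λ n q g → con 0 :- n :* q := n :* (con 1 :- q) :- n :* con 1) ≈-refl (κ (+ suc n)) (Q (suc n)) (geo (suc n)) ⟩
    κ (+ suc n) ⊗ (κ 1ℤ ⊝ Q (suc n)) ⊝ κ (+ suc n) ⊗ κ 1ℤ
      ≈⟨ ⊝-cong ≈-refl (⊗-cong′ ≈-refl (geo-inv n)) ⟨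
    κ (+ suc n) ⊗ (κ 1ℤ ⊝ Q (suc n)) ⊝ κ (+ suc n) ⊗ ((κ 1ℤ ⊝ Q (suc n)) ⊗ (κ 1ℤ ⊕ geo (suc n)))
      ≈⟨ solve 3 (λ n f g → n :* f :- n :* (f :* (con 1 :+ g)) := (:- (n :* g)) :* f) ≈-refl (κ (+ suc n)) (κ 1ℤ ⊝ Q (suc n)) (geo (suc n)) ⟩
    ⊖ (κ (+ suc n) ⊗ geo (suc n)) ⊗ (κ 1ℤ ⊝ Q (suc n)) ∎

  LD-euler : ∀ K → LD (euler K) (⊖ S K (λ n → κ (+ n) ⊗ geo n))
  LD-euler zero    = ≈-trans (D-κ 1ℤ) (solve 0 (con 0 := (:- con 0) :* con 1) ≈-refl)
  LD-euler (suc K) = LD-cong (solve 2 (λ a b → (:- a) :+ (:- b) := :- (a :+ b)) ≈-refl _ _) (LD-⊗ (LD-euler K) (LD-factor K))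

  e₁ e₂ i₁ i₂ : PS
  e₁ = euler M
  i₁ = euler⁻¹ M
  e₂ = V e₁
  i₂ = V i₁

  e₁i₁ : e₁ ⊗ i₁ ≈ κ 1ℤ
  e₁i₁ = euler-inv M

  e₂i₂ : e₂ ⊗ i₂ ≈ κ 1ℤ
  e₂i₂ = ≈-trans (≈-sym (V-⊗ e₁ i₁)) (≈-trans (V-cong e₁i₁) (V-κ 1ℤ))

  LD-e₁ : LD e₁ (⊖ s)
  LD-e₁ = LD-cong (⊖-cong (S-cong M λ n → ≈-sym (S-⊗ˡ M (κ (+ suc n)) (λ k → Q (suc n ℕ.* k))))) (LD-euler M)

  LD-e₂ : LD e₂ (κ (- + 2) ⊗ s₂)
  LD-e₂ = begin
    D e₂
      ≈⟨ ≈-trans (V-D e₁) (⊗-cong′ ≈-refl (V-cong (≈-trans LD-e₁ (solve 2 (λ s e → (:- s) :* e := conℤ (- 1ℤ) :* (s :* e)) ≈-refl s e₁)))) ⟩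
    κ (+ 2) ⊗ V (κ (- 1ℤ) ⊗ (s ⊗ e₁))
      ≈⟨ ⊗-cong′ ≈-refl (≈-trans (V-⊗ _ _) (⊗-cong′ (V-κ _) (V-⊗ s e₁))) ⟩
    κ (+ 2) ⊗ (κ (- 1ℤ) ⊗ (s₂ ⊗ e₂))
      ≈⟨ solve 2 (λ s e → con 2 :* (conℤ (- 1ℤ) :* (s :* e)) := conℤ (- + 2) :* s :* e) ≈-refl s₂ e₂ ⟩
    κ (- + 2) ⊗ s₂ ⊗ e₂ ∎

  euler-0 : ∀ K → euler K 0 ≡ 1ℤ
  euler-0 zero    = κ-zero 1ℤ
  euler-0 (suc K) = ⊗-0 (euler-0 K) (trans (⊕-at (κ 1ℤ) (⊖ Q (suc K)) 0) (cong₂ _+_ (κ-zero 1ℤ) (trans (⊖-at (Q (suc K)) 0) (cong -_ (Q-suc-zero K)))))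

  e₁-0 : e₁ 0 ≡ 1ℤ
  e₁-0 = euler-0 M

  inv-0 : ∀ {f g} → f 0 ≡ 1ℤ → f ⊗ g ≈ κ 1ℤ → g 0 ≡ 1ℤ
  inv-0 {f} {g} p q = trans (sym (trans (⊗-zero f g) (trans (cong (_· g 0) p) (ℤP.*-identityˡ (g 0))))) (trans (at q 0 z≤n) (κ-zero 1ℤ))

  -- W = η(z)⁸/η(2z)⁴ and T = η(2z)²⁴/η(z)²⁴, the Hauptmodul of Γ₀(2); T = qσ² and ζ = σ⁻¹.
  W W⁻¹ σ ζ T : PS
  W   = e₁ ↑ 8 ⊗ i₂ ↑ 4
  W⁻¹ = i₁ ↑ 8 ⊗ e₂ ↑ 4
  σ   = e₂ ↑ 12 ⊗ i₁ ↑ 12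
  ζ   = i₂ ↑ 12 ⊗ e₁ ↑ 12
  T   = Q 1 ⊗ (σ ⊗ σ)

  WW⁻¹ : W ⊗ W⁻¹ ≈ κ 1ℤ
  WW⁻¹ = ⊗-inv (↑-inv 8 e₁i₁) (↑-inv 4 (≈-trans (⊗-comm i₂ e₂) e₂i₂))

  σζ : σ ⊗ ζ ≈ κ 1ℤ
  σζ = ⊗-inv (↑-inv 12 e₂i₂) (↑-inv 12 (≈-trans (⊗-comm i₁ e₁) e₁i₁))

  LD-i₁ : LD i₁ (⊖ (⊖ s))
  LD-i₁ = LD-inv e₁i₁ LD-e₁

  LD-i₂ : LD i₂ (⊖ (κ (- + 2) ⊗ s₂))
  LD-i₂ = LD-inv e₂i₂ LD-e₂

  LD-W : LD W u
  LD-W = LD-cong (solve 2 (λ a b → con 8 :* (:- a) :+ con 4 :* (:- (conℤ (- + 2) :* b)) := conℤ (- + 8) :* (a :- b)) ≈-refl s s₂) (LD-⊗ (LD-↑ 8 LD-e₁) (LD-↑ 4 LD-i₂))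

  LD-W⁻¹ : LD W⁻¹ (⊖ u)
  LD-W⁻¹ = LD-inv WW⁻¹ LD-W

  η : PS
  η = κ (+ 12) ⊗ (s ⊝ κ (+ 2) ⊗ s₂)

  LD-σ : LD σ η
  LD-σ = LD-cong (solve 2 (λ a b → con 12 :* (conℤ (- + 2) :* b) :+ con 12 :* (:- (:- a)) := con 12 :* (a :- con 2 :* b)) ≈-refl s s₂) (LD-⊗ (LD-↑ 12 LD-e₂) (LD-↑ 12 LD-i₁))

  LD-ζ : LD ζ (⊖ η)
  LD-ζ = LD-inv σζ LD-σ

  LD-Q : ∀ e → LD (Q e) (κ (+ e))
  LD-Q = D-Q

  E-η : κ 1ℤ ⊕ κ (+ 2) ⊗ η ≈ E
  E-η = solve 2 (λ a b → con 1 :+ con 2 :* (con 12 :* (a :- con 2 :* b)) := con 1 :+ con 24 :* a :- con 48 :* b) ≈-refl s s₂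

  LD-T : LD T E
  LD-T = LD-cong (≈-trans (solve 1 (λ h → con 1 :+ (h :+ h) := con 1 :+ con 2 :* h) ≈-refl η) E-η) (LD-⊗ (LD-Q 1) (LD-⊗ LD-σ LD-σ))

  e₂-0 : e₂ 0 ≡ 1ℤ
  e₂-0 = trans (V-double e₁ 0) e₁-0

  i₁-0 : i₁ 0 ≡ 1ℤ
  i₁-0 = inv-0 e₁-0 e₁i₁

  i₂-0 : i₂ 0 ≡ 1ℤ
  i₂-0 = inv-0 e₂-0 e₂i₂

  W-0 : W 0 ≡ 1ℤ
  W-0 = ⊗-0 (↑-0 8 e₁-0) (↑-0 4 i₂-0)

  W⁻¹-0 : W⁻¹ 0 ≡ 1ℤ
  W⁻¹-0 = ⊗-0 (↑-0 8 i₁-0) (↑-0 4 e₂-0)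

  σ-0 : σ 0 ≡ 1ℤ
  σ-0 = ⊗-0 (↑-0 12 e₂-0) (↑-0 12 i₁-0)

  ζ-0 : ζ 0 ≡ 1ℤ
  ζ-0 = ⊗-0 (↑-0 12 i₂-0) (↑-0 12 e₁-0)

  ⊗-1 : ∀ f g → (f ⊗ g) 1 ≡ f 0 · g 1 + f 1 · g 0
  ⊗-1 f g = trans (⊗-suc f g 0) (cong (λ z → f 0 · g 1 + z) (⊗-zero (tail f) g))

  ⊝-at : ∀ f g n → (f ⊝ g) n ≡ f n - g n
  ⊝-at f g n = trans (⊕-at f (⊖ g) n) (cong (λ z → f n + z) (⊖-at g n))

  euler-1 : ∀ K → euler (suc K) 1 ≡ - 1ℤ
  euler-1 zero = trans (⊗-1 (κ 1ℤ) (κ 1ℤ ⊝ Q 1)) (trans (cong₂ (λ x y → x · (κ 1ℤ ⊝ Q 1) 1 + y · (κ 1ℤ ⊝ Q 1) 0) (κ-zero 1ℤ) (κ-suc 1ℤ 0))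
    (trans (cong (λ z → 1ℤ · z + 0ℤ · (κ 1ℤ ⊝ Q 1) 0) (trans (⊝-at (κ 1ℤ) (Q 1) 1) (cong₂ _-_ (κ-suc 1ℤ 0) (trans (Q-suc-suc 0 0) (trans (Q-zero 0) (κ-zero 1ℤ))))))
      (ZS.solve 1 (λ x → # 1 ⋆ ∸′ # 1 ⊹ # 0 ⋆ x ⊜ ∸′ # 1) refl ((κ 1ℤ ⊝ Q 1) 0))))
  euler-1 (suc K) = trans (⊗-1 (euler (suc K)) f) (trans (cong₂ (λ x y → x · f 1 + y · f 0) (euler-0 (suc K)) (euler-1 K))
    (cong₂ (λ x y → 1ℤ · x + - 1ℤ · y) (trans (⊝-at (κ 1ℤ) (Q (suc (suc K))) 1) (cong₂ _-_ (κ-suc 1ℤ 0) (trans (Q-suc-suc (suc K) 0) (Q-suc-zero K))))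
      (trans (⊝-at (κ 1ℤ) (Q (suc (suc K))) 0) (cong₂ _-_ (κ-zero 1ℤ) (Q-suc-zero (suc K))))))
    where
    f : PS
    f = κ 1ℤ ⊝ Q (suc (suc K))

  s-0 : s 0 ≡ 0ℤ
  s-0 = ℤP.neg-injective (trans (sym (trans (⊗-zero (⊖ s) e₁) (trans (cong₂ _·_ (⊖-at s 0) e₁-0) (ℤP.*-identityʳ (- s 0)))))
    (trans (sym (at LD-e₁ 0 z≤n)) (D-at e₁ 0)))

  s₂-0 : s₂ 0 ≡ 0ℤ
  s₂-0 = trans (V-double s 0) s-0

  s₄-0 : s₄ 0 ≡ 0ℤ
  s₄-0 = trans (V-double s₂ 0) s₂-0

  -- Read off from `LD-e₁` at q, where `e₁` begins with 1 - q. For M = 0 this coefficient lies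
  -- beyond the precision.
  s-1 : 1 ℕ.≤ M → s 1 ≡ 1ℤ
  s-1 1≤M = ℤP.neg-injective (trans (sym (trans (⊗-1 (⊖ s) e₁) (trans (cong₂ (λ x y → x · e₁ 1 + y · e₁ 0) (trans (⊖-at s 0) (cong -_ s-0)) (⊖-at s 1))
      (trans (cong (λ z → 0ℤ · e₁ 1 + - s 1 · z) e₁-0) (ZS.solve 2 (λ x y → # 0 ⋆ x ⊹ (∸′ y) ⋆ # 1 ⊜ ∸′ y) refl (e₁ 1) (s 1))))))
    (trans (sym (at LD-e₁ 1 1≤M)) (trans (D-at e₁ 1) (trans (ℤP.*-identityˡ (e₁ 1)) (euler-1′ M 1≤M)))))
    where
    euler-1′ : ∀ K → 1 ℕ.≤ K → euler K 1 ≡ - 1ℤ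
    euler-1′ (suc K) _ = euler-1 K

  E-0 : E 0 ≡ 1ℤ
  E-0 = trans (⊝-at (κ 1ℤ ⊕ κ (+ 24) ⊗ s) (κ (+ 48) ⊗ s₂) 0) (trans (cong₂ _-_ (trans (⊕-at (κ 1ℤ) (κ (+ 24) ⊗ s) 0) (cong₂ _+_ (κ-zero 1ℤ) (trans (κ-⊗ (+ 24) s 0) (cong (+ 24 ·_) s-0))))
    (trans (κ-⊗ (+ 48) s₂ 0) (cong (+ 48 ·_) s₂-0))) refl)

  Y-0 : Y 0 ≡ 1ℤ
  Y-0 = trans (⊝-at (κ 1ℤ ⊕ κ (+ 8) ⊗ s) (κ (+ 32) ⊗ s₄) 0) (trans (cong₂ _-_ (trans (⊕-at (κ 1ℤ) (κ (+ 8) ⊗ s) 0) (cong₂ _+_ (κ-zero 1ℤ) (trans (κ-⊗ (+ 8) s 0) (cong (+ 8 ·_) s-0))))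
    (trans (κ-⊗ (+ 32) s₄ 0) (cong (+ 32 ·_) s₄-0))) refl)

  u-0 : u 0 ≡ 0ℤ
  u-0 = trans (κ-⊗ (- + 8) (s ⊝ s₂) 0) (cong (- + 8 ·_) (trans (⊝-at s s₂ 0) (cong₂ _-_ s-0 s₂-0)))

  Z-at : ∀ n → Z n ≡ s n - + 3 · s₂ n + + 2 · s₄ n
  Z-at n = trans (⊕-at (s ⊝ κ (+ 3) ⊗ s₂) (κ (+ 2) ⊗ s₄) n) (cong₂ _+_ (trans (⊝-at s (κ (+ 3) ⊗ s₂) n) (cong (λ z → s n - z) (κ-⊗ (+ 3) s₂ n))) (κ-⊗ (+ 2) s₄ n))

  Z-0 : Z 0 ≡ 0ℤ
  Z-0 = trans (Z-at 0) (trans (cong₂ (λ x y → x - + 3 · y + + 2 · s₄ 0) s-0 s₂-0) (cong (λ z → 0ℤ + + 2 · z) s₄-0))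

  Z-1 : 1 ℕ.≤ M → Z 1 ≡ 1ℤ
  Z-1 1≤M = trans (Z-at 1) (trans (cong₂ (λ x y → x - + 3 · y + + 2 · s₄ 1) (s-1 1≤M) (V-1 s)) (cong (λ z → 1ℤ + + 2 · z) (V-1 s₂)))

  T-1 : T 1 ≡ 1ℤ
  T-1 = trans (⊗-1 (Q 1) (σ ⊗ σ)) (trans (cong₂ (λ x y → x · (σ ⊗ σ) 1 + y · (σ ⊗ σ) 0) (Q-suc-zero 0) (trans (Q-suc-suc 0 0) (trans (Q-zero 0) (κ-zero 1ℤ))))
    (trans (cong (λ z → 0ℤ · (σ ⊗ σ) 1 + 1ℤ · z) (⊗-0 σ-0 σ-0)) (ZS.solve 1 (λ x → # 0 ⋆ x ⊹ # 1 ⊜ # 1) refl ((σ ⊗ σ) 1))))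

  T-0 : T 0 ≡ 0ℤ
  T-0 = trans (⊗-zero (Q 1) (σ ⊗ σ)) (trans (cong (_· (σ ⊗ σ) 0) (Q-suc-zero 0)) (ℤP.*-zeroˡ ((σ ⊗ σ) 0)))

  LD-WWT : LD (W ⊗ W ⊗ T) (κ (+ 2) ⊗ u ⊕ E)
  LD-WWT = LD-cong (solve 2 (λ u e → u :+ u :+ e := con 2 :* u :+ e) ≈-refl u E) (LD-⊗ (LD-⊗ LD-W LD-W) LD-T)

  -- Both sides have the logarithmic derivative 2u + E, whose constant term is 1, and both begin
  -- with q.
  X-W : X ≈ W ⊗ W ⊗ T
  X-W = begin
    X
      ≈⟨ solve 2 (λ x y → x := (x :- y) :+ y) ≈-refl X (W ⊗ W ⊗ T) ⟩
    (X ⊝ W ⊗ W ⊗ T) ⊕ W ⊗ W ⊗ T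
      ≈⟨ ⊕-cong (vanish M refl) ≈-refl ⟩
    κ 0ℤ ⊕ W ⊗ W ⊗ T
      ≈⟨ ⊕-identityˡ _ ⟩
    W ⊗ W ⊗ T ∎
    where
    LD-diff : LD (X ⊝ W ⊗ W ⊗ T) (κ (+ 2) ⊗ u ⊕ E)
    LD-diff = ≈-trans (D-⊝ _ _) (≈-trans (⊝-cong D-X LD-WWT) (solve 3 (λ β x y → β :* x :- β :* y := β :* (x :- y)) ≈-refl (κ (+ 2) ⊗ u ⊕ E) X (W ⊗ W ⊗ T)))
    β-0 : (κ (+ 2) ⊗ u ⊕ E) 0 ≡ 1ℤ
    β-0 = trans (⊕-at (κ (+ 2) ⊗ u) E 0) (cong₂ _+_ (trans (κ-⊗ (+ 2) u 0) (cong (+ 2 ·_) u-0)) E-0)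
    X-1 : 1 ℕ.≤ M → X 1 ≡ 1ℤ
    X-1 1≤M = trans (⊗-1 Y Z) (trans (cong₂ (λ x y → x · Z 1 + Y 1 · y) Y-0 Z-0) (trans (cong (λ z → 1ℤ · z + Y 1 · 0ℤ) (Z-1 1≤M)) (ZS.solve 1 (λ y → # 1 ⊹ y ⋆ # 0 ⊜ # 1) refl (Y 1))))
    WWT-1 : (W ⊗ W ⊗ T) 1 ≡ 1ℤ
    WWT-1 = trans (⊗-1 (W ⊗ W) T) (trans (cong₂ (λ x y → x · T 1 + (W ⊗ W) 1 · y) (⊗-0 W-0 W-0) T-0) (trans (cong (λ z → 1ℤ · z + (W ⊗ W) 1 · 0ℤ) T-1) (ZS.solve 1 (λ y → # 1 ⊹ y ⋆ # 0 ⊜ # 1) refl ((W ⊗ W) 1))))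
    X-0 : X 0 ≡ 0ℤ
    X-0 = trans (⊗-zero Y Z) (trans (cong (Y 0 ·_) Z-0) (ℤP.*-zeroʳ (Y 0)))
    WWT-0 : (W ⊗ W ⊗ T) 0 ≡ 0ℤ
    WWT-0 = trans (⊗-zero (W ⊗ W) T) (trans (cong ((W ⊗ W) 0 ·_) T-0) (ℤP.*-zeroʳ ((W ⊗ W) 0)))
    vanish : ∀ K → K ≡ M → X ⊝ W ⊗ W ⊗ T ≈ κ 0ℤ
    vanish zero K≡M = mk λ { zero _ → trans (⊝-at X (W ⊗ W ⊗ T) 0) (trans (cong₂ _-_ X-0 WWT-0) (sym (κ-zero 0ℤ)))
                           ; (suc n) p → ⊥-elim (ℕP.1+n≰n (ℕP.≤-trans p (ℕP.≤-trans (ℕP.≤-reflexive (sym K≡M)) z≤n))) }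
    vanish (suc K) K≡M = log-unique LD-diff β-0 (trans (⊝-at X (W ⊗ W ⊗ T) 1) (cong₂ _-_ (X-1 (subst (1 ℕ.≤_) K≡M (s≤s z≤n))) WWT-1))

  T-W : X ⊗ W⁻¹ ≈ W ⊗ T
  T-W = ≈-trans (⊗-cong′ X-W ≈-refl) (≈-trans (solve 3 (λ w v t → w :* w :* t :* v := (w :* v) :* (w :* t)) ≈-refl W W⁻¹ T)
    (≈-trans (⊗-cong′ WW⁻¹ ≈-refl) (⊗-identityˡ _)))

  -- D(E/W) = 32X/W = 32WT and DT = ET, so (E/W)² and 1 + 64T have the same derivative 64ET and the
  -- same constant term.
  E² : E ⊗ E ≈ W ⊗ W ⊕ κ (+ 64) ⊗ X
  E² = begin
    E ⊗ E
      ≈⟨ solve 1 (λ e → e :* e := e :* e :* (con 1 :* con 1)) ≈-refl E ⟩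
    E ⊗ E ⊗ (κ 1ℤ ⊗ κ 1ℤ)
      ≈⟨ ⊗-cong′ ≈-refl (⊗-cong′ WW⁻¹ WW⁻¹) ⟨
    E ⊗ E ⊗ (W ⊗ W⁻¹ ⊗ (W ⊗ W⁻¹))
      ≈⟨ solve 3 (λ e w v → e :* e :* (w :* v :* (w :* v)) := w :* w :* ((e :* v) :* (e :* v))) ≈-refl E W W⁻¹ ⟩
    W ⊗ W ⊗ ((E ⊗ W⁻¹) ⊗ (E ⊗ W⁻¹))
      ≈⟨ ⊗-cong′ ≈-refl (D-injective derivative constant) ⟩
    W ⊗ W ⊗ (κ 1ℤ ⊕ κ (+ 64) ⊗ T)
      ≈⟨ solve 2 (λ w t → w :* w :* (con 1 :+ con 64 :* t) := w :* w :+ con 64 :* (w :* w :* t)) ≈-refl W T ⟩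
    W ⊗ W ⊕ κ (+ 64) ⊗ (W ⊗ W ⊗ T)
      ≈⟨ ⊕-cong ≈-refl (⊗-cong′ ≈-refl X-W) ⟨
    W ⊗ W ⊕ κ (+ 64) ⊗ X ∎
    where
    D-EW : D (E ⊗ W⁻¹) ≈ κ (+ 32) ⊗ (W ⊗ T)
    D-EW = ≈-trans (D-⊗ E W⁻¹) (≈-trans (⊕-cong (⊗-cong′ D-E ≈-refl) (⊗-cong′ ≈-refl LD-W⁻¹))
      (≈-trans (solve 4 (λ u e x v → (u :* e :+ con 32 :* x) :* v :+ e :* ((:- u) :* v) := con 32 :* (x :* v)) ≈-refl u E X W⁻¹) (⊗-cong′ ≈-refl T-W)))
    derivative : D ((E ⊗ W⁻¹) ⊗ (E ⊗ W⁻¹)) ≈ D (κ 1ℤ ⊕ κ (+ 64) ⊗ T)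
    derivative = begin
      D ((E ⊗ W⁻¹) ⊗ (E ⊗ W⁻¹))
        ≈⟨ ≈-trans (D-⊗ _ _) (⊕-cong (⊗-cong′ D-EW ≈-refl) (⊗-cong′ ≈-refl D-EW)) ⟩
      κ (+ 32) ⊗ (W ⊗ T) ⊗ (E ⊗ W⁻¹) ⊕ (E ⊗ W⁻¹) ⊗ (κ (+ 32) ⊗ (W ⊗ T))
        ≈⟨ solve 4 (λ w v e t → con 32 :* (w :* t) :* (e :* v) :+ (e :* v) :* (con 32 :* (w :* t)) := con 64 :* ((w :* v) :* (e :* t))) ≈-refl W W⁻¹ E T ⟩
      κ (+ 64) ⊗ ((W ⊗ W⁻¹) ⊗ (E ⊗ T))
        ≈⟨ ⊗-cong′ ≈-refl (≈-trans (⊗-cong′ WW⁻¹ (≈-sym LD-T)) (⊗-identityˡ (D T))) ⟩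
      κ (+ 64) ⊗ D T
        ≈⟨ ≈-trans (D-⊕ _ _) (≈-trans (⊕-cong (D-κ 1ℤ) (D-κ⊗ (+ 64) T)) (⊕-identityˡ _)) ⟨
      D (κ 1ℤ ⊕ κ (+ 64) ⊗ T) ∎
    constant : ((E ⊗ W⁻¹) ⊗ (E ⊗ W⁻¹)) 0 ≡ (κ 1ℤ ⊕ κ (+ 64) ⊗ T) 0
    constant = trans (⊗-0 (⊗-0 E-0 W⁻¹-0) (⊗-0 E-0 W⁻¹-0)) (sym (trans (⊕-at (κ 1ℤ) (κ (+ 64) ⊗ T) 0) (cong₂ _+_ (κ-zero 1ℤ) (trans (κ-⊗ (+ 64) T 0) (cong (+ 64 ·_) T-0)))))

  -- The terminating solution of the differential equation

  p : ℤ
  p = + 2 · + M + 1ℤ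

  -- The conjugate of 2D by q^(p/2): it multiplies the coefficient at n by 2n - p.
  Δ : PS → PS
  Δ f = κ (+ 2) ⊗ D f ⊝ κ p ⊗ f

  Δ-at : ∀ f n → Δ f n ≡ (+ 2 · + n - p) · f n
  Δ-at f n = trans (⊝-at (κ (+ 2) ⊗ D f) (κ p ⊗ f) n) (trans (cong₂ _-_ (trans (κ-⊗ (+ 2) (D f) n) (cong (+ 2 ·_) (D-at f n))) (κ-⊗ p f n))
    (ZS.solve 3 (λ n p x → # 2 ⋆ (n ⋆ x) ∸′ p ⋆ x ⊜ (# 2 ⋆ n ∸′ p) ⋆ x) refl (+ n) p (f n)))

  Δ-cong : ∀ {f g} → f ≈ g → Δ f ≈ Δ g
  Δ-cong q = ⊝-cong (⊗-cong′ ≈-refl (D-cong q)) (⊗-cong′ ≈-refl q)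

  Δ-⊕ : ∀ f g → Δ (f ⊕ g) ≈ Δ f ⊕ Δ g
  Δ-⊕ f g = ≈-trans (⊝-cong (⊗-cong′ ≈-refl (D-⊕ f g)) ≈-refl)
    (solve 5 (λ a b x y p → con 2 :* (a :+ b) :- p :* (x :+ y) := con 2 :* a :- p :* x :+ (con 2 :* b :- p :* y)) ≈-refl (D f) (D g) f g (κ p))

  Δ-κ⊗ : ∀ c f → Δ (κ c ⊗ f) ≈ κ c ⊗ Δ f
  Δ-κ⊗ c f = ≈-trans (⊝-cong (⊗-cong′ ≈-refl (D-κ⊗ c f)) ≈-refl)
    (solve 4 (λ c d f p → con 2 :* (c :* d) :- p :* (c :* f) := c :* (con 2 :* d :- p :* f)) ≈-refl (κ c) (D f) f (κ p))

  Δ³ : PS → PS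
  Δ³ f = Δ (Δ (Δ f))

  Δ-⊗ : ∀ f y e → Δ y ≈ e ⊗ y → Δ (f ⊗ y) ≈ (e ⊗ f ⊕ κ (+ 2) ⊗ D f) ⊗ y
  Δ-⊗ f y e q = begin
    κ (+ 2) ⊗ D (f ⊗ y) ⊝ κ p ⊗ (f ⊗ y)
      ≈⟨ ⊝-cong (⊗-cong′ ≈-refl (D-⊗ f y)) ≈-refl ⟩
    κ (+ 2) ⊗ (D f ⊗ y ⊕ f ⊗ D y) ⊝ κ p ⊗ (f ⊗ y)
      ≈⟨ solve 5 (λ a f b y p → con 2 :* (a :* y :+ f :* b) :- p :* (f :* y) := con 2 :* a :* y :+ f :* (con 2 :* b :- p :* y)) ≈-refl (D f) f (D y) y (κ p) ⟩
    κ (+ 2) ⊗ D f ⊗ y ⊕ f ⊗ Δ y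
      ≈⟨ ⊕-cong ≈-refl (⊗-cong′ ≈-refl q) ⟩
    κ (+ 2) ⊗ D f ⊗ y ⊕ f ⊗ (e ⊗ y)
      ≈⟨ solve 4 (λ a f e y → con 2 :* a :* y :+ f :* (e :* y) := (e :* f :+ con 2 :* a) :* y) ≈-refl (D f) f e y ⟩
    (e ⊗ f ⊕ κ (+ 2) ⊗ D f) ⊗ y ∎

  -- Bol's identity: the cube of Δ sends a form of weight -2 to one of weight 4.
  Δ³-form : ∀ ρ y → Δ y ≈ (κ (- + 2) ⊗ u ⊝ κ ρ ⊗ E) ⊗ y →
    Δ³ y ≈ E ⊗ (κ (- cube ρ) ⊗ (W ⊗ W ⊗ y) ⊝ κ (+ 64 · cube (ρ - 1ℤ)) ⊗ (X ⊗ y))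
  Δ³-form ρ y q = begin
    Δ³ y
      ≈⟨ Δ-cong (≈-trans (Δ-cong q) (Δ-⊗ e y e q)) ⟩
    Δ (f₂ ⊗ y)
      ≈⟨ Δ-⊗ f₂ y e q ⟩
    (e ⊗ f₂ ⊕ κ (+ 2) ⊗ D f₂) ⊗ y
      ≈⟨ ⊗-cong′ f₃ ≈-refl ⟩
    E ⊗ (κ (- cube ρ) ⊗ (W ⊗ W) ⊝ κ (+ 64 · cube (ρ - 1ℤ)) ⊗ X) ⊗ y
      ≈⟨ solve 6 (λ e a w b x y → e :* (a :* w :- b :* x) :* y := e :* (a :* (w :* y) :- b :* (x :* y))) ≈-refl E (κ (- cube ρ)) (W ⊗ W) (κ (+ 64 · cube (ρ - 1ℤ))) X y ⟩
    E ⊗ (κ (- cube ρ) ⊗ (W ⊗ W ⊗ y) ⊝ κ (+ 64 · cube (ρ - 1ℤ)) ⊗ (X ⊗ y)) ∎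
    where
    r e d f₂ : PS
    r = κ ρ
    e = κ (- + 2) ⊗ u ⊝ κ ρ ⊗ E
    d = κ (+ 16) ⊗ X ⊝ u ⊗ u ⊝ κ ρ ⊗ (u ⊗ E ⊕ κ (+ 32) ⊗ X)
    f₂ = e ⊗ e ⊕ κ (+ 2) ⊗ D e
    D-e : D e ≈ d
    D-e = ≈-trans (D-⊝ _ _) (≈-trans (⊝-cong (≈-trans (D-κ⊗ (- + 2) u) (solve 1 (λ a → conℤ (- + 2) :* a := :- (con 2 :* a)) ≈-refl (D u))) (D-κ⊗ ρ E))
      (≈-trans (⊝-cong (⊖-cong D-u) (⊗-cong′ ≈-refl D-E)) (solve 4 (λ u x r e → (:- (u :* u :- con 16 :* x)) :- r :* (u :* e :+ con 32 :* x) := con 16 :* x :- u :* u :- r :* (u :* e :+ con 32 :* x)) ≈-refl u X r E)))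
    D-d : κ (+ 2) ⊗ D d ≈ κ (+ 32) ⊗ ((κ (+ 2) ⊗ u ⊕ E) ⊗ X) ⊝ κ (+ 2) ⊗ u ⊗ (u ⊗ u ⊝ κ (+ 16) ⊗ X) ⊝ r ⊗ ((u ⊗ u ⊝ κ (+ 16) ⊗ X) ⊗ E ⊕ κ (+ 2) ⊗ u ⊗ (u ⊗ E ⊕ κ (+ 32) ⊗ X) ⊕ κ (+ 64) ⊗ ((κ (+ 2) ⊗ u ⊕ E) ⊗ X))
    D-d = begin
      κ (+ 2) ⊗ D d
        ≈⟨ ⊗-cong′ ≈-refl (≈-trans (D-⊝ _ _) (⊝-cong (≈-trans (D-⊝ _ _) (⊝-cong (D-κ⊗ (+ 16) X) (D-⊗ u u))) (≈-trans (D-κ⊗ ρ _) (⊗-cong′ ≈-refl (≈-trans (D-⊕ _ _) (⊕-cong (D-⊗ u E) (D-κ⊗ (+ 32) X))))))) ⟩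
      κ (+ 2) ⊗ (κ (+ 16) ⊗ D X ⊝ (D u ⊗ u ⊕ u ⊗ D u) ⊝ r ⊗ (D u ⊗ E ⊕ u ⊗ D E ⊕ κ (+ 32) ⊗ D X))
        ≈⟨ solve 6 (λ dx du u r e de → con 2 :* (con 16 :* dx :- (du :* u :+ u :* du) :- r :* (du :* e :+ u :* de :+ con 32 :* dx))
             := con 32 :* dx :- con 2 :* u :* (con 2 :* du) :- r :* ((con 2 :* du) :* e :+ con 2 :* u :* de :+ con 64 :* dx)) ≈-refl (D X) (D u) u r E (D E) ⟩
      κ (+ 32) ⊗ D X ⊝ κ (+ 2) ⊗ u ⊗ (κ (+ 2) ⊗ D u) ⊝ r ⊗ (κ (+ 2) ⊗ D u ⊗ E ⊕ κ (+ 2) ⊗ u ⊗ D E ⊕ κ (+ 64) ⊗ D X)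
        ≈⟨ ⊝-cong (⊝-cong (⊗-cong′ ≈-refl D-X) (⊗-cong′ ≈-refl D-u)) (⊗-cong′ ≈-refl (⊕-cong (⊕-cong (⊗-cong′ D-u ≈-refl) (⊗-cong′ ≈-refl D-E)) (⊗-cong′ ≈-refl D-X))) ⟩
      κ (+ 32) ⊗ ((κ (+ 2) ⊗ u ⊕ E) ⊗ X) ⊝ κ (+ 2) ⊗ u ⊗ (u ⊗ u ⊝ κ (+ 16) ⊗ X) ⊝ r ⊗ ((u ⊗ u ⊝ κ (+ 16) ⊗ X) ⊗ E ⊕ κ (+ 2) ⊗ u ⊗ (u ⊗ E ⊕ κ (+ 32) ⊗ X) ⊕ κ (+ 64) ⊗ ((κ (+ 2) ⊗ u ⊕ E) ⊗ X)) ∎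
    κ-cube : ∀ c → κ (cube c) ≈ κ c ⊗ κ c ⊗ κ c
    κ-cube c = ≈-trans (κ-* (c · c) c) (⊗-cong′ (κ-* c c) ≈-refl)
    f₃ : e ⊗ f₂ ⊕ κ (+ 2) ⊗ D f₂ ≈ E ⊗ (κ (- cube ρ) ⊗ (W ⊗ W) ⊝ κ (+ 64 · cube (ρ - 1ℤ)) ⊗ X)
    f₃ = begin
      e ⊗ f₂ ⊕ κ (+ 2) ⊗ D f₂
        ≈⟨ ⊕-cong ≈-refl (⊗-cong′ ≈-refl (≈-trans (D-⊕ _ _) (⊕-cong (D-⊗ e e) (D-κ⊗ (+ 2) (D e))))) ⟩
      e ⊗ (e ⊗ e ⊕ κ (+ 2) ⊗ D e) ⊕ κ (+ 2) ⊗ (D e ⊗ e ⊕ e ⊗ D e ⊕ κ (+ 2) ⊗ D (D e))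
        ≈⟨ ⊕-cong (⊗-cong′ ≈-refl (⊕-cong ≈-refl (⊗-cong′ ≈-refl D-e))) (⊗-cong′ ≈-refl (⊕-cong (⊕-cong (⊗-cong′ D-e ≈-refl) (⊗-cong′ ≈-refl D-e)) (≈-trans (⊗-cong′ ≈-refl (D-cong D-e)) D-d))) ⟩
      e ⊗ (e ⊗ e ⊕ κ (+ 2) ⊗ d) ⊕ κ (+ 2) ⊗ (d ⊗ e ⊕ e ⊗ d ⊕ _)
        -- The claim has become algebra in u, E, X and r. All powers of `u` cancel, and E² - 64X is
        -- left to be replaced by W².
        ≈⟨ solve 4 (λ u E X r →
             let e = conℤ (- + 2) :* u :- r :* E
                 d = con 16 :* X :- u :* u :- r :* (u :* E :+ con 32 :* X)
                 d′ = con 32 :* ((con 2 :* u :+ E) :* X) :- con 2 :* u :* (u :* u :- con 16 :* X) :- r :* ((u :* u :- con 16 :* X) :* E :+ con 2 :* u :* (u :* E :+ con 32 :* X) :+ con 64 :* ((con 2 :* u :+ E) :* X))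
             in e :* (e :* e :+ con 2 :* d) :+ con 2 :* (d :* e :+ e :* d :+ d′)
             := E :* ((:- (r :* r :* r)) :* (E :* E :- con 64 :* X) :- con 64 :* ((r :+ conℤ (- 1ℤ)) :* (r :+ conℤ (- 1ℤ)) :* (r :+ conℤ (- 1ℤ))) :* X)) ≈-refl u E X r ⟩
      E ⊗ (⊖ (r ⊗ r ⊗ r) ⊗ (E ⊗ E ⊝ κ (+ 64) ⊗ X) ⊝ κ (+ 64) ⊗ ((r ⊕ κ (- 1ℤ)) ⊗ (r ⊕ κ (- 1ℤ)) ⊗ (r ⊕ κ (- 1ℤ))) ⊗ X)
        ≈⟨ ⊗-cong′ ≈-refl (⊝-cong (⊗-cong′ (≈-trans (⊖-cong (≈-sym (κ-cube ρ))) (≈-sym (κ-neg _))) (≈-trans (⊝-cong E² ≈-refl) (solve 2 (λ w x → w :+ x :- x := w) ≈-refl _ _)))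
             (⊗-cong′ (≈-trans (⊗-cong′ ≈-refl (≈-trans (⊗-cong′ (⊗-cong′ (≈-sym (κ-+ ρ (- 1ℤ))) (≈-sym (κ-+ ρ (- 1ℤ)))) (≈-sym (κ-+ ρ (- 1ℤ)))) (≈-sym (κ-cube (ρ - 1ℤ))))) (≈-sym (κ-* (+ 64) (cube (ρ - 1ℤ))))) ≈-refl)) ⟩
      E ⊗ (κ (- cube ρ) ⊗ (W ⊗ W) ⊝ κ (+ 64 · cube (ρ - 1ℤ)) ⊗ X) ∎

  -- y j is q^(p/2) W⁻¹ T^(-j - 1/2): the half-integral powers of q are absorbed in the shift of Δ = 2D - p.
  ζ² : ℕ → PS
  ζ² j = (ζ ⊗ ζ) ↑ j

  y z R : ℕ → PS
  y j = Q (M ∸ j) ⊗ (W⁻¹ ⊗ (ζ ⊗ ζ² j))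
  z j = Q (M ∸ j) ⊗ (W ⊗ (ζ ⊗ ζ² j))
  R j = W ⊗ ζ² j

  odd# : ℕ → ℤ
  odd# j = + 2 · + j + 1ℤ

  LD-ζ² : ∀ j → LD (ζ² j) (κ (+ j) ⊗ (κ (- + 2) ⊗ η))
  LD-ζ² j = LD-↑ j (LD-cong (solve 1 (λ h → :- h :+ :- h := conℤ (- + 2) :* h) ≈-refl η) (LD-⊗ LD-ζ LD-ζ))

  Δ-y : ∀ j → j ℕ.≤ M → Δ (y j) ≈ (κ (- + 2) ⊗ u ⊝ κ (odd# j) ⊗ E) ⊗ y j
  Δ-y j j≤M = begin
    κ (+ 2) ⊗ D (y j) ⊝ κ p ⊗ y j
      ≈⟨ ⊝-cong (⊗-cong′ ≈-refl (LD-⊗ (LD-Q (M ∸ j)) (LD-⊗ LD-W⁻¹ (LD-⊗ LD-ζ (LD-ζ² j))))) (⊗-cong′ κ-p ≈-refl) ⟩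
    κ (+ 2) ⊗ ((k ⊕ (⊖ u ⊕ (⊖ η ⊕ κ (+ j) ⊗ (κ (- + 2) ⊗ η)))) ⊗ y j) ⊝ (κ (+ 2) ⊗ (k ⊕ κ (+ j)) ⊕ κ 1ℤ) ⊗ y j
      ≈⟨ solve 5 (λ k u h j y → con 2 :* ((k :+ (:- u :+ (:- h :+ j :* (conℤ (- + 2) :* h)))) :* y) :- (con 2 :* (k :+ j) :+ con 1) :* y
           := (conℤ (- + 2) :* u :- (con 2 :* j :+ con 1) :* (con 1 :+ con 2 :* h)) :* y) ≈-refl k u η (κ (+ j)) (y j) ⟩
    (κ (- + 2) ⊗ u ⊝ (κ (+ 2) ⊗ κ (+ j) ⊕ κ 1ℤ) ⊗ (κ 1ℤ ⊕ κ (+ 2) ⊗ η)) ⊗ y j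
      ≈⟨ ⊗-cong′ (⊝-cong ≈-refl (⊗-cong′ (≈-trans (⊕-cong (≈-sym (κ-* (+ 2) (+ j))) ≈-refl) (≈-sym (κ-+ (+ 2 · + j) 1ℤ))) E-η)) ≈-refl ⟩
    (κ (- + 2) ⊗ u ⊝ κ (odd# j) ⊗ E) ⊗ y j ∎
    where
    k : PS
    k = κ (+ (M ∸ j))
    κ-p : κ p ≈ κ (+ 2) ⊗ (k ⊕ κ (+ j)) ⊕ κ 1ℤ
    κ-p = ≈-trans (κ-+ (+ 2 · + M) 1ℤ) (⊕-cong (≈-trans (κ-* (+ 2) (+ M)) (⊗-cong′ ≈-refl (≈-trans (subst (λ t → κ (+ M) ≈ κ (+ t)) (sym (ℕP.m∸n+n≡m j≤M)) ≈-refl) (κ-+ (+ (M ∸ j)) (+ j))))) ≈-refl)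

  WW-y : ∀ j → W ⊗ W ⊗ y j ≈ z j
  WW-y j = ≈-trans (solve 4 (λ w q v t → w :* w :* (q :* (v :* t)) := q :* ((w :* v) :* w :* t)) ≈-refl W (Q (M ∸ j)) W⁻¹ (ζ ⊗ ζ² j))
    (≈-trans (⊗-cong′ ≈-refl (⊗-cong′ (⊗-cong′ WW⁻¹ ≈-refl) ≈-refl)) (⊗-cong′ ≈-refl (⊗-cong′ (⊗-identityˡ W) ≈-refl)))

  T-ζ² : ∀ j → T ⊗ ζ² (suc j) ≈ Q 1 ⊗ ζ² j
  T-ζ² j = ≈-trans (solve 4 (λ q s z t → q :* (s :* s) :* (z :* z :* t) := (s :* z) :* (s :* z) :* (q :* t)) ≈-refl (Q 1) σ ζ (ζ² j))
    (≈-trans (⊗-cong′ (⊗-cong′ σζ σζ) ≈-refl) (solve 1 (λ x → con 1 :* con 1 :* x := x) ≈-refl (Q 1 ⊗ ζ² j)))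

  -- X = W²T, and `T` shifts j by one; hence Δ³ of `y (suc j)` involves just two neighbouring `z`.
  X-y : ∀ j → j ℕ.< M → X ⊗ y (suc j) ≈ z j
  X-y j j<M = begin
    X ⊗ y (suc j)
      ≈⟨ ⊗-cong′ X-W ≈-refl ⟩
    W ⊗ W ⊗ T ⊗ (Q (M ∸ suc j) ⊗ (W⁻¹ ⊗ (ζ ⊗ ζ² (suc j))))
      ≈⟨ solve 6 (λ w t q v z x → w :* w :* t :* (q :* (v :* (z :* x))) := (w :* v) :* (q :* (w :* (z :* (t :* x))))) ≈-refl W T (Q (M ∸ suc j)) W⁻¹ ζ (ζ² (suc j)) ⟩
    W ⊗ W⁻¹ ⊗ (Q (M ∸ suc j) ⊗ (W ⊗ (ζ ⊗ (T ⊗ ζ² (suc j)))))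
      ≈⟨ ⊗-cong′ WW⁻¹ (⊗-cong′ ≈-refl (⊗-cong′ ≈-refl (⊗-cong′ ≈-refl (T-ζ² j)))) ⟩
    κ 1ℤ ⊗ (Q (M ∸ suc j) ⊗ (W ⊗ (ζ ⊗ (Q 1 ⊗ ζ² j))))
      ≈⟨ solve 5 (λ q w z o x → con 1 :* (q :* (w :* (z :* (o :* x)))) := o :* q :* (w :* (z :* x))) ≈-refl (Q (M ∸ suc j)) W ζ (Q 1) (ζ² j) ⟩
    Q 1 ⊗ Q (M ∸ suc j) ⊗ (W ⊗ (ζ ⊗ ζ² j))
      ≈⟨ ⊗-cong′ (≈-trans (≈-sym (Q-+ 1 (M ∸ suc j))) (Q-≡ (sym (ℕP.+-∸-assoc 1 j<M)))) ≈-refl ⟩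
    z j ∎

  -- For ρ = 1 the second term of Bol's identity has the factor (ρ - 1)³ = 0, so the chain of `z`
  -- starts at 0.
  Δ³-y₀ : Δ³ (y 0) ≈ κ (- 1ℤ) ⊗ (E ⊗ z 0)
  Δ³-y₀ = ≈-trans (Δ³-form 1ℤ (y 0) (Δ-y 0 z≤n)) (≈-trans (⊗-cong′ ≈-refl (⊝-cong (⊗-cong′ ≈-refl (WW-y 0)) ≈-refl))
    (solve 3 (λ e z x → e :* (conℤ (- 1ℤ) :* z :- con 0 :* x) := conℤ (- 1ℤ) :* (e :* z)) ≈-refl E (z 0) (X ⊗ y 0)))

  Δ³-y : ∀ j → j ℕ.< M → Δ³ (y (suc j)) ≈ E ⊗ (κ (- cube (odd# (suc j))) ⊗ z (suc j) ⊝ κ (+ 64 · cube (+ 2 · + suc j)) ⊗ z j)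
  Δ³-y j j<M = ≈-trans (Δ³-form (odd# (suc j)) (y (suc j)) (Δ-y (suc j) j<M))
    (⊗-cong′ ≈-refl (⊝-cong (⊗-cong′ ≈-refl (WW-y (suc j))) (⊗-cong′ (subst (λ t → κ (+ 64 · cube (odd# (suc j) - 1ℤ)) ≈ κ (+ 64 · cube t)) (ZS.solve 1 (λ x → x ⊹ # 1 ∸′ # 1 ⊜ x) refl (+ 2 · + suc j)) ≈-refl) (X-y j j<M))))

  -- The constant term of W T^(-j), because `R j` is qʲ W T^(-j).
  res : ℕ → ℤ
  res j = R j j

  res-0 : res 0 ≡ 1ℤ
  res-0 = ⊗-0 W-0 (κ-zero 1ℤ)

  -- The differential of E W⁻¹ T^(-j-1) is exact and has residue 0. By D(E W⁻¹) = 32WT and E² = W² +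
  -- 64X that residue is a combination of `res j` and `res (suc j)`. The recurrence is the one of
  -- (-64)ʲbⱼ.
  res-suc : ∀ j → j ℕ.< M → + suc j · res (suc j) ≡ - (+ 32 · odd# j) · res j
  res-suc j j<M = trans (ZS.solve 3 (λ j′ a b → j′ ⋆ a ⊜ # 32 ⋆ b ∸′ j′ ⋆ # 64 ⋆ b ∸′ (# 32 ⋆ b ∸′ j′ ⋆ (a ⊹ # 64 ⋆ b))) refl (+ suc j) (res (suc j)) (res j))
    (trans (cong (λ t → + 32 · res j - + suc j · + 64 · res j - t) (trans (sym right) (trans (sym (at main (suc j) j<M)) left)))
      (ZS.solve 2 (λ j b → # 32 ⋆ b ∸′ (# 1 ⊹ j) ⋆ # 64 ⋆ b ∸′ # 0 ⊜ (∸′ (# 32 ⋆ (# 2 ⋆ j ⊹ # 1))) ⋆ b) refl (+ j) (res j)))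
    where
    G : PS
    G = E ⊗ W⁻¹ ⊗ ζ² (suc j)
    D-G : D G ≈ κ (+ 32) ⊗ (Q 1 ⊗ R j) ⊝ κ (+ suc j) ⊗ (κ (+ 2) ⊗ η) ⊗ G
    D-G = begin
      D G
        ≈⟨ ≈-trans (D-⊗ _ _) (⊕-cong (⊗-cong′ (≈-trans (D-⊗ E W⁻¹) (⊕-cong (⊗-cong′ D-E ≈-refl) (⊗-cong′ ≈-refl LD-W⁻¹))) ≈-refl) (⊗-cong′ ≈-refl (LD-ζ² (suc j)))) ⟩
      ((u ⊗ E ⊕ κ (+ 32) ⊗ X) ⊗ W⁻¹ ⊕ E ⊗ (⊖ u ⊗ W⁻¹)) ⊗ ζ² (suc j) ⊕ E ⊗ W⁻¹ ⊗ (κ (+ suc j) ⊗ (κ (- + 2) ⊗ η) ⊗ ζ² (suc j))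
        ≈⟨ solve 7 (λ u e x v t k h → ((u :* e :+ con 32 :* x) :* v :+ e :* (:- u :* v)) :* t :+ e :* v :* (k :* (conℤ (- + 2) :* h) :* t)
             := con 32 :* (x :* v :* t) :- k :* (con 2 :* h) :* (e :* v :* t)) ≈-refl u E X W⁻¹ (ζ² (suc j)) (κ (+ suc j)) η ⟩
      κ (+ 32) ⊗ (X ⊗ W⁻¹ ⊗ ζ² (suc j)) ⊝ κ (+ suc j) ⊗ (κ (+ 2) ⊗ η) ⊗ G
        ≈⟨ ⊝-cong (⊗-cong′ ≈-refl X-step) ≈-refl ⟩
      κ (+ 32) ⊗ (Q 1 ⊗ R j) ⊝ κ (+ suc j) ⊗ (κ (+ 2) ⊗ η) ⊗ G ∎
      where
      X-step : X ⊗ W⁻¹ ⊗ ζ² (suc j) ≈ Q 1 ⊗ R j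
      X-step = ≈-trans (⊗-cong′ T-W ≈-refl) (≈-trans (⊗-assoc W T (ζ² (suc j))) (≈-trans (⊗-cong′ ≈-refl (T-ζ² j)) (solve 3 (λ w q t → w :* (q :* t) := q :* (w :* t)) ≈-refl W (Q 1) (ζ² j))))
    E-G : E ⊗ G ≈ R (suc j) ⊕ κ (+ 64) ⊗ (Q 1 ⊗ R j)
    E-G = begin
      E ⊗ (E ⊗ W⁻¹ ⊗ ζ² (suc j))
        ≈⟨ solve 3 (λ e v t → e :* (e :* v :* t) := e :* e :* v :* t) ≈-refl E W⁻¹ (ζ² (suc j)) ⟩
      E ⊗ E ⊗ W⁻¹ ⊗ ζ² (suc j)
        ≈⟨ ⊗-cong′ (⊗-cong′ E² ≈-refl) ≈-refl ⟩
      (W ⊗ W ⊕ κ (+ 64) ⊗ X) ⊗ W⁻¹ ⊗ ζ² (suc j)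
        ≈⟨ solve 4 (λ w x v t → (w :* w :+ con 64 :* x) :* v :* t := (w :* v) :* (w :* t) :+ con 64 :* (x :* v :* t)) ≈-refl W X W⁻¹ (ζ² (suc j)) ⟩
      W ⊗ W⁻¹ ⊗ (W ⊗ ζ² (suc j)) ⊕ κ (+ 64) ⊗ (X ⊗ W⁻¹ ⊗ ζ² (suc j))
        ≈⟨ ⊕-cong (≈-trans (⊗-cong′ WW⁻¹ ≈-refl) (⊗-identityˡ _)) (⊗-cong′ ≈-refl (≈-trans (⊗-cong′ T-W ≈-refl) (≈-trans (⊗-assoc W T (ζ² (suc j))) (≈-trans (⊗-cong′ ≈-refl (T-ζ² j)) (solve 3 (λ w q t → w :* (q :* t) := q :* (w :* t)) ≈-refl W (Q 1) (ζ² j)))))) ⟩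
      R (suc j) ⊕ κ (+ 64) ⊗ (Q 1 ⊗ R j) ∎
    main : D G ⊝ κ (+ suc j) ⊗ G ≈ κ (+ 32) ⊗ (Q 1 ⊗ R j) ⊝ κ (+ suc j) ⊗ (R (suc j) ⊕ κ (+ 64) ⊗ (Q 1 ⊗ R j))
    main = begin
      D G ⊝ κ (+ suc j) ⊗ G
        ≈⟨ ⊝-cong D-G ≈-refl ⟩
      κ (+ 32) ⊗ (Q 1 ⊗ R j) ⊝ κ (+ suc j) ⊗ (κ (+ 2) ⊗ η) ⊗ G ⊝ κ (+ suc j) ⊗ G
        ≈⟨ solve 4 (λ a k h g → a :- k :* (con 2 :* h) :* g :- k :* g := a :- k :* ((con 1 :+ con 2 :* h) :* g)) ≈-refl (κ (+ 32) ⊗ (Q 1 ⊗ R j)) (κ (+ suc j)) η G ⟩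
      κ (+ 32) ⊗ (Q 1 ⊗ R j) ⊝ κ (+ suc j) ⊗ ((κ 1ℤ ⊕ κ (+ 2) ⊗ η) ⊗ G)
        ≈⟨ ⊝-cong ≈-refl (⊗-cong′ ≈-refl (≈-trans (⊗-cong′ E-η ≈-refl) E-G)) ⟩
      κ (+ 32) ⊗ (Q 1 ⊗ R j) ⊝ κ (+ suc j) ⊗ (R (suc j) ⊕ κ (+ 64) ⊗ (Q 1 ⊗ R j)) ∎
    -- Up to the factor q^(j+1) this series is the derivative of q^(-j-1)G, which has no constant
    -- term.
    left : (D G ⊝ κ (+ suc j) ⊗ G) (suc j) ≡ 0ℤ
    left = trans (⊝-at _ _ (suc j)) (trans (cong₂ _-_ (D-at G (suc j)) (κ-⊗ (+ suc j) G (suc j))) (ℤP.+-inverseʳ (+ suc j · G (suc j))))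
    q-at : (Q 1 ⊗ R j) (suc j) ≡ res j
    q-at = Q-shift 1 (R j) j
    right : (κ (+ 32) ⊗ (Q 1 ⊗ R j) ⊝ κ (+ suc j) ⊗ (R (suc j) ⊕ κ (+ 64) ⊗ (Q 1 ⊗ R j))) (suc j) ≡ + 32 · res j - + suc j · (res (suc j) + + 64 · res j)
    right = trans (⊝-at _ _ (suc j)) (cong₂ _-_ (trans (κ-⊗ (+ 32) _ (suc j)) (cong (+ 32 ·_) q-at))
      (trans (κ-⊗ (+ suc j) _ (suc j)) (cong (+ suc j ·_) (trans (⊕-at (R (suc j)) _ (suc j)) (cong (λ t → res (suc j) + t) (trans (κ-⊗ (+ 64) _ (suc j)) (cong (+ 64 ·_) q-at)))))))

  h : PS
  h = e₁ ↑ 4 ⊗ e₂ ↑ 4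

  h-y : ∀ j → h ⊗ y j ≈ Q (M ∸ j) ⊗ R j
  h-y j = begin
    h ⊗ y j
      ≈⟨ solve 5 (λ h q v z t → h :* (q :* (v :* (z :* t))) := q :* ((h :* v :* z) :* t)) ≈-refl h (Q (M ∸ j)) W⁻¹ ζ (ζ² j) ⟩
    Q (M ∸ j) ⊗ ((h ⊗ W⁻¹ ⊗ ζ) ⊗ ζ² j)
      ≈⟨ ⊗-cong′ ≈-refl (⊗-cong′ hWζ ≈-refl) ⟩
    Q (M ∸ j) ⊗ (W ⊗ ζ² j) ∎
    where
    ↑-+ : ∀ f a b → f ↑ (a ℕ.+ b) ≈ f ↑ a ⊗ f ↑ b
    ↑-+ f zero    b = ≈-sym (⊗-identityˡ _)
    ↑-+ f (suc a) b = ≈-trans (⊗-cong′ ≈-refl (↑-+ f a b)) (≈-sym (⊗-assoc _ _ _))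
    hWζ : h ⊗ W⁻¹ ⊗ ζ ≈ W
    hWζ = begin
      (e₁ ↑ 4 ⊗ e₂ ↑ 4) ⊗ (i₁ ↑ 8 ⊗ e₂ ↑ 4) ⊗ (i₂ ↑ 12 ⊗ e₁ ↑ 12)
        ≈⟨ ⊗-cong′ ≈-refl (⊗-cong′ (≈-trans (↑-+ i₂ 4 8) (⊗-cong′ ≈-refl (↑-+ i₂ 4 4))) (↑-+ e₁ 8 4)) ⟩
      (e₁ ↑ 4 ⊗ e₂ ↑ 4) ⊗ (i₁ ↑ 8 ⊗ e₂ ↑ 4) ⊗ (i₂ ↑ 4 ⊗ (i₂ ↑ 4 ⊗ i₂ ↑ 4) ⊗ (e₁ ↑ 8 ⊗ e₁ ↑ 4))
        ≈⟨ solve 5 (λ a b c d x → (a :* b) :* (c :* b) :* (d :* (d :* d) :* (x :* a)) := (a :* a) :* (b :* d) :* (b :* d) :* (d :* (x :* c))) ≈-refl (e₁ ↑ 4) (e₂ ↑ 4) (i₁ ↑ 8) (i₂ ↑ 4) (e₁ ↑ 8) ⟩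
      (e₁ ↑ 4 ⊗ e₁ ↑ 4) ⊗ (e₂ ↑ 4 ⊗ i₂ ↑ 4) ⊗ (e₂ ↑ 4 ⊗ i₂ ↑ 4) ⊗ (i₂ ↑ 4 ⊗ (e₁ ↑ 8 ⊗ i₁ ↑ 8))
        ≈⟨ ⊗-cong′ (⊗-cong′ (⊗-cong′ (≈-sym (↑-+ e₁ 4 4)) (↑-inv 4 e₂i₂)) (↑-inv 4 e₂i₂)) (⊗-cong′ ≈-refl (↑-inv 8 e₁i₁)) ⟩
      e₁ ↑ 8 ⊗ κ 1ℤ ⊗ κ 1ℤ ⊗ (i₂ ↑ 4 ⊗ κ 1ℤ)
        ≈⟨ solve 2 (λ a b → a :* con 1 :* con 1 :* (b :* con 1) := a :* b) ≈-refl (e₁ ↑ 8) (i₂ ↑ 4) ⟩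
      W ∎

  -- `C-rec` says that the two contributions of each `z j`, from neighbouring terms of the
  -- combination, cancel. Any integral solution serves, so `C` stays a parameter.
  module _ (C : ℕ → ℤ) (C-rec : ∀ j → j ℕ.< M → - (+ 64 · cube (+ 2 · + suc j)) · C (suc j) ≡ cube (odd# j) · C j) where

    v : ℕ → PS
    v zero    = κ (C 0) ⊗ y 0
    v (suc J) = v J ⊕ κ (C (suc J)) ⊗ y (suc J)

    Δ³-⊕ : ∀ f g → Δ³ (f ⊕ g) ≈ Δ³ f ⊕ Δ³ g
    Δ³-⊕ f g = ≈-trans (Δ-cong (≈-trans (Δ-cong (Δ-⊕ f g)) (Δ-⊕ _ _))) (Δ-⊕ _ _)

    Δ³-κ⊗ : ∀ c f → Δ³ (κ c ⊗ f) ≈ κ c ⊗ Δ³ f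
    Δ³-κ⊗ c f = ≈-trans (Δ-cong (≈-trans (Δ-cong (Δ-κ⊗ c f)) (Δ-κ⊗ c _))) (Δ-κ⊗ c _)

    -- Telescoping: only the last `z` survives, and for J = M its coefficient contains (2M + 1)³ =
    -- p³.
    Δ³-v : ∀ J → J ℕ.≤ M → Δ³ (v J) ≈ κ (- (cube (odd# J) · C J)) ⊗ (E ⊗ z J)
    Δ³-v zero J≤M = ≈-trans (Δ³-κ⊗ (C 0) (y 0)) (≈-trans (⊗-cong′ ≈-refl Δ³-y₀) (≈-trans (≈-sym (⊗-assoc _ _ _)) (⊗-cong′ (≈-trans (≈-sym (κ-* (C 0) (- 1ℤ)))
      (subst (λ t → κ (C 0 · - 1ℤ) ≈ κ t) (ZS.solve 1 (λ c → c ⋆ ∸′ # 1 ⊜ ∸′ (# 1 ⋆ c)) refl (C 0)) ≈-refl)) ≈-refl)))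
    Δ³-v (suc J) J<M = begin
      Δ³ (v J ⊕ κ (C (suc J)) ⊗ y (suc J))
        ≈⟨ ≈-trans (Δ³-⊕ _ _) (⊕-cong (Δ³-v J (ℕP.<⇒≤ J<M)) (≈-trans (Δ³-κ⊗ (C (suc J)) (y (suc J))) (⊗-cong′ ≈-refl (Δ³-y J J<M)))) ⟩
      κ (- (cube (odd# J) · C J)) ⊗ (E ⊗ z J) ⊕ κ (C (suc J)) ⊗ (E ⊗ (κ (- cube (odd# (suc J))) ⊗ z (suc J) ⊝ κ (+ 64 · cube (+ 2 · + suc J)) ⊗ z J))
        ≈⟨ solve 7 (λ a e z c b z′ d → a :* (e :* z) :+ c :* (e :* (b :* z′ :- d :* z)) := (a :- d :* c) :* (e :* z) :+ (b :* c) :* (e :* z′)) ≈-refl (κ (- (cube (odd# J) · C J))) E (z J) (κ (C (suc J))) (κ (- cube (odd# (suc J)))) (z (suc J)) (κ (+ 64 · cube (+ 2 · + suc J))) ⟩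
      (κ (- (cube (odd# J) · C J)) ⊝ κ (+ 64 · cube (+ 2 · + suc J)) ⊗ κ (C (suc J))) ⊗ (E ⊗ z J) ⊕ (κ (- cube (odd# (suc J))) ⊗ κ (C (suc J))) ⊗ (E ⊗ z (suc J))
        ≈⟨ ⊕-cong (⊗-cong′ cancel ≈-refl) (⊗-cong′ (≈-trans (≈-sym (κ-* _ _)) (subst (λ t → κ (- cube (odd# (suc J)) · C (suc J)) ≈ κ t) (sym (ℤP.neg-distribˡ-* (cube (odd# (suc J))) (C (suc J)))) ≈-refl)) ≈-refl) ⟩
      κ 0ℤ ⊗ (E ⊗ z J) ⊕ κ (- (cube (odd# (suc J)) · C (suc J))) ⊗ (E ⊗ z (suc J))
        ≈⟨ solve 2 (λ a b → con 0 :* a :+ b := b) ≈-refl _ _ ⟩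
      κ (- (cube (odd# (suc J)) · C (suc J))) ⊗ (E ⊗ z (suc J)) ∎
      where
      d : ℤ
      d = + 64 · cube (+ 2 · + suc J)
      cancel : κ (- (cube (odd# J) · C J)) ⊝ κ d ⊗ κ (C (suc J)) ≈ κ 0ℤ
      cancel = ≈-trans (⊕-cong ≈-refl (≈-trans (⊖-cong (≈-sym (κ-* _ _))) (≈-sym (κ-neg _)))) (≈-trans (≈-sym (κ-+ _ _))
        (subst (λ t → κ (- (cube (odd# J) · C J) + - (d · C (suc J))) ≈ κ t) (trans (cong (λ t → - t + - (d · C (suc J))) (sym (C-rec J J<M)))
          (ZS.solve 2 (λ a b → (∸′ ((∸′ a) ⋆ b)) ⊹ (∸′ (a ⋆ b)) ⊜ # 0) refl d (C (suc J)))) ≈-refl))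

    Δ³-at : ∀ f n → Δ³ f n ≡ cube (+ 2 · + n - p) · f n
    Δ³-at f n = trans (Δ-at _ n) (trans (cong ((+ 2 · + n - p) ·_) (trans (Δ-at _ n) (cong ((+ 2 · + n - p) ·_) (Δ-at f n))))
      (ZS.solve 2 (λ a x → a ⋆ (a ⋆ (a ⋆ x)) ⊜ a ⋆ a ⋆ a ⋆ x) refl (+ 2 · + n - p) (f n)))

    v-coeff : ∀ n → n ℕ.≤ M → cube (+ 2 · + n - p) · v M n ≡ cube p · (- C M · (E ⊗ z M) n)
    v-coeff n n≤M = trans (sym (Δ³-at (v M) n)) (trans (at (Δ³-v M ℕP.≤-refl) n n≤M) (trans (κ-⊗ _ _ n)
      (ZS.solve 3 (λ c x y → (∸′ (c ⋆ x)) ⋆ y ⊜ c ⋆ ((∸′ x) ⋆ y)) refl (cube p) (C M) ((E ⊗ z M) n))))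

    y-0 : ∀ j → j ℕ.< M → y j 0 ≡ 0ℤ
    y-0 j j<M = trans (⊗-zero _ _) (trans (cong (_· rest 0) (Q-0′ (M ∸ j) (ℕP.m<n⇒0<n∸m j<M))) (ℤP.*-zeroˡ (rest 0)))
      where
      rest : PS
      rest = W⁻¹ ⊗ (ζ ⊗ ζ² j)
      Q-0′ : ∀ e → 0 ℕ.< e → Q e 0 ≡ 0ℤ
      Q-0′ (suc e) _ = Q-suc-zero e

    y-M : y M 0 ≡ 1ℤ
    y-M = ⊗-0 (trans (cong (λ e → Q e 0) (ℕP.n∸n≡0 M)) (trans (Q-zero 0) (κ-zero 1ℤ))) (⊗-0 W⁻¹-0 (⊗-0 ζ-0 (↑-0 M (⊗-0 ζ-0 ζ-0))))

    v-0< : ∀ J → J ℕ.< M → v J 0 ≡ 0ℤ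
    v-0< zero J<M = trans (κ-⊗ (C 0) (y 0) 0) (trans (cong (C 0 ·_) (y-0 0 J<M)) (ℤP.*-zeroʳ (C 0)))
    v-0< (suc J) J<M = trans (⊕-at _ _ 0) (trans (cong₂ _+_ (v-0< J (ℕP.<⇒≤ J<M)) (trans (κ-⊗ (C (suc J)) (y (suc J)) 0) (trans (cong (C (suc J) ·_) (y-0 (suc J) J<M)) (ℤP.*-zeroʳ (C (suc J)))))) refl)

    -- The series `y j` starts at q^(M-j), so the constant term comes from j = M alone.
    v-0 : v M 0 ≡ C M
    v-0 = go M refl
      where
      go : ∀ J → J ≡ M → v J 0 ≡ C J
      go zero    J≡M = trans (κ-⊗ (C 0) (y 0) 0) (trans (cong (C 0 ·_) (trans (cong (λ t → y t 0) J≡M) y-M)) (ℤP.*-identityʳ (C 0)))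
      go (suc J) J≡M = trans (⊕-at _ _ 0) (trans (cong₂ _+_ (v-0< J (ℕP.≤-reflexive J≡M)) (trans (κ-⊗ (C (suc J)) (y (suc J)) 0) (trans (cong (C (suc J) ·_) (trans (cong (λ t → y t 0) J≡M) y-M)) (ℤP.*-identityʳ (C (suc J)))))) (ℤP.+-identityˡ (C (suc J))))

    -- The factor q^(M-j) in `h-y` moves the coefficient at j of `R j` to the same place M for every
    -- j.
    h-v : ∀ J → J ℕ.≤ M → (h ⊗ v J) M ≡ sum₀ J (λ j → C j · res j)
    h-v J J≤M = term J J≤M
      where
      h-term : ∀ j → j ℕ.≤ M → (h ⊗ (κ (C j) ⊗ y j)) M ≡ C j · res j
      h-term j j≤M = trans (at (≈-trans (solve 3 (λ h c y → h :* (c :* y) := c :* (h :* y)) ≈-refl h (κ (C j)) (y j)) (⊗-cong′ ≈-refl (h-y j))) M ℕP.≤-refl)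
        (trans (κ-⊗ (C j) _ M) (cong (C j ·_) (trans (cong (Q (M ∸ j) ⊗ R j) (sym (ℕP.m∸n+n≡m j≤M))) (Q-shift (M ∸ j) (R j) j))))
      term : ∀ J → J ℕ.≤ M → (h ⊗ v J) M ≡ sum₀ J (λ j → C j · res j)
      term zero    J≤M = h-term 0 J≤M
      term (suc J) J≤M = trans (at (distribˡ h (v J) _) M ℕP.≤-refl) (trans (⊕-at _ _ M) (cong₂ _+_ (term J (ℕP.<⇒≤ J≤M)) (h-term (suc J) J≤M)))

-- The eta product of the statement

-- The where-functions of mulT and oneMinusQ cannot be named, so unification is made to recover them:
-- each mutual block solves the metavariable by an equation whose arguments have been abstracted to distinct variables.
mutual
  mulT-go : ℕ → Series → Series → ℕ → ℕ → Series
  mulT-go = _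

  mulT-suc : ∀ L f g → mulT (suc L) f g ≡ coeff f 0 · coeff g 0 ∷ mulT-go (suc L) f g L 1
  mulT-suc L f g with suc L | 1
  ... | _ | _ = refl

mutual
  mulT-conv : ℕ → Series → Series → ℕ → ℤ
  mulT-conv = _

  mulT-go-suc : ∀ L f g r i → mulT-go L f g (suc r) i ≡ mulT-conv L f g i ∷ mulT-go L f g r (suc i)
  mulT-go-suc L f g r i = refl

mutual
  mulT-plus : ℕ → Series → Series → ℕ → ℕ → ℤ → ℤ → ℤ
  mulT-plus = _

  mulT-conv-suc : ∀ L f g i → mulT-conv L f g (suc i) ≡ mulT-plus L f g (suc i) i (coeff f (suc i)) (coeff g (i ∸ i))
  mulT-conv-suc L f g i with suc i
  ... | w with coeff f w | coeff g (i ∸ i)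
  ... | _ | _ = refl

mutual
  omq-go : ℕ → ℕ → ℕ → ℕ → Series
  omq-go = _

  oneMinusQ-suc : ∀ L d → oneMinusQ (suc L) d ≡ omqCoeff d 0 ∷ omq-go (suc L) d L 1
  oneMinusQ-suc L d with suc L | 1
  ... | _ | _ = refl

coeff-from : (go : ℕ → ℕ → Series) (c : ℕ → ℤ) → (∀ i → go 0 i ≡ []) → (∀ r i → go (suc r) i ≡ c i ∷ go r (suc i)) →
  ∀ r i n → n ℕ.< r → coeff (go r i) n ≡ c (i ℕ.+ n)
coeff-from go c g₀ g₁ (suc r) i zero    _       rewrite g₁ r i = cong c (sym (ℕP.+-identityʳ i))
coeff-from go c g₀ g₁ (suc r) i (suc n) (s≤s p) rewrite g₁ r i = trans (coeff-from go c g₀ g₁ r (suc i) n p) (cong c (sym (ℕP.+-suc i n)))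

coeff-mulT-conv : ∀ L f g n → n ℕ.≤ L → coeff (mulT (suc L) f g) n ≡ mulT-conv (suc L) f g n
coeff-mulT-conv L f g zero    _   = cong (λ l → coeff l 0) (mulT-suc L f g)
coeff-mulT-conv L f g (suc n) n<L = trans (cong (λ l → coeff l (suc n)) (mulT-suc L f g))
  (coeff-from (mulT-go (suc L) f g) (mulT-conv (suc L) f g) (λ _ → refl) (λ _ _ → refl) L 1 n n<L)

-- The convolution as `mulT` accumulates it, from the first term on; `partial-head` splits it at the
-- other end to meet the recursion of `⊗`.
partial : (f g : PS) → ℕ → ℕ → ℤ
partial f g i zero    = f 0 · g i
partial f g i (suc j) = partial f g i j + f (suc j) · g (i ∸ suc j)

mulT-plus-partial : ∀ L f g i j x y → mulT-plus L f g i j x y ≡ partial (coeff f) (coeff g) i j + x · y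
mulT-plus-partial L f g i zero    x y = refl
mulT-plus-partial L f g i (suc j) x y = cong (λ t → t + x · y) (mulT-plus-partial L f g i j (coeff f (suc j)) (coeff g (i ∸ suc j)))

partial-head : ∀ f g i j → partial f g (suc i) (suc j) ≡ f 0 · g (suc i) + partial (tail f) g i j
partial-head f g i zero    = refl
partial-head f g i (suc j) = trans (cong (λ t → t + f (suc (suc j)) · g (i ∸ suc j)) (partial-head f g i j)) (ℤP.+-assoc (f 0 · g (suc i)) (partial (tail f) g i j) (f (suc (suc j)) · g (i ∸ suc j)))

partial-⊗ : ∀ f g i → partial f g i i ≡ (f ⊗ g) i
partial-⊗ f g zero    = sym (⊗-zero f g)
partial-⊗ f g (suc i) = trans (partial-head f g i i) (trans (cong (λ t → f 0 · g (suc i) + t) (partial-⊗ (tail f) g i)) (sym (⊗-suc f g i)))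

mulT-conv-⊗ : ∀ L f g i → mulT-conv L f g i ≡ (coeff f ⊗ coeff g) i
mulT-conv-⊗ L f g zero    = partial-⊗ (coeff f) (coeff g) 0
mulT-conv-⊗ L f g (suc i) = trans (mulT-conv-suc L f g i) (trans (mulT-plus-partial L f g (suc i) i (coeff f (suc i)) (coeff g (i ∸ i))) (partial-⊗ (coeff f) (coeff g) (suc i)))

coeff-mulT : ∀ L f g n → n ℕ.≤ L → coeff (mulT (suc L) f g) n ≡ (coeff f ⊗ coeff g) n
coeff-mulT L f g n n≤L = trans (coeff-mulT-conv L f g n n≤L) (mulT-conv-⊗ (suc L) f g n)

coeff-oneMinusQ : ∀ L d n → n ℕ.≤ L → coeff (oneMinusQ (suc L) d) n ≡ omqCoeff d n
coeff-oneMinusQ L d zero    _   = cong (λ l → coeff l 0) (oneMinusQ-suc L d)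
coeff-oneMinusQ L d (suc n) n<L = trans (cong (λ l → coeff l (suc n)) (oneMinusQ-suc L d))
  (coeff-from (omq-go (suc L) d) (omqCoeff d) (λ _ → refl) (λ _ _ → refl) L 1 n n<L)

Q-diag : ∀ d → Q d d ≡ 1ℤ
Q-diag zero    = trans (Q-zero 0) (κ-zero 1ℤ)
Q-diag (suc d) = trans (Q-suc-suc d d) (Q-diag d)

Q-off : ∀ d n → d ≢ n → Q d n ≡ 0ℤ
Q-off zero    zero    d≢n = ⊥-elim (d≢n refl)
Q-off zero    (suc n) d≢n = trans (Q-zero (suc n)) (κ-suc 1ℤ n)
Q-off (suc d) zero    d≢n = Q-suc-zero d
Q-off (suc d) (suc n) d≢n = trans (Q-suc-suc d n) (Q-off d n (λ e → d≢n (cong suc e)))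

omqCoeff-Q : ∀ d n → omqCoeff (suc d) n ≡ (κ 1ℤ ⊝ Q (suc d)) n
omqCoeff-Q d n = trans (lem n) (sym (trans (⊕-at (κ 1ℤ) (⊖ Q (suc d)) n) (cong (λ t → κ 1ℤ n + t) (⊖-at (Q (suc d)) n))))
  where
  lem : ∀ n → omqCoeff (suc d) n ≡ κ 1ℤ n - Q (suc d) n
  lem n with n ℕ.≟ 0 | suc d ℕ.≟ n
  ... | yes refl | no _     = sym (cong₂ _-_ (κ-zero 1ℤ) (Q-suc-zero d))
  ... | no _     | yes refl = sym (cong₂ _-_ (κ-suc 1ℤ d) (Q-diag (suc d)))
  lem zero    | no n≢0 | no _    = ⊥-elim (n≢0 refl)
  lem (suc n) | no _   | no d≢n = sym (cong₂ _-_ (κ-suc 1ℤ n) (Q-off (suc d) (suc n) d≢n))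

coeff-oneT : ∀ L n → coeff (oneT (suc L)) n ≡ κ 1ℤ n
coeff-oneT L zero    = sym (κ-zero 1ℤ)
coeff-oneT L (suc n) = trans (zeros L n) (sym (κ-suc 1ℤ n))
  where
  zeros : ∀ L n → coeff (replicate L 0ℤ) n ≡ 0ℤ
  zeros zero    n       = refl
  zeros (suc L) zero    = refl
  zeros (suc L) (suc n) = zeros L n

-- Lists of length K + 1 carry the coefficients up to q^K, which is the precision of `Truncated K`.
module Link (K : ℕ) where
  open Truncated K

  L : ℕ
  L = suc K

  mulT-≈ : ∀ f g → coeff (mulT L f g) ≈ coeff f ⊗ coeff g
  mulT-≈ f g = mk (coeff-mulT K f g)

  oneT-≈ : coeff (oneT L) ≈ κ 1ℤ
  oneT-≈ = mk λ n _ → coeff-oneT K n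

  oneMinusQ-≈ : ∀ d → coeff (oneMinusQ L (suc d)) ≈ κ 1ℤ ⊝ Q (suc d)
  oneMinusQ-≈ d = mk λ n n≤K → trans (coeff-oneMinusQ K (suc d) n n≤K) (omqCoeff-Q d n)

  powT-≈ : ∀ f n → coeff (powT L f n) ≈ coeff f ↑ n
  powT-≈ f zero    = oneT-≈
  powT-≈ f (suc n) = ≈-trans (mulT-≈ f _) (⊗-cong′ ≈-refl (powT-≈ f n))

  ↑-⊗ : ∀ f g n → (f ⊗ g) ↑ n ≈ f ↑ n ⊗ g ↑ n
  ↑-⊗ f g zero    = ≈-sym (⊗-identityˡ (κ 1ℤ))
  ↑-⊗ f g (suc n) = ≈-trans (⊗-cong′ ≈-refl (↑-⊗ f g n)) (solve 4 (λ f g x y → f :* g :* (x :* y) := f :* x :* (g :* y)) ≈-refl f g (f ↑ n) (g ↑ n))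

  V-↑ : ∀ f n → V (f ↑ n) ≈ V f ↑ n
  V-↑ f zero    = V-κ 1ℤ
  V-↑ f (suc n) = ≈-trans (V-⊗ _ _) (⊗-cong′ ≈-refl (V-↑ f n))

  V-factor : ∀ d → V (κ 1ℤ ⊝ Q d) ≈ κ 1ℤ ⊝ Q (d ℕ.+ d)
  V-factor d = ≈-trans (V-cong (solve 1 (λ q → con 1 :- q := con 1 :+ conℤ (- 1ℤ) :* q) ≈-refl (Q d)))
    (≈-trans (V-⊕ _ _) (≈-trans (⊕-cong (V-κ 1ℤ) (≈-trans (V-⊗ _ _) (⊗-cong′ (V-κ (- 1ℤ)) (V-Q d)))) (solve 1 (λ q → con 1 :+ conℤ (- 1ℤ) :* q := con 1 :- q) ≈-refl (Q (d ℕ.+ d)))))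

  -- The factors 1 - q^(2n) and 1 - q^(4n) are the images of 1 - qⁿ under one and two applications
  -- of `V`.
  etaProd-≈ : ∀ n → coeff (etaProd L n) ≈ V (euler n) ↑ 4 ⊗ V (V (euler n)) ↑ 4
  etaProd-≈ zero = ≈-trans oneT-≈ (≈-sym (≈-trans (⊗-cong′ (ones (V-κ 1ℤ)) (ones (≈-trans (V-cong (V-κ 1ℤ)) (V-κ 1ℤ)))) (⊗-identityˡ _)))
    where
    ones : ∀ {f} → f ≈ κ 1ℤ → f ↑ 4 ≈ κ 1ℤ
    ones p = ≈-trans (↑-cong 4 p) (solve 0 (con 1 :* (con 1 :* (con 1 :* (con 1 :* con 1))) := con 1) ≈-refl)
  etaProd-≈ (suc n) = begin
    coeff (etaProd L (suc n))
      ≈⟨ ≈-trans (mulT-≈ (etaProd L n) _) (⊗-cong′ (etaProd-≈ n) (≈-trans (mulT-≈ (powT L (oneMinusQ L (2 ℕ.* suc n)) 4) _) (⊗-cong′ (≈-trans (powT-≈ _ 4) (↑-cong 4 factor₁)) (≈-trans (powT-≈ _ 4) (↑-cong 4 factor₂))))) ⟩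
    V (euler n) ↑ 4 ⊗ V (V (euler n)) ↑ 4 ⊗ (V g ↑ 4 ⊗ V (V g) ↑ 4)
      ≈⟨ solve 4 (λ a b c d → a :* b :* (c :* d) := a :* c :* (b :* d)) ≈-refl (V (euler n) ↑ 4) (V (V (euler n)) ↑ 4) (V g ↑ 4) (V (V g) ↑ 4) ⟩
    (V (euler n) ↑ 4 ⊗ V g ↑ 4) ⊗ (V (V (euler n)) ↑ 4 ⊗ V (V g) ↑ 4)
      ≈⟨ ⊗-cong′ (≈-trans (↑-cong 4 (V-⊗ (euler n) g)) (↑-⊗ (V (euler n)) (V g) 4)) (≈-trans (↑-cong 4 (≈-trans (V-cong (V-⊗ (euler n) g)) (V-⊗ (V (euler n)) (V g)))) (↑-⊗ (V (V (euler n))) (V (V g)) 4)) ⟨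
    V (euler (suc n)) ↑ 4 ⊗ V (V (euler (suc n))) ↑ 4 ∎
    where
    open ≈R
    g : PS
    g = κ 1ℤ ⊝ Q (suc n)
    two : 2 ℕ.* suc n ≡ suc n ℕ.+ suc n
    two = cong (λ t → suc n ℕ.+ t) (ℕP.+-identityʳ (suc n))
    four : 4 ℕ.* suc n ≡ (suc n ℕ.+ suc n) ℕ.+ (suc n ℕ.+ suc n)
    four = trans (ℕP.*-distribʳ-+ (suc n) 2 2) (cong₂ ℕ._+_ two two)
    factor₁ : coeff (oneMinusQ L (2 ℕ.* suc n)) ≈ V g
    factor₁ = ≈-trans (oneMinusQ-≈ _) (≈-trans (⊕-cong ≈-refl (⊖-cong (Q-≡ two))) (≈-sym (V-factor (suc n))))
    factor₂ : coeff (oneMinusQ L (4 ℕ.* suc n)) ≈ V (V g)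
    factor₂ = ≈-trans (oneMinusQ-≈ _) (≈-trans (⊕-cong ≈-refl (⊖-cong (Q-≡ four))) (≈-sym (≈-trans (V-cong (V-factor (suc n))) (V-factor (suc n ℕ.+ suc n)))))

module _ (M : ℕ) where
  private
    module L = Link (M ℕ.+ M)
    module T₂ = Truncated (M ℕ.+ M)

  open Truncated M

  euler-stable : ∀ k → euler (k ℕ.+ M) ≈ euler M
  euler-stable zero    = ≈-refl
  euler-stable (suc k) = ≈-trans (⊗-cong′ (euler-stable k) (⊕-cong ≈-refl (⊖-cong (Q-vanish (suc k ℕ.+ M) (s≤s (ℕP.m≤n+m M k))))))
    (solve 1 (λ x → x :* (con 1 :- con 0) := x) ≈-refl (euler M))

  -- The statement multiplies 2M + 1 factors to precision q^(2M). The product is a series in q², so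
  -- its coefficient at 2M is the one at M after q² ↦ q, where `M` factors are enough.
  a-coeff : a (suc (M ℕ.+ M)) ≡ h M
  a-coeff = trans (T₂.at (T₂.≈-trans (L.etaProd-≈ n) (T₂.≈-sym (T₂.≈-trans (T₂.V-⊗ _ _) (T₂.⊗-cong′ (L.V-↑ (euler n) 4) (L.V-↑ (V (euler n)) 4))))) (M ℕ.+ M) ℕP.≤-refl)
    (trans (V-double (euler n ↑ 4 ⊗ V (euler n) ↑ 4) M) (at (⊗-cong′ (↑-cong 4 (euler-stable (suc M))) (↑-cong 4 (V-cong (euler-stable (suc M))))) M ℕP.≤-refl))
    where
    n : ℕ
    n = suc (M ℕ.+ M)

-- Congruences and rational numbers

infix 4 _≡_⟪_⟫
record _≡_⟪_⟫ (a b P : ℤ) : Set where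
  constructor cong-by
  field
    quotient : ℤ
    equation : a ≡ b + quotient · P

module _ {P : ℤ} where
  ≋-reflexive : ∀ {a b} → a ≡ b → a ≡ b ⟪ P ⟫
  ≋-reflexive {a} refl = cong-by 0ℤ (ZS.solve 2 (λ a P → a ⊜ a ⊹ # 0 ⋆ P) refl a P)

  ≋-refl : ∀ {a} → a ≡ a ⟪ P ⟫
  ≋-refl = ≋-reflexive refl

  ≋-sym : ∀ {a b} → a ≡ b ⟪ P ⟫ → b ≡ a ⟪ P ⟫
  ≋-sym {a} {b} (cong-by k refl) = cong-by (- k) (ZS.solve 3 (λ b k P → b ⊜ b ⊹ k ⋆ P ⊹ (∸′ k) ⋆ P) refl b k P)

  ≋-trans : ∀ {a b c} → a ≡ b ⟪ P ⟫ → b ≡ c ⟪ P ⟫ → a ≡ c ⟪ P ⟫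
  ≋-trans {c = c} (cong-by k refl) (cong-by l refl) = cong-by (l + k) (ZS.solve 4 (λ c k l P → c ⊹ l ⋆ P ⊹ k ⋆ P ⊜ c ⊹ (l ⊹ k) ⋆ P) refl c k l P)

  ≋-+ : ∀ {a b c d} → a ≡ b ⟪ P ⟫ → c ≡ d ⟪ P ⟫ → a + c ≡ b + d ⟪ P ⟫
  ≋-+ {b = b} {d = d} (cong-by k refl) (cong-by l refl) = cong-by (k + l) (ZS.solve 5 (λ b d k l P → b ⊹ k ⋆ P ⊹ (d ⊹ l ⋆ P) ⊜ b ⊹ d ⊹ (k ⊹ l) ⋆ P) refl b d k l P)

  ≋-* : ∀ {a b c d} → a ≡ b ⟪ P ⟫ → c ≡ d ⟪ P ⟫ → a · c ≡ b · d ⟪ P ⟫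
  ≋-* {b = b} {d = d} (cong-by k refl) (cong-by l refl) = cong-by (k · d + b · l + k · P · l)
    (ZS.solve 5 (λ b d k l P → (b ⊹ k ⋆ P) ⋆ (d ⊹ l ⋆ P) ⊜ b ⋆ d ⊹ (k ⋆ d ⊹ b ⋆ l ⊹ k ⋆ P ⋆ l) ⋆ P) refl b d k l P)

  ≋-neg : ∀ {a b} → a ≡ b ⟪ P ⟫ → - a ≡ - b ⟪ P ⟫
  ≋-neg {b = b} (cong-by k refl) = cong-by (- k) (ZS.solve 3 (λ b k P → ∸′ (b ⊹ k ⋆ P) ⊜ (∸′ b) ⊹ (∸′ k) ⋆ P) refl b k P)

  ≋-*ˡ : ∀ c {a b} → a ≡ b ⟪ P ⟫ → c · a ≡ c · b ⟪ P ⟫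
  ≋-*ˡ c p = ≋-* {a = c} {c} ≋-refl p

  ≋-*ʳ : ∀ c {a b} → a ≡ b ⟪ P ⟫ → a · c ≡ b · c ⟪ P ⟫
  ≋-*ʳ c p = ≋-* {c = c} {c} p ≋-refl

  ≋-+ˡ : ∀ c {a b} → a ≡ b ⟪ P ⟫ → c + a ≡ c + b ⟪ P ⟫
  ≋-+ˡ c p = ≋-+ {a = c} {c} ≋-refl p

  ≋-+ʳ : ∀ c {a b} → a ≡ b ⟪ P ⟫ → a + c ≡ b + c ⟪ P ⟫
  ≋-+ʳ c p = ≋-+ {c = c} {c} p ≋-refl

modSetoid : ℤ → Setoid 0ℓ 0ℓ
modSetoid P = record { Carrier = ℤ ; _≈_ = λ a b → a ≡ b ⟪ P ⟫ ; isEquivalence = record { refl = ≋-refl ; sym = ≋-sym ; trans = ≋-trans } }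

module ≋R (P : ℤ) = SetoidR (modSetoid P)

≋-reduce : ∀ {P a b} Q → a ≡ b ⟪ P · Q ⟫ → a ≡ b ⟪ P ⟫
≋-reduce {P} {a} {b} Q (cong-by k refl) = cong-by (k · Q) (ZS.solve 4 (λ b k P Q → b ⊹ k ⋆ (P ⋆ Q) ⊜ b ⊹ k ⋆ Q ⋆ P) refl b k P Q)

≋-scale : ∀ {P a b} Q → a ≡ b ⟪ P ⟫ → Q · a ≡ Q · b ⟪ P · Q ⟫
≋-scale {P} {a} {b} Q (cong-by k refl) = cong-by k (ZS.solve 4 (λ b k P Q → Q ⋆ (b ⊹ k ⋆ P) ⊜ Q ⋆ b ⊹ k ⋆ (P ⋆ Q)) refl b k P Q)

record Unit (P z : ℤ) : Set where
  constructor unit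
  field
    inverse   : ℤ
    isInverse : z · inverse ≡ 1ℤ ⟪ P ⟫

open Unit public

module _ {P : ℤ} where
  unit-1 : Unit P 1ℤ
  unit-1 = unit 1ℤ ≋-refl

  unit-* : ∀ {y z} → Unit P y → Unit P z → Unit P (y · z)
  unit-* {y} {z} (unit v p) (unit w q) = unit (v · w) (≋-trans (≋-reflexive (ZS.solve 4 (λ y z v w → y ⋆ z ⋆ (v ⋆ w) ⊜ (y ⋆ v) ⋆ (z ⋆ w)) refl y z v w)) (≋-* p q))

  unit-≋ : ∀ {y z} → y ≡ z ⟪ P ⟫ → Unit P z → Unit P y
  unit-≋ p (unit w q) = unit w (≋-trans (≋-*ʳ w p) q)

  unit-neg : ∀ {z} → Unit P z → Unit P (- z)
  unit-neg {z} (unit w q) = unit (- w) (≋-trans (≋-reflexive (ZS.solve 2 (λ z w → (∸′ z) ⋆ (∸′ w) ⊜ z ⋆ w) refl z w)) q)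

  unit-cancel : ∀ {z x y} → Unit P z → z · x ≡ z · y ⟪ P ⟫ → x ≡ y ⟪ P ⟫
  unit-cancel {z} {x} {y} (unit w q) p = begin
    x                ≈⟨ ≋-reflexive (sym (ℤP.*-identityˡ x)) ⟩
    1ℤ · x           ≈⟨ ≋-*ʳ x (≋-sym q) ⟩
    z · w · x        ≈⟨ ≋-reflexive (ZS.solve 3 (λ z w x → z ⋆ w ⋆ x ⊜ w ⋆ (z ⋆ x)) refl z w x) ⟩
    w · (z · x)      ≈⟨ ≋-*ˡ w p ⟩
    w · (z · y)      ≈⟨ ≋-reflexive (ZS.solve 3 (λ z w x → w ⋆ (z ⋆ x) ⊜ z ⋆ w ⋆ x) refl z w y) ⟩
    z · w · y        ≈⟨ ≋-*ʳ y q ⟩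
    1ℤ · y           ≈⟨ ≋-reflexive (ℤP.*-identityˡ y) ⟩
    y ∎
    where open ≋R P

-- 1 - z(v + w - zvw) = (1 - zv)(1 - zw)
unit-lift : ∀ {P Q z} → Unit P z → Unit Q z → Unit (P · Q) z
unit-lift {P} {Q} {z} (unit v (cong-by k p)) (unit w (cong-by l q)) = unit (v + w - z · v · w) (cong-by (- (k · l))
  (trans (ZS.solve 3 (λ z v w → z ⋆ (v ⊹ w ∸′ z ⋆ v ⋆ w) ⊜ # 1 ∸′ (z ⋆ v ∸′ # 1) ⋆ (z ⋆ w ∸′ # 1)) refl z v w)
    (trans (cong₂ (λ x y → 1ℤ - (x - 1ℤ) · (y - 1ℤ)) p q)
      (ZS.solve 4 (λ k l P Q → # 1 ∸′ (# 1 ⊹ k ⋆ P ∸′ # 1) ⋆ (# 1 ⊹ l ⋆ Q ∸′ # 1) ⊜ # 1 ⊹ (∸′ (k ⋆ l)) ⋆ (P ⋆ Q)) refl k l P Q))))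

unit-reduce : ∀ {P z} Q → Unit (P · Q) z → Unit P z
unit-reduce Q (unit w q) = unit w (≋-reduce Q q)

unit-coprime : ∀ {p n} → Coprime p n → Unit (+ p) (+ n)
unit-coprime {p} {n} c with coprime-Bézout c
... | Bézout.+- x y eq = unit (- (+ y)) (cong-by (- (+ x)) (trans (ZS.solve 2 (λ n y → n ⋆ (∸′ y) ⊜ # 1 ∸′ (# 1 ⊹ y ⋆ n)) refl (+ n) (+ y))
    (trans (cong (λ t → 1ℤ - t) eq′) (ZS.solve 2 (λ p x → # 1 ∸′ x ⋆ p ⊜ # 1 ⊹ (∸′ x) ⋆ p) refl (+ p) (+ x)))))
  where
  eq′ : 1ℤ + + y · + n ≡ + x · + p
  eq′ = trans (cong (λ t → 1ℤ + t) (sym (ℤP.pos-* y n))) (trans (cong +_ eq) (ℤP.pos-* x p))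
... | Bézout.-+ x y eq = unit (+ y) (cong-by (+ x) (trans (ℤP.*-comm (+ n) (+ y)) (trans (sym (ℤP.pos-* y n)) (trans (cong +_ (sym eq)) (cong (λ t → 1ℤ + t) (ℤP.pos-* x p))))))

unit-<prime : ∀ {p} → Prime p → ∀ n → 0 ℕ.< n → n ℕ.< p → Unit (+ p) (+ n)
unit-<prime pp (suc n) _ n<p = unit-coprime (prime⇒coprime pp n<p)

-- x ≡ z modulo P in the localisation of ℤ at the units modulo P
record Repᵘ (P : ℤ) (x : ℚᵘ) (z : ℤ) : Set where
  constructor rep
  field
    den quo : ℤ
    den-unit : Unit P den
    equation : ℚᵘ.↥ x · den ≡ (z · den + quo · P) · ℚᵘ.↧ x

Rep : ℤ → ℚ → ℤ → Set
Rep P x z = Repᵘ P (toℚᵘ x) z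

module _ {P : ℤ} where
  rep-≃ : ∀ {x y z} → x ℚᵘ.≃ y → Repᵘ P y z → Repᵘ P x z
  rep-≃ {x@record{}} {y@record{}} {z} (*≡* e) (rep d k U eq) = rep d k U (ℤP.*-cancelʳ-≡ _ _ (ℚᵘ.↧ y)
    (trans (ZS.solve 3 (λ a b c → a ⋆ b ⋆ c ⊜ a ⋆ c ⋆ b) refl (ℚᵘ.↥ x) d (ℚᵘ.↧ y))
      (trans (cong (_· d) e) (trans (ZS.solve 3 (λ a b c → a ⋆ b ⋆ c ⊜ a ⋆ c ⋆ b) refl (ℚᵘ.↥ y) (ℚᵘ.↧ x) d)
        (trans (cong (_· ℚᵘ.↧ x) eq) (ZS.solve 3 (λ a b c → a ⋆ b ⋆ c ⊜ a ⋆ c ⋆ b) refl (z · d + k · P) (ℚᵘ.↧ y) (ℚᵘ.↧ x)))))))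

  repᵘ-+ : ∀ {x y a b} → Repᵘ P x a → Repᵘ P y b → Repᵘ P (x ℚᵘ.+ y) (a + b)
  repᵘ-+ {x@(mkℚᵘ _ _)} {y@(mkℚᵘ _ _)} {a} {b} (rep d k U e) (rep d′ k′ U′ e′) = rep (d · d′) (k · d′ + k′ · d) (unit-* U U′)
    (trans (ZS.solve 6 (λ x x′ y y′ d d′ → (x ⋆ y′ ⊹ y ⋆ x′) ⋆ (d ⋆ d′) ⊜ (x ⋆ d) ⋆ (y′ ⋆ d′) ⊹ (y ⋆ d′) ⋆ (x′ ⋆ d)) refl (ℚᵘ.↥ x) (ℚᵘ.↧ x) (ℚᵘ.↥ y) (ℚᵘ.↧ y) d d′)
      (trans (cong₂ (λ s t → s · (ℚᵘ.↧ y · d′) + t · (ℚᵘ.↧ x · d)) e e′)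
        (ZS.solve 9 (λ a b d d′ k k′ P x y → (a ⋆ d ⊹ k ⋆ P) ⋆ x ⋆ (y ⋆ d′) ⊹ (b ⋆ d′ ⊹ k′ ⋆ P) ⋆ y ⋆ (x ⋆ d) ⊜ ((a ⊹ b) ⋆ (d ⋆ d′) ⊹ (k ⋆ d′ ⊹ k′ ⋆ d) ⋆ P) ⋆ (x ⋆ y)) refl a b d d′ k k′ P (ℚᵘ.↧ x) (ℚᵘ.↧ y))))

  repᵘ-* : ∀ {x y a b} → Repᵘ P x a → Repᵘ P y b → Repᵘ P (x ℚᵘ.* y) (a · b)
  repᵘ-* {x@(mkℚᵘ _ _)} {y@(mkℚᵘ _ _)} {a} {b} (rep d k U e) (rep d′ k′ U′ e′) = rep (d · d′) (a · d · k′ + k · (b · d′) + k · k′ · P) (unit-* U U′)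
    (trans (ZS.solve 4 (λ x y d d′ → (x ⋆ y) ⋆ (d ⋆ d′) ⊜ (x ⋆ d) ⋆ (y ⋆ d′)) refl (ℚᵘ.↥ x) (ℚᵘ.↥ y) d d′)
      (trans (cong₂ _·_ e e′)
        (ZS.solve 9 (λ a b d d′ k k′ P x y → (a ⋆ d ⊹ k ⋆ P) ⋆ x ⋆ ((b ⋆ d′ ⊹ k′ ⋆ P) ⋆ y) ⊜ ((a ⋆ b) ⋆ (d ⋆ d′) ⊹ (a ⋆ d ⋆ k′ ⊹ k ⋆ (b ⋆ d′) ⊹ k ⋆ k′ ⋆ P) ⋆ P) ⋆ (x ⋆ y)) refl a b d d′ k k′ P (ℚᵘ.↧ x) (ℚᵘ.↧ y))))

  repᵘ-neg : ∀ {x a} → Repᵘ P x a → Repᵘ P (ℚᵘ.- x) (- a)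
  repᵘ-neg {x@(mkℚᵘ n _)} {a} (rep d k U e) = rep d (- k) U (trans (sym (ℤP.neg-distribˡ-* n d)) (trans (cong -_ e)
    (ZS.solve 5 (λ a d k P x → ∸′ ((a ⋆ d ⊹ k ⋆ P) ⋆ x) ⊜ ((∸′ a) ⋆ d ⊹ (∸′ k) ⋆ P) ⋆ x) refl a d k P (ℚᵘ.↧ x))))

  rep-+ : ∀ {x y a b} → Rep P x a → Rep P y b → Rep P (x ℚ.+ y) (a + b)
  rep-+ {x} {y} p q = rep-≃ (ℚP.toℚᵘ-homo-+ x y) (repᵘ-+ p q)

  rep-* : ∀ {x y a b} → Rep P x a → Rep P y b → Rep P (x ℚ.* y) (a · b)
  rep-* {x} {y} p q = rep-≃ (ℚP.toℚᵘ-homo-* x y) (repᵘ-* p q)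

  rep-minus : ∀ {x y a b} → Rep P x a → Rep P y b → Rep P (x ℚ.- y) (a - b)
  rep-minus {x} {y} p q = rep-+ {x} {ℚ.- y} p (rep-≃ (ℚP.toℚᵘ-homo‿- y) (repᵘ-neg q))

  rep-≋ : ∀ {x a b} → a ≡ b ⟪ P ⟫ → Repᵘ P x a → Repᵘ P x b
  rep-≋ {x} {a} {b} (cong-by l refl) (rep d k U e) = rep d (l · d + k) U (trans e (cong (_· ℚᵘ.↧ x)
    (ZS.solve 5 (λ b l P d k → (b ⊹ l ⋆ P) ⋆ d ⊹ k ⋆ P ⊜ b ⋆ d ⊹ (l ⋆ d ⊹ k) ⋆ P) refl b l P d k)))

  rep-/ : ∀ n d .{{_ : ℕ.NonZero d}} z → Unit P (+ d) → z · + d ≡ n ⟪ P ⟫ → Rep P (n ℚ./ d) z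
  rep-/ n (suc d) z U (cong-by k e) = rep-≃ (ℚP.toℚᵘ-fromℚᵘ (mkℚᵘ n d)) (rep (+ suc d) (- k) U
    (cong (_· + suc d) (trans (ZS.solve 3 (λ n k P → n ⊜ n ⊹ k ⋆ P ⊹ (∸′ k) ⋆ P) refl n k P) (cong (λ t → t + - k · P) (sym e)))))

  rep-int : ∀ n → Rep P (n ℚ./ 1) n
  rep-int n = rep-/ n 1 n unit-1 (≋-reflexive (ℤP.*-identityʳ n))

  rep-pow : ∀ {x a} → Rep P x a → ∀ n → Rep P (powℚ x n) (a ℤ.^ n)
  rep-pow         p zero    = rep-int 1ℤ
  rep-pow {x} {a} p (suc n) = rep-* {x} {powℚ x n} p (rep-pow p n)

prime^4 : ∀ p → + (p ℕ.^ 4) ≡ + p · + p · + p · + p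
prime^4 p = trans (ℤP.pos-* p (p ℕ.* (p ℕ.* (p ℕ.* 1)))) (trans (cong (+ p ·_) (trans (ℤP.pos-* p (p ℕ.* (p ℕ.* 1))) (cong (+ p ·_) (trans (ℤP.pos-* p (p ℕ.* 1)) (cong (+ p ·_) (cong +_ (ℕP.*-identityʳ p)))))))
  (ZS.solve 1 (λ p → p ⋆ (p ⋆ (p ⋆ p)) ⊜ p ⋆ p ⋆ p ⋆ p) refl (+ p)))

-- As `den` is a unit, p⁴ divides the numerator. Then p divides it too, and lowest terms make the
-- denominator prime to p.
rep-0 : ∀ {p} → Prime p → ∀ x → Rep (+ p · + p · + p · + p) x 0ℤ → Coprime p (ℚ.↧ₙ x) × (+ (p ℕ.^ 4)) ℤD.∣ (ℚ.↥ x)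
rep-0 {p} pp (mkℚ n d-1 c) (rep d k (unit w (cong-by l U)) e) = cop , subst (λ t → ℤ.∣ t ∣ ℕD.∣ ℤ.∣ n ∣) (sym (prime^4 p)) (ℕD.divides ℤ.∣ q ∣ (trans (cong ℤ.∣_∣ n≡) (ℤP.abs-* q P)))
  where
  P : ℤ
  P = + p · + p · + p · + p
  D′ : ℤ
  D′ = + suc d-1
  q : ℤ
  q = k · D′ · w - l · n
  n≡ : n ≡ q · P
  n≡ = trans (ZS.solve 3 (λ n l P → n ⊜ n ⋆ (# 1 ⊹ l ⋆ P) ∸′ l ⋆ n ⋆ P) refl n l P)
    (trans (cong (λ t → n · t - l · n · P) (sym U))
    (trans (ZS.solve 5 (λ n d w l P → n ⋆ (d ⋆ w) ∸′ l ⋆ n ⋆ P ⊜ (n ⋆ d) ⋆ w ∸′ l ⋆ n ⋆ P) refl n d w l P)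
    (trans (cong (λ t → t · w - l · n · P) e)
      (ZS.solve 7 (λ d k P D w l n → (# 0 ⋆ d ⊹ k ⋆ P) ⋆ D ⋆ w ∸′ l ⋆ n ⋆ P ⊜ (k ⋆ D ⋆ w ∸′ l ⋆ n) ⋆ P) refl d k P D′ w l n))))
  p∣n : p ℕD.∣ ℤ.∣ n ∣
  p∣n = ℕD.divides ℤ.∣ q · (+ p · + p · + p) ∣ (trans (cong ℤ.∣_∣ (trans n≡ (ZS.solve 2 (λ q p → q ⋆ (p ⋆ p ⋆ p ⋆ p) ⊜ q ⋆ (p ⋆ p ⋆ p) ⋆ p) refl q (+ p)))) (ℤP.abs-* (q · (+ p · + p · + p)) (+ p)))
  -- The coprimality stored in a rational is irrelevant and has to be recomputed by its decision
  -- procedure.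
  c′ : Coprime ℤ.∣ n ∣ (suc d-1)
  c′ = recompute (coprime? ℤ.∣ n ∣ (suc d-1)) c
  cop : Coprime p (suc d-1)
  cop {i} (i∣p , i∣d) with prime⇒irreducible pp i∣p
  ... | inj₁ i≡1 = i≡1
  ... | inj₂ refl = c′ (p∣n , i∣d)

≡-modℚ : ∀ {p} → Prime p → ∀ {x y a b} → Rep (+ p · + p · + p · + p) x a → Rep (+ p · + p · + p · + p) y b →
  a ≡ b ⟪ + p · + p · + p · + p ⟫ → x ≡ y [modℚ p ^ 4 ]
≡-modℚ {p} pp {x} {y} {a} {b} A B (cong-by k e) = rep-0 pp (x ℚ.- y) (rep-≋ (cong-by k (trans (cong (_- b) e) (ZS.solve 3 (λ b k P → b ⊹ k ⋆ P ∸′ b ⊜ # 0 ⊹ k ⋆ P) refl b k (+ p · + p · + p · + p)))) (rep-minus {x = x} {y} A B))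

-- Finite products and sums of integers, first-order recurrences

prod : ℕ → (ℕ → ℤ) → ℤ
prod zero    f = 1ℤ
prod (suc n) f = prod n f · f n

prod-cong : ∀ n {f g} → (∀ i → i ℕ.< n → f i ≡ g i) → prod n f ≡ prod n g
prod-cong zero    p = refl
prod-cong (suc n) p = cong₂ _·_ (prod-cong n (λ i q → p i (ℕP.m≤n⇒m≤1+n q))) (p n ℕP.≤-refl)

prod-head : ∀ n f → prod (suc n) f ≡ f 0 · prod n (λ i → f (suc i))
prod-head zero    f = ℤP.*-comm 1ℤ (f 0)
prod-head (suc n) f = trans (cong (_· f (suc n)) (prod-head n f)) (ℤP.*-assoc (f 0) (prod n (λ i → f (suc i))) (f (suc n)))

prod-* : ∀ n f g → prod n (λ i → f i · g i) ≡ prod n f · prod n g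
prod-* zero    f g = refl
prod-* (suc n) f g = trans (cong (_· (f n · g n)) (prod-* n f g)) (ZS.solve 4 (λ a b c d → a ⋆ b ⋆ (c ⋆ d) ⊜ a ⋆ c ⋆ (b ⋆ d)) refl (prod n f) (prod n g) (f n) (g n))

prod-zero : ∀ n f i → i ℕ.< n → f i ≡ 0ℤ → prod n f ≡ 0ℤ
prod-zero (suc n) f i i<n z with i ℕ.≟ n
... | yes refl = trans (cong (prod n f ·_) z) (ℤP.*-zeroʳ (prod n f))
... | no  i≢n  = trans (cong (_· f n) (prod-zero n f i (ℕP.≤∧≢⇒< (ℕP.≤-pred i<n) i≢n) z)) (ℤP.*-zeroˡ (f n))

prod-unit : ∀ {P} n f → (∀ i → i ℕ.< n → Unit P (f i)) → Unit P (prod n f)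
prod-unit zero    f U = unit-1
prod-unit (suc n) f U = unit-* (prod-unit n f (λ i q → U i (ℕP.m≤n⇒m≤1+n q))) (U n ℕP.≤-refl)

sum₀-cong : ∀ {P} n {f g} → (∀ i → i ℕ.≤ n → f i ≡ g i ⟪ P ⟫) → sum₀ n f ≡ sum₀ n g ⟪ P ⟫
sum₀-cong zero    p = p 0 z≤n
sum₀-cong (suc n) p = ≋-+ (sum₀-cong n (λ i q → p i (ℕP.m≤n⇒m≤1+n q))) (p (suc n) ℕP.≤-refl)

sum₀-* : ∀ n c f → sum₀ n (λ i → c · f i) ≡ c · sum₀ n f
sum₀-* zero    c f = refl
sum₀-* (suc n) c f = trans (cong (_+ c · f (suc n)) (sum₀-* n c f)) (sym (ℤP.*-distribˡ-+ c (sum₀ n f) (f (suc n))))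

sum₀-+ : ∀ n f g → sum₀ n (λ i → f i + g i) ≡ sum₀ n f + sum₀ n g
sum₀-+ zero    f g = refl
sum₀-+ (suc n) f g = trans (cong (_+ (f (suc n) + g (suc n))) (sum₀-+ n f g)) (ZS.solve 4 (λ a b c d → a ⊹ b ⊹ (c ⊹ d) ⊜ a ⊹ c ⊹ (b ⊹ d)) refl (sum₀ n f) (sum₀ n g) (f (suc n)) (g (suc n)))

sum₀-swap : ∀ m n (f : ℕ → ℕ → ℤ) → sum₀ m (λ i → sum₀ n (λ j → f i j)) ≡ sum₀ n (λ j → sum₀ m (λ i → f i j))
sum₀-swap zero    n f = refl
sum₀-swap (suc m) n f = trans (cong (_+ sum₀ n (f (suc m))) (sum₀-swap m n f)) (sym (sum₀-+ n (λ j → sum₀ m (λ i → f i j)) (f (suc m))))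

sum₀-head : ∀ n f → sum₀ (suc n) f ≡ f 0 + sum₀ n (λ i → f (suc i))
sum₀-head zero    f = refl
sum₀-head (suc n) f = trans (cong (_+ f (suc (suc n))) (sum₀-head n f)) (ℤP.+-assoc (f 0) (sum₀ n (λ i → f (suc i))) (f (suc (suc n))))

sum₀-reverse : ∀ n f → sum₀ n f ≡ sum₀ n (λ i → f (n ∸ i))
sum₀-reverse zero    f = refl
sum₀-reverse (suc n) f = trans (cong (_+ f (suc n)) (sum₀-reverse n f)) (trans (ℤP.+-comm (sum₀ n (λ i → f (n ∸ i))) (f (suc n))) (sym (sum₀-head n (λ i → f (suc n ∸ i)))))

sum₁-cong : ∀ {P} n {f g} → (∀ i → 0 ℕ.< i → i ℕ.≤ n → f i ≡ g i ⟪ P ⟫) → sumℤ n f ≡ sumℤ n g ⟪ P ⟫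
sum₁-cong zero    p = ≋-refl
sum₁-cong (suc n) p = ≋-+ (sum₁-cong n (λ i q r → p i q (ℕP.m≤n⇒m≤1+n r))) (p (suc n) (s≤s z≤n) ℕP.≤-refl)

sum₁-* : ∀ n c f → sumℤ n (λ i → c · f i) ≡ c · sumℤ n f
sum₁-* zero    c f = sym (ℤP.*-zeroʳ c)
sum₁-* (suc n) c f = trans (cong (_+ c · f (suc n)) (sum₁-* n c f)) (sym (ℤP.*-distribˡ-+ c (sumℤ n f) (f (suc n))))

sum₁-head : ∀ n f → sumℤ (suc n) f ≡ f 1 + sumℤ n (λ i → f (suc i))
sum₁-head zero    f = ℤP.+-comm 0ℤ (f 1)
sum₁-head (suc n) f = trans (cong (_+ f (suc (suc n))) (sum₁-head n f)) (ℤP.+-assoc (f 1) (sumℤ n (λ i → f (suc i))) (f (suc (suc n))))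

sum₁-reverse : ∀ n f → sumℤ n f ≡ sumℤ n (λ i → f (suc n ∸ i))
sum₁-reverse zero    f = refl
sum₁-reverse (suc n) f = trans (cong (_+ f (suc n)) (sum₁-reverse n f)) (trans (ℤP.+-comm (sumℤ n (λ i → f (suc n ∸ i))) (f (suc n))) (sym (sum₁-head n (λ i → f (suc (suc n) ∸ i)))))

sum₁-split : ∀ m n f → sumℤ (m ℕ.+ n) f ≡ sumℤ m f + sumℤ n (λ i → f (m ℕ.+ i))
sum₁-split m zero    f = trans (cong (λ t → sumℤ t f) (ℕP.+-identityʳ m)) (sym (ℤP.+-identityʳ (sumℤ m f)))
sum₁-split m (suc n) f = trans (cong (λ t → sumℤ t f) (ℕP.+-suc m n)) (trans (cong₂ _+_ (sum₁-split m n f) (cong f (sym (ℕP.+-suc m n)))) (ℤP.+-assoc (sumℤ m f) (sumℤ n (λ i → f (m ℕ.+ i))) (f (m ℕ.+ suc n))))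

sum₁-parity : ∀ m f → sumℤ (m ℕ.+ m) f ≡ sumℤ m (λ i → f (i ℕ.+ i)) + sumℤ m (λ i → f (i ℕ.+ i ∸ 1))
sum₁-parity zero    f = refl
sum₁-parity (suc m) f rewrite ℕP.+-suc m m = trans (cong (λ t → t + f (suc (m ℕ.+ m)) + f (suc (suc (m ℕ.+ m)))) (sum₁-parity m f))
  (ZS.solve 4 (λ a b c d → a ⊹ b ⊹ c ⊹ d ⊜ a ⊹ d ⊹ (b ⊹ c)) refl (sumℤ m (λ i → f (i ℕ.+ i))) (sumℤ m (λ i → f (i ℕ.+ i ∸ 1))) (f (suc (m ℕ.+ m))) (f (suc (suc (m ℕ.+ m)))))

-- Two solutions of the same first-order recurrence are proportional as long as the leading
-- coefficients are invertible. This replaces computations with quotients of Pochhammer symbols.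
seq-unique : ∀ {P} m (den num : ℕ → ℤ) → (∀ i → i ℕ.< m → Unit P (den i)) → ∀ {s t : ℕ → ℤ} →
  (∀ i → i ℕ.< m → den i · s (suc i) ≡ num i · s i ⟪ P ⟫) → (∀ i → i ℕ.< m → den i · t (suc i) ≡ num i · t i ⟪ P ⟫) →
  ∀ c → s 0 ≡ c · t 0 ⟪ P ⟫ → ∀ k → k ℕ.≤ m → s k ≡ c · t k ⟪ P ⟫
seq-unique m den num U p q c z zero    _   = z
seq-unique {P} m den num U {s} {t} p q c z (suc k) k<m = unit-cancel (U k k<m) (begin
  den k · s (suc k)        ≈⟨ p k k<m ⟩
  num k · s k              ≈⟨ ≋-*ˡ (num k) (seq-unique m den num U p q c z k (ℕP.<⇒≤ k<m)) ⟩
  num k · (c · t k)        ≈⟨ ≋-reflexive (ZS.solve 3 (λ a b c → a ⋆ (b ⋆ c) ⊜ b ⋆ (a ⋆ c)) refl (num k) c (t k)) ⟩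
  c · (num k · t k)        ≈⟨ ≋-*ˡ c (≋-sym (q k k<m)) ⟩
  c · (den k · t (suc k))  ≈⟨ ≋-reflexive (ZS.solve 3 (λ a b c → a ⋆ (b ⋆ c) ⊜ b ⋆ (a ⋆ c)) refl c (den k) (t (suc k))) ⟩
  den k · (c · t (suc k))  ∎)
  where open ≋R P

-- A hypergeometric term modulo P, with value 1 at 0 and term ratio num/den, realised by integers.
module Ratio {P : ℤ} (m : ℕ) (num den : ℕ → ℤ) (U : ∀ i → i ℕ.< m → Unit P (den i)) where
  -- junk value 0 from index m on
  den⁻¹ : ℕ → ℤ
  den⁻¹ i with i ℕ.<? m
  ... | yes i<m = inverse (U i i<m)
  ... | no  _   = 0ℤ

  ratio : ℕ → ℤ
  ratio zero    = 1ℤ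
  ratio (suc k) = ratio k · (num k · den⁻¹ k)

  ratio-rec : ∀ k → k ℕ.< m → den k · ratio (suc k) ≡ num k · ratio k ⟪ P ⟫
  ratio-rec k k<m with k ℕ.<? m
  ... | no  k≮m = ⊥-elim (k≮m k<m)
  ... | yes q   = ≋-trans (≋-reflexive (ZS.solve 4 (λ d r n w → d ⋆ (r ⋆ (n ⋆ w)) ⊜ (d ⋆ w) ⋆ (n ⋆ r)) refl (den k) (ratio k) (num k) (inverse (U k q))))
    (≋-trans (≋-*ʳ (num k · ratio k) (isInverse (U k q))) (≋-reflexive (ℤP.*-identityˡ (num k · ratio k))))

-- Harmonic sums and Morley's congruence

module Prime-odd (m : ℕ) (pp : Prime (suc (m ℕ.+ m))) where
  π π³ π⁴ : ℤ
  π  = + suc (m ℕ.+ m)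
  π³ = π · π · π
  π⁴ = π · π · π · π

  -- The Pochhammer factors 1 + i and 1/2 + i, doubled to be integers; the term ratio of `b` is o/e.
  e o : ℕ → ℤ
  e i = + 2 · + suc i
  o i = + 2 · + i + 1ℤ

  π-m : π ≡ o m
  π-m = ZS.solve 1 (λ m → # 1 ⊹ (m ⊹ m) ⊜ # 2 ⋆ m ⊹ # 1) refl (+ m)

  lift : ∀ {z} → Unit π z → Unit π⁴ z
  lift U = unit-lift (unit-lift (unit-lift U U) U) U

  unit-nat : ∀ n → 0 ℕ.< n → n ℕ.≤ m ℕ.+ m → Unit π (+ n)
  unit-nat n 0<n n≤2m = unit-<prime pp n 0<n (s≤s n≤2m)

  unit-e : ∀ i → i ℕ.< m → Unit π (e i)
  unit-e i i<m = subst (Unit π) (trans (ℤP.pos-+ (suc i) (suc i)) (ZS.solve 1 (λ i → i ⊹ i ⊜ # 2 ⋆ i) refl (+ suc i))) (unit-nat (suc i ℕ.+ suc i) (s≤s z≤n) (ℕP.+-mono-≤ i<m i<m))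

  unit-o : ∀ i → i ℕ.< m → Unit π (o i)
  unit-o i i<m = subst (Unit π) (ZS.solve 1 (λ i → # 1 ⊹ (i ⊹ i) ⊜ # 2 ⋆ i ⊹ # 1) refl (+ i)) (unit-nat (suc (i ℕ.+ i)) (s≤s z≤n) (ℕP.+-mono-≤ i<m (ℕP.<⇒≤ i<m)))

  open Ratio {π⁴} m o e (λ i i<m → lift (unit-e i i<m)) public renaming (ratio to b; ratio-rec to b-rec) using ()

  sq : ℤ → ℤ
  sq x = x · x

  unit-sq-+ : ∀ {z} c → Unit π z → Unit π (sq z + c · sq π)
  unit-sq-+ {z} c U = unit-≋ (cong-by (c · π) (ZS.solve 3 (λ z c p → z ⋆ z ⊹ c ⋆ (p ⋆ p) ⊜ z ⋆ z ⊹ c ⋆ p ⋆ p) refl z c π)) (unit-* U U)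

  -- w n is the inverse of n modulo π⁴ for 0 < n < p, and 0 otherwise
  w : ℕ → ℤ
  w zero = 0ℤ
  w (suc n) with suc n ℕ.≤? m ℕ.+ m
  ... | yes q = inverse (lift (unit-nat (suc n) (s≤s z≤n) q))
  ... | no _  = 0ℤ

  w-inv : ∀ n → 0 ℕ.< n → n ℕ.≤ m ℕ.+ m → + n · w n ≡ 1ℤ ⟪ π⁴ ⟫
  w-inv (suc n) _ n≤ with suc n ℕ.≤? m ℕ.+ m
  ... | yes q = isInverse (lift (unit-nat (suc n) (s≤s z≤n) q))
  ... | no ¬q = ⊥-elim (¬q n≤)

  mod-π : ∀ {a b} → a ≡ b ⟪ π⁴ ⟫ → a ≡ b ⟪ π ⟫
  mod-π q = ≋-reduce π (≋-reduce π (≋-reduce π q))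

  H : ℕ → ℤ
  H n = sumℤ n (λ i → sq (w i))

  inv² : ∀ k → 0 ℕ.< k → k ℕ.≤ m ℕ.+ m → + k · + k · sq (w k) ≡ 1ℤ ⟪ π ⟫
  inv² k 0<k k≤ = mod-π (≋-trans (≋-reflexive (ZS.solve 2 (λ a b → a ⋆ a ⋆ (b ⋆ b) ⊜ (a ⋆ b) ⋆ (a ⋆ b)) refl (+ k) (w k))) (≋-* (w-inv k 0<k k≤) (w-inv k 0<k k≤)))

  -- p - n ≡ -n, and the sign is lost in the square.
  w²-reflect : ∀ n → 0 ℕ.< n → n ℕ.≤ m ℕ.+ m → sq (w (suc (m ℕ.+ m) ∸ n)) ≡ sq (w n) ⟪ π ⟫
  w²-reflect n 0<n n≤ = unit-cancel (unit-* (unit-nat n 0<n n≤) (unit-nat n 0<n n≤)) (begin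
    + n · + n · sq (w n′)        ≈⟨ ≋-*ʳ (sq (w n′)) {+ n · + n} {+ n′ · + n′} (cong-by (+ n - + n′) eqn) ⟩
    + n′ · + n′ · sq (w n′)      ≈⟨ inv² n′ (ℕP.m<n⇒0<n∸m (s≤s n≤)) (ℕP.∸-monoʳ-≤ (suc (m ℕ.+ m)) 0<n) ⟩
    1ℤ                           ≈⟨ ≋-sym (inv² n 0<n n≤) ⟩
    + n · + n · sq (w n)         ∎)
    where
    open ≋R π
    n′ : ℕ
    n′ = suc (m ℕ.+ m) ∸ n
    π≡ : π ≡ + n′ + + n
    π≡ = cong +_ (sym (ℕP.m∸n+n≡m (ℕP.m≤n⇒m≤1+n n≤)))
    eqn : + n · + n ≡ + n′ · + n′ + (+ n - + n′) · π
    eqn = trans (ZS.solve 2 (λ a b → a ⋆ a ⊜ b ⋆ b ⊹ (a ∸′ b) ⋆ (b ⊹ a)) refl (+ n) (+ n′)) (cong (λ t → + n′ · + n′ + (+ n - + n′) · t) (sym π≡))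

  -- Under i ↦ p - i the terms of `H n′` become the terms of H(p - 1) with index beyond n.
  H-reflect : ∀ n n′ → n ℕ.+ n′ ≡ m ℕ.+ m → H n + H n′ ≡ H (m ℕ.+ m) ⟪ π ⟫
  H-reflect n n′ n+n′ = begin
    H n + H n′
      ≈⟨ ≋-+ˡ (H n) (≋-reflexive (sum₁-reverse n′ (λ i → sq (w i)))) ⟩
    H n + sumℤ n′ (λ i → sq (w (suc n′ ∸ i)))
      ≈⟨ ≋-+ˡ (H n) (sum₁-cong n′ (λ i 0<i i≤n′ → subst (λ t → sq (w t) ≡ sq (w (n ℕ.+ i)) ⟪ π ⟫) (index i)
           (w²-reflect (n ℕ.+ i) (ℕP.<-≤-trans 0<i (ℕP.m≤n+m i n)) (ℕP.≤-trans (ℕP.+-monoʳ-≤ n i≤n′) (ℕP.≤-reflexive n+n′))))) ⟩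
    H n + sumℤ n′ (λ i → sq (w (n ℕ.+ i)))
      ≈⟨ ≋-reflexive (sym (sum₁-split n n′ (λ i → sq (w i)))) ⟩
    H (n ℕ.+ n′)
      ≈⟨ ≋-reflexive (cong H n+n′) ⟩
    H (m ℕ.+ m) ∎
    where
    open ≋R π
    index : ∀ i → suc (m ℕ.+ m) ∸ (n ℕ.+ i) ≡ suc n′ ∸ i
    index i = trans (cong (λ t → suc t ∸ (n ℕ.+ i)) (sym n+n′)) (trans (cong (_∸ (n ℕ.+ i)) (sym (ℕP.+-suc n n′))) (ℕP.[m+n]∸[m+o]≡n∸o n (suc n′) i))

prod-reverse-odd : ∀ j → prod j (λ i → + 2 · + i + 1ℤ - + 2 · + j) ≡ prod j (λ i → - (+ 2 · + i + 1ℤ))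
prod-reverse-odd zero    = refl
prod-reverse-odd (suc j) = trans (prod-head j (λ i → + 2 · + i + 1ℤ - + 2 · + suc j)) (trans (cong₂ _·_
    (ZS.solve 1 (λ j → # 1 ∸′ # 2 ⋆ (# 1 ⊹ j) ⊜ ∸′ (# 2 ⋆ j ⊹ # 1)) refl (+ j))
    (trans (prod-cong j (λ i _ → ZS.solve 2 (λ i j → # 2 ⋆ (# 1 ⊹ i) ⊹ # 1 ∸′ # 2 ⋆ (# 1 ⊹ j) ⊜ # 2 ⋆ i ⊹ # 1 ∸′ # 2 ⋆ j) refl (+ i) (+ j))) (prod-reverse-odd j)))
  (ℤP.*-comm (- (+ 2 · + j + 1ℤ)) (prod j (λ i → - (+ 2 · + i + 1ℤ)))))

prod-reverse-even : ∀ j → prod j (λ i → + 2 · + i - + 2 · + j) ≡ prod j (λ i → - (+ 2 · + suc i))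
prod-reverse-even zero    = refl
prod-reverse-even (suc j) = trans (prod-head j (λ i → + 2 · + i - + 2 · + suc j)) (trans (cong₂ _·_
    (ZS.solve 1 (λ j → # 0 ∸′ # 2 ⋆ (# 1 ⊹ j) ⊜ ∸′ (# 2 ⋆ (# 1 ⊹ j))) refl (+ j))
    (trans (prod-cong j (λ i _ → ZS.solve 2 (λ i j → # 2 ⋆ (# 1 ⊹ i) ∸′ # 2 ⋆ (# 1 ⊹ j) ⊜ # 2 ⋆ i ∸′ # 2 ⋆ j) refl (+ i) (+ j))) (prod-reverse-even j)))
  (ℤP.*-comm (- (+ 2 · + suc j)) (prod j (λ i → - (+ 2 · + suc i)))))

-- (2n)! / n! = 2ⁿ (1 · 3 ⋯ (2n - 1))
prod-upper-half : ∀ n → prod n (λ i → + 2 · + n - + i) ≡ prod n (λ i → + 2 · (+ 2 · + i + 1ℤ))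
prod-upper-half zero    = refl
prod-upper-half (suc n) = ℤP.*-cancelʳ-≡ _ _ (+ suc n) (begin
  prod (suc n) f · + suc n
    ≡⟨ cong (prod (suc n) f ·_) (ZS.solve 1 (λ n → # 1 ⊹ n ⊜ # 2 ⋆ (# 1 ⊹ n) ∸′ (# 1 ⊹ n)) refl (+ n)) ⟩
  prod (suc (suc n)) f
    ≡⟨ trans (prod-head (suc n) f) (cong (f 0 ·_) (prod-head n (λ i → f (suc i)))) ⟩
  f 0 · (f 1 · prod n (λ i → f (suc (suc i))))
    ≡⟨ cong (λ t → f 0 · (f 1 · t)) (trans (prod-cong n (λ i _ → ZS.solve 2 (λ n i → # 2 ⋆ (# 1 ⊹ n) ∸′ (# 1 ⊹ (# 1 ⊹ i)) ⊜ # 2 ⋆ n ∸′ i) refl (+ n) (+ i))) (prod-upper-half n)) ⟩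
  f 0 · (f 1 · R)
    ≡⟨ ZS.solve 2 (λ n r → (# 2 ⋆ (# 1 ⊹ n) ∸′ # 0) ⋆ ((# 2 ⋆ (# 1 ⊹ n) ∸′ # 1) ⋆ r) ⊜ r ⋆ (# 2 ⋆ (# 2 ⋆ n ⊹ # 1)) ⋆ (# 1 ⊹ n)) refl (+ n) R ⟩
  R · (+ 2 · (+ 2 · + n + 1ℤ)) · + suc n ∎)
  where
  open ≡-Reasoning
  f : ℕ → ℤ
  f i = + 2 · + suc n - + i
  R : ℤ
  R = prod n (λ i → + 2 · (+ 2 · + i + 1ℤ))

module Harmonic (m : ℕ) (pp : Prime (suc (m ℕ.+ m))) (2≤m : 2 ℕ.≤ m) where
  open Prime-odd m pp

  Hₑ : ℕ → ℤ
  Hₑ n = sumℤ n (λ i → sq (w (i ℕ.+ i)))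

  -- 4/(2i)² = 1/i².
  Hₑ-H : + 4 · Hₑ m ≡ H m ⟪ π ⟫
  Hₑ-H = ≋-trans (≋-reflexive (sym (sum₁-* m (+ 4) (λ i → sq (w (i ℕ.+ i)))))) (sum₁-cong m λ i 0<i i≤m →
    let i≤ = ℕP.≤-trans i≤m (ℕP.m≤m+n m m) in
    unit-cancel (unit-* (unit-nat i 0<i i≤) (unit-nat i 0<i i≤)) (≋-trans (≋-reflexive (ZS.solve 2 (λ i x → i ⋆ i ⋆ (# 4 ⋆ x) ⊜ (i ⊹ i) ⋆ (i ⊹ i) ⋆ x) refl (+ i) (sq (w (i ℕ.+ i)))))
      (≋-trans (inv² (i ℕ.+ i) (ℕP.<-≤-trans 0<i (ℕP.m≤m+n i i)) (ℕP.+-mono-≤ i≤m i≤m)) (≋-sym (inv² i 0<i i≤)))))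

  -- As p is odd, i ↦ p - i exchanges the odd and the even indices.
  H-parity : H (m ℕ.+ m) ≡ + 2 · Hₑ m ⟪ π ⟫
  H-parity = begin
    H (m ℕ.+ m)
      ≈⟨ ≋-reflexive (sum₁-parity m (λ i → sq (w i))) ⟩
    Hₑ m + sumℤ m (λ i → sq (w (i ℕ.+ i ∸ 1)))
      ≈⟨ ≋-+ˡ (Hₑ m) (≋-trans (≋-reflexive (sum₁-reverse m (λ i → sq (w (i ℕ.+ i ∸ 1))))) (sum₁-cong m λ i 0<i i≤m →
           subst (λ t → sq (w t) ≡ sq (w (i ℕ.+ i)) ⟪ π ⟫) (index i i≤m) (w²-reflect (i ℕ.+ i) (ℕP.<-≤-trans 0<i (ℕP.m≤m+n i i)) (ℕP.+-mono-≤ i≤m i≤m)))) ⟩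
    Hₑ m + Hₑ m
      ≈⟨ ≋-reflexive (ZS.solve 1 (λ x → x ⊹ x ⊜ # 2 ⋆ x) refl (Hₑ m)) ⟩
    + 2 · Hₑ m ∎
    where
    open ≋R π
    index : ∀ i → i ℕ.≤ m → suc (m ℕ.+ m) ∸ (i ℕ.+ i) ≡ (suc m ∸ i) ℕ.+ (suc m ∸ i) ∸ 1
    index i i≤m = trans (cong (λ t → suc (t ℕ.+ t) ∸ (i ℕ.+ i)) (sym (ℕP.m∸n+n≡m i≤m)))
      (trans (cong (_∸ (i ℕ.+ i)) (NS.solve 2 (λ j i → NS.con 1 NS.:+ ((j NS.:+ i) NS.:+ (j NS.:+ i)) NS.:= (j NS.:+ (NS.con 1 NS.:+ j)) NS.:+ (i NS.:+ i)) refl (m ∸ i) i))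
        (trans (ℕP.m+n∸n≡m (m ∸ i ℕ.+ suc (m ∸ i)) (i ℕ.+ i)) (cong (λ t → t ℕ.+ t ∸ 1) (sym (ℕP.+-∸-assoc 1 i≤m)))))

  unit-6 : Unit π (+ 6)
  unit-6 = unit-* (unit-nat 2 (s≤s z≤n) (ℕP.≤-trans 2≤m (ℕP.m≤m+n m m))) (unit-nat 3 (s≤s z≤n) (ℕP.≤-trans (s≤s (s≤s (s≤s z≤n))) (ℕP.+-mono-≤ 2≤m 2≤m)))

  -- 2 H(m) ≡ H(2m) ≡ H(m)/2, so 6 H(m) vanishes
  H-m : H m ≡ 0ℤ ⟪ π ⟫
  H-m = unit-cancel unit-6 (begin
    + 6 · H m
      ≈⟨ ≋-reflexive (ZS.solve 1 (λ x → # 6 ⋆ x ⊜ # 4 ⋆ (x ⊹ x) ∸′ # 2 ⋆ x) refl (H m)) ⟩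
    + 4 · (H m + H m) - + 2 · H m
      ≈⟨ ≋-+ʳ (- (+ 2 · H m)) (≋-*ˡ (+ 4) (≋-trans (H-reflect m m refl) H-parity)) ⟩
    + 4 · (+ 2 · Hₑ m) - + 2 · H m
      ≈⟨ ≋-reflexive (ZS.solve 2 (λ x y → # 4 ⋆ (# 2 ⋆ x) ∸′ # 2 ⋆ y ⊜ # 2 ⋆ (# 4 ⋆ x) ∸′ # 2 ⋆ y) refl (Hₑ m) (H m)) ⟩
    + 2 · (+ 4 · Hₑ m) - + 2 · H m
      ≈⟨ ≋-+ʳ (- (+ 2 · H m)) (≋-*ˡ (+ 2) Hₑ-H) ⟩
    + 2 · H m - + 2 · H m
      ≈⟨ ≋-reflexive (ZS.solve 1 (λ x → # 2 ⋆ x ∸′ # 2 ⋆ x ⊜ # 6 ⋆ # 0) refl (H m)) ⟩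
    + 6 · 0ℤ ∎)
    where open ≋R π

  H-2m : H (m ℕ.+ m) ≡ 0ℤ ⟪ π ⟫
  H-2m = ≋-trans (≋-sym (H-reflect m m refl)) (≋-+ H-m H-m)

  Hₑ-m : Hₑ m ≡ 0ℤ ⟪ π ⟫
  Hₑ-m = unit-cancel (unit-* u₂ u₂) (≋-trans Hₑ-H H-m)
    where
    u₂ : Unit π (+ 2)
    u₂ = unit-nat 2 (s≤s z≤n) (ℕP.≤-trans 2≤m (ℕP.m≤m+n m m))

  e-nat : ∀ i → e i ≡ + (suc i ℕ.+ suc i)
  e-nat i = ZS.solve 1 (λ i → # 2 ⋆ i ⊜ i ⊹ i) refl (+ suc i)

  e²w² : ∀ i → i ℕ.< m → e i · e i · sq (w (suc i ℕ.+ suc i)) ≡ 1ℤ ⟪ π ⟫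
  e²w² i i<m = subst (λ t → t · t · sq (w (suc i ℕ.+ suc i)) ≡ 1ℤ ⟪ π ⟫) (sym (e-nat i)) (inv² (suc i ℕ.+ suc i) (s≤s z≤n) (ℕP.+-mono-≤ i<m i<m))

  -- (e - p)² = e(e - 2p) + p², and p²/(e(e - 2p)) ≡ p²/e² modulo p³. The factors 1 + p²/e² multiply
  -- to 1 + p² Σ 1/e², because their cross terms carry p⁴.
  square-product : ∀ k → k ℕ.≤ m → prod k (λ i → sq (e i - π)) ≡ prod k (λ i → e i · (e i - + 2 · π)) · (1ℤ + sq π · Hₑ k) ⟪ π³ ⟫
  square-product zero    _   = ≋-reflexive (ZS.solve 1 (λ p → # 1 ⊜ # 1 ⋆ (# 1 ⊹ p ⋆ p ⋆ # 0)) refl π)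
  square-product (suc k) k<m with e²w² k k<m
  ... | cong-by l eq = ≋-trans (≋-*ʳ (sq (e k - π)) (square-product k (ℕP.<⇒≤ k<m))) (cong-by (A · (- l + + 2 · e k · x + π · Hₑ k))
    (trans (ZS.solve 5 (λ A p h e x → A ⋆ (# 1 ⊹ p ⋆ p ⋆ h) ⋆ ((e ∸′ p) ⋆ (e ∸′ p)) ⊜
        A ⋆ (e ⋆ (e ∸′ # 2 ⋆ p)) ⋆ (# 1 ⊹ p ⋆ p ⋆ (h ⊹ x)) ⊹ A ⋆ (p ⋆ p) ⋆ (# 1 ∸′ e ⋆ e ⋆ x ⊹ # 2 ⋆ p ⋆ e ⋆ x ⊹ p ⋆ p ⋆ h)) refl A π (Hₑ k) (e k) x)
      (trans (cong (λ t → A · (e k · (e k - + 2 · π)) · (1ℤ + sq π · (Hₑ k + x)) + A · (π · π) · (1ℤ - t + + 2 · π · e k · x + π · π · Hₑ k)) eq)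
        (ZS.solve 7 (λ B A p l e x h → B ⊹ A ⋆ (p ⋆ p) ⋆ (# 1 ∸′ (# 1 ⊹ l ⋆ p) ⊹ # 2 ⋆ p ⋆ e ⋆ x ⊹ p ⋆ p ⋆ h) ⊜ B ⊹ A ⋆ ((∸′ l) ⊹ # 2 ⋆ e ⋆ x ⊹ p ⋆ h) ⋆ (p ⋆ p ⋆ p)) refl
          (A · (e k · (e k - + 2 · π)) · (1ℤ + sq π · (Hₑ k + x))) A π l (e k) x (Hₑ k)))))
    where
    A x : ℤ
    A = prod k (λ i → e i · (e i - + 2 · π))
    x = sq (w (suc k ℕ.+ suc k))

  ν : ℤ
  ν = prod m (λ i → - o i)

  -- With p = 2m + 1 the factors run through 1 - 2m, ..., -3, -1.
  prod-e-π : prod m (λ i → e i - π) ≡ ν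
  prod-e-π = trans (prod-cong m (λ i _ → ZS.solve 2 (λ i m → # 2 ⋆ (# 1 ⊹ i) ∸′ (# 1 ⊹ (m ⊹ m)) ⊜ # 2 ⋆ i ⊹ # 1 ∸′ # 2 ⋆ m) refl (+ i) (+ m))) (prod-reverse-odd m)

  -- Here e i - 2p = -2(2m - i), and the product of the 2m - i is (2m)!/m!. Together with `prod-e-π`
  -- this makes `square-product` a comparison of ν² with a multiple of ν, from which Morley's
  -- congruence drops out.
  prod-e-2π : prod m (λ i → e i - + 2 · π) ≡ prod m (λ i → + 4) · ν
  prod-e-2π = begin
    prod m (λ i → e i - + 2 · π)
      ≡⟨ prod-cong m (λ i _ → ZS.solve 2 (λ i m → # 2 ⋆ (# 1 ⊹ i) ∸′ # 2 ⋆ (# 1 ⊹ (m ⊹ m)) ⊜ ∸′ # 2 ⋆ (# 2 ⋆ m ∸′ i)) refl (+ i) (+ m)) ⟩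
    prod m (λ i → (- + 2) · (+ 2 · + m - + i))
      ≡⟨ trans (prod-* m (λ _ → - + 2) (λ i → + 2 · + m - + i)) (cong (prod m (λ _ → - + 2) ·_) (prod-upper-half m)) ⟩
    prod m (λ _ → - + 2) · prod m (λ i → + 2 · o i)
      ≡⟨ prod-* m (λ _ → - + 2) (λ i → + 2 · o i) ⟨
    prod m (λ i → (- + 2) · (+ 2 · o i))
      ≡⟨ prod-cong m (λ i _ → ZS.solve 1 (λ x → ∸′ # 2 ⋆ (# 2 ⋆ x) ⊜ # 4 ⋆ (∸′ x)) refl (o i)) ⟩
    prod m (λ i → + 4 · - o i)
      ≡⟨ prod-* m (λ _ → + 4) (λ i → - o i) ⟩
    prod m (λ i → + 4) · ν ∎
    where open ≡-Reasoning

  -- Morley's congruence (-1)ᵐ C(p - 1, m) ≡ 4ᵖ⁻¹ modulo p³, with denominators cleared.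
  morley : ν ≡ prod m (λ i → + 4 · e i) ⟪ π³ ⟫
  morley = unit-cancel unit-ν (begin
    ν · ν
      ≈⟨ ≋-reflexive (sym (trans (prod-* m (λ i → e i - π) (λ i → e i - π)) (cong₂ _·_ prod-e-π prod-e-π))) ⟩
    prod m (λ i → sq (e i - π))
      ≈⟨ square-product m ℕP.≤-refl ⟩
    A · (1ℤ + sq π · Hₑ m)
      ≈⟨ ≋-*ˡ A {1ℤ + sq π · Hₑ m} {1ℤ} (drop Hₑ-m) ⟩
    A · 1ℤ
      ≈⟨ ≋-reflexive (trans (ℤP.*-identityʳ A) (trans (prod-* m e (λ i → e i - + 2 · π)) (trans (cong (prod m e ·_) prod-e-2π)
           (trans (ZS.solve 3 (λ e f n → e ⋆ (f ⋆ n) ⊜ n ⋆ (f ⋆ e)) refl (prod m e) (prod m (λ _ → + 4)) ν) (cong (ν ·_) (sym (prod-* m (λ _ → + 4) e))))))) ⟩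
    ν · prod m (λ i → + 4 · e i) ∎)
    where
    open ≋R π³
    A : ℤ
    A = prod m (λ i → e i · (e i - + 2 · π))
    unit-ν : Unit π³ ν
    unit-ν = prod-unit m (λ i → - o i) (λ i i<m → unit-reduce π (unit-neg (lift (unit-o i i<m))))
    drop : ∀ {x} → x ≡ 0ℤ ⟪ π ⟫ → 1ℤ + sq π · x ≡ 1ℤ ⟪ π³ ⟫
    drop (cong-by k refl) = cong-by k (ZS.solve 2 (λ p k → # 1 ⊹ p ⋆ p ⋆ (# 0 ⊹ k ⋆ p) ⊜ # 1 ⊹ k ⋆ (p ⋆ p ⋆ p)) refl π k)

  b⁴ : ℕ → ℤ
  b⁴ j = sq (sq (b j))

  -- If i + k + 1 = m, then e k + o i = p = o k + e i. So modulo p the recurrence of `b` read from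
  -- the top downwards is the same recurrence, and the two solutions differ by the factor `b m`.
  b-reflect : ∀ k → k ℕ.≤ m → b (m ∸ k) ≡ b m · b k ⟪ π ⟫
  b-reflect = seq-unique m e o unit-e {λ k → b (m ∸ k)} {b} rec (λ i i<m → mod-π (b-rec i i<m)) (b m) (≋-reflexive (sym (ℤP.*-identityʳ (b m))))
    where
    open ≋R π
    rec : ∀ k → k ℕ.< m → e k · b (m ∸ suc k) ≡ o k · b (m ∸ k) ⟪ π ⟫
    rec k k<m = begin
      e k · b i
        ≈⟨ ≋-*ʳ (b i) (cong-by {e k} { - o i} 1ℤ (trans (ZS.solve 2 (λ i k → # 2 ⋆ (# 1 ⊹ k) ⊜ (∸′ (# 2 ⋆ i ⊹ # 1)) ⊹ # 1 ⋆ (# 1 ⊹ ((# 1 ⊹ (i ⊹ k)) ⊹ (# 1 ⊹ (i ⊹ k))))) refl (+ i) (+ k)) (cong (λ t → - o i + 1ℤ · + suc (t ℕ.+ t)) m≡))) ⟩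
      - o i · b i
        ≈⟨ ≋-trans (≋-reflexive (sym (ℤP.neg-distribˡ-* (o i) (b i)))) (≋-trans (≋-neg (≋-sym (mod-π (b-rec i i<m)))) (≋-reflexive (ℤP.neg-distribˡ-* (e i) (b (suc i))))) ⟩
      - e i · b (suc i)
        ≈⟨ ≋-*ʳ (b (suc i)) (cong-by { - e i} {o k} (- 1ℤ) (trans (ZS.solve 2 (λ i k → ∸′ (# 2 ⋆ (# 1 ⊹ i)) ⊜ (# 2 ⋆ k ⊹ # 1) ⊹ ∸′ # 1 ⋆ (# 1 ⊹ ((# 1 ⊹ (i ⊹ k)) ⊹ (# 1 ⊹ (i ⊹ k))))) refl (+ i) (+ k)) (cong (λ t → o k + - 1ℤ · + suc (t ℕ.+ t)) m≡))) ⟩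
      o k · b (suc i)
        ≈⟨ ≋-reflexive (cong (λ t → o k · b t) (sym (ℕP.+-∸-assoc 1 k<m))) ⟩
      o k · b (m ∸ k) ∎
      where
      i : ℕ
      i = m ∸ suc k
      m≡ : suc (i ℕ.+ k) ≡ m
      m≡ = trans (sym (ℕP.+-suc i k)) (ℕP.m∸n+n≡m k<m)
      i<m : i ℕ.< m
      i<m = ℕP.≤-trans (s≤s (ℕP.m≤m+n i k)) (ℕP.≤-reflexive m≡)

  -- The reflection at k = m, where b 0 = 1.
  b-m² : b m · b m ≡ 1ℤ ⟪ π ⟫
  b-m² = ≋-sym (≋-trans (≋-reflexive (cong b (sym (ℕP.n∸n≡0 m)))) (b-reflect m ℕP.≤-refl))

  -- the summand changes sign under j ↦ m - j
  b⁴H-sum : sum₀ m (λ j → b⁴ j · H (j ℕ.+ j)) ≡ 0ℤ ⟪ π ⟫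
  b⁴H-sum = unit-cancel u₂ (begin
    + 2 · S
      ≈⟨ ≋-reflexive (ZS.solve 1 (λ s → # 2 ⋆ s ⊜ s ⊹ s) refl S) ⟩
    S + S
      ≈⟨ ≋-+ˡ S (≋-trans (≋-reflexive (sum₀-reverse m g)) (≋-trans (sum₀-cong m anti) (≋-reflexive (sum₀-* m (- 1ℤ) g)))) ⟩
    S + - 1ℤ · S
      ≈⟨ ≋-reflexive (ZS.solve 1 (λ s → s ⊹ ∸′ # 1 ⋆ s ⊜ # 2 ⋆ # 0) refl S) ⟩
    + 2 · 0ℤ ∎)
    where
    open ≋R π
    u₂ : Unit π (+ 2)
    u₂ = unit-nat 2 (s≤s z≤n) (ℕP.≤-trans 2≤m (ℕP.m≤m+n m m))
    g : ℕ → ℤ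
    g j = b⁴ j · H (j ℕ.+ j)
    S : ℤ
    S = sum₀ m g
    anti : ∀ j → j ℕ.≤ m → g (m ∸ j) ≡ - 1ℤ · g j ⟪ π ⟫
    anti j j≤m = begin
      g j′
        ≈⟨ ≋-*ʳ (H (j′ ℕ.+ j′)) (≋-* (≋-* (b-reflect j j≤m) (b-reflect j j≤m)) (≋-* (b-reflect j j≤m) (b-reflect j j≤m))) ⟩
      sq (sq (b m · b j)) · H (j′ ℕ.+ j′)
        ≈⟨ ≋-reflexive (ZS.solve 4 (λ a b x y → (a ⋆ b ⋆ (a ⋆ b)) ⋆ (a ⋆ b ⋆ (a ⋆ b)) ⋆ x ⊜ ((a ⋆ a) ⋆ (a ⋆ a)) ⋆ ((b ⋆ b ⋆ (b ⋆ b)) ⋆ ((y ⊹ x) ∸′ y))) refl (b m) (b j) (H (j′ ℕ.+ j′)) (H (j ℕ.+ j))) ⟩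
      b m · b m · (b m · b m) · (b⁴ j · (H (j ℕ.+ j) + H (j′ ℕ.+ j′) - H (j ℕ.+ j)))
        ≈⟨ ≋-* (≋-* b-m² b-m²) (≋-*ˡ (b⁴ j) (≋-+ʳ (- H (j ℕ.+ j)) (≋-trans (H-reflect (j ℕ.+ j) (j′ ℕ.+ j′) index) H-2m))) ⟩
      1ℤ · 1ℤ · (b⁴ j · (0ℤ - H (j ℕ.+ j)))
        ≈⟨ ≋-reflexive (ZS.solve 2 (λ b h → # 1 ⋆ # 1 ⋆ (b ⋆ (# 0 ∸′ h)) ⊜ ∸′ # 1 ⋆ (b ⋆ h)) refl (b⁴ j) (H (j ℕ.+ j))) ⟩
      - 1ℤ · g j ∎
      where
      j′ : ℕ
      j′ = m ∸ j
      index : (j ℕ.+ j) ℕ.+ (j′ ℕ.+ j′) ≡ m ℕ.+ m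
      index = trans (NS.solve 2 (λ a b → (a NS.:+ a) NS.:+ (b NS.:+ b) NS.:= (b NS.:+ a) NS.:+ (b NS.:+ a)) refl j j′) (cong (λ t → t ℕ.+ t) (ℕP.m∸n+n≡m j≤m))

-- Whipple's transformation

-- N₀ k j = 4ʲ (-k)ⱼ (k + 1/2)ⱼ and N₁ k j = 4ʲ (-k)ⱼ (k + 3/2)ⱼ
N₀ N₁ : ℕ → ℕ → ℤ
N₀ k j = prod j (λ i → (+ 2 · + i - + 2 · + k) · (+ 2 · + k + 1ℤ + + 2 · + i))
N₁ k j = prod j (λ i → (+ 2 · + i - + 2 · + k) · (+ 2 · + k + + 3 + + 2 · + i))

-- `N₁ k j` is the common factor of N₀ k (j + 1) and N₀ (k + 1) (j + 1); it lets the summands for k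
-- and k + 1 be compared without division.
N₀-shift : ∀ k j → N₀ k (suc j) ≡ N₁ k j · ((+ 2 · + j - + 2 · + k) · (+ 2 · + k + 1ℤ))
N₀-shift k zero    = ZS.solve 1 (λ k → # 1 ⋆ ((# 0 ∸′ # 2 ⋆ k) ⋆ (# 2 ⋆ k ⊹ # 1 ⊹ # 0)) ⊜ # 1 ⋆ ((# 0 ∸′ # 2 ⋆ k) ⋆ (# 2 ⋆ k ⊹ # 1))) refl (+ k)
N₀-shift k (suc j) = trans (cong (_· ((+ 2 · + suc j - + 2 · + k) · (+ 2 · + k + 1ℤ + + 2 · + suc j))) (N₀-shift k j))
  (ZS.solve 3 (λ N j k → N ⋆ ((# 2 ⋆ j ∸′ # 2 ⋆ k) ⋆ (# 2 ⋆ k ⊹ # 1)) ⋆ ((# 2 ⋆ (# 1 ⊹ j) ∸′ # 2 ⋆ k) ⋆ (# 2 ⋆ k ⊹ # 1 ⊹ # 2 ⋆ (# 1 ⊹ j)))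
    ⊜ N ⋆ ((# 2 ⋆ j ∸′ # 2 ⋆ k) ⋆ (# 2 ⋆ k ⊹ # 3 ⊹ # 2 ⋆ j)) ⋆ ((# 2 ⋆ (# 1 ⊹ j) ∸′ # 2 ⋆ k) ⋆ (# 2 ⋆ k ⊹ # 1))) refl (N₁ k j) (+ j) (+ k))

N₀-shift′ : ∀ k j → N₀ (suc k) (suc j) ≡ N₁ k j · (- (+ 2 · + suc k) · (+ 2 · + k + + 3 + + 2 · + j))
N₀-shift′ k zero    = ZS.solve 1 (λ k → # 1 ⋆ ((# 0 ∸′ # 2 ⋆ (# 1 ⊹ k)) ⋆ (# 2 ⋆ (# 1 ⊹ k) ⊹ # 1 ⊹ # 0)) ⊜ # 1 ⋆ ((∸′ (# 2 ⋆ (# 1 ⊹ k))) ⋆ (# 2 ⋆ k ⊹ # 3 ⊹ # 0))) refl (+ k)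
N₀-shift′ k (suc j) = trans (cong (_· ((+ 2 · + suc j - + 2 · + suc k) · (+ 2 · + suc k + 1ℤ + + 2 · + suc j))) (N₀-shift′ k j))
  (ZS.solve 3 (λ N j k → N ⋆ ((∸′ (# 2 ⋆ (# 1 ⊹ k))) ⋆ (# 2 ⋆ k ⊹ # 3 ⊹ # 2 ⋆ j)) ⋆ ((# 2 ⋆ (# 1 ⊹ j) ∸′ # 2 ⋆ (# 1 ⊹ k)) ⋆ (# 2 ⋆ (# 1 ⊹ k) ⊹ # 1 ⊹ # 2 ⋆ (# 1 ⊹ j)))
    ⊜ N ⋆ ((# 2 ⋆ j ∸′ # 2 ⋆ k) ⋆ (# 2 ⋆ k ⊹ # 3 ⊹ # 2 ⋆ j)) ⋆ ((∸′ (# 2 ⋆ (# 1 ⊹ k))) ⋆ (# 2 ⋆ k ⊹ # 3 ⊹ # 2 ⋆ (# 1 ⊹ j)))) refl (N₁ k j) (+ j) (+ k))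

N₀-ratio : ∀ k j → (+ 2 · + suc k - + 2 · + j) · (+ 2 · + k + 1ℤ) · N₀ (suc k) j ≡ + 2 · + suc k · (+ 2 · + k + 1ℤ + + 2 · + j) · N₀ k j
N₀-ratio k zero    = ZS.solve 1 (λ k → (# 2 ⋆ (# 1 ⊹ k) ∸′ # 0) ⋆ (# 2 ⋆ k ⊹ # 1) ⋆ # 1 ⊜ # 2 ⋆ (# 1 ⊹ k) ⋆ (# 2 ⋆ k ⊹ # 1 ⊹ # 0) ⋆ # 1) refl (+ k)
N₀-ratio k (suc j) = trans (cong ((+ 2 · + suc k - + 2 · + suc j) · (+ 2 · + k + 1ℤ) ·_) (N₀-shift′ k j)) (trans
  (ZS.solve 3 (λ N j k → (# 2 ⋆ (# 1 ⊹ k) ∸′ # 2 ⋆ (# 1 ⊹ j)) ⋆ (# 2 ⋆ k ⊹ # 1) ⋆ (N ⋆ ((∸′ (# 2 ⋆ (# 1 ⊹ k))) ⋆ (# 2 ⋆ k ⊹ # 3 ⊹ # 2 ⋆ j)))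
    ⊜ # 2 ⋆ (# 1 ⊹ k) ⋆ (# 2 ⋆ k ⊹ # 1 ⊹ # 2 ⋆ (# 1 ⊹ j)) ⋆ (N ⋆ ((# 2 ⋆ j ∸′ # 2 ⋆ k) ⋆ (# 2 ⋆ k ⊹ # 1)))) refl (N₁ k j) (+ j) (+ k))
  (cong (+ 2 · + suc k · (+ 2 · + k + 1ℤ + + 2 · + suc j) ·_) (sym (N₀-shift k j))))

factor-zero : ∀ k c → (+ 2 · + k - + 2 · + k) · c ≡ 0ℤ
factor-zero k c = ZS.solve 2 (λ k c → (# 2 ⋆ k ∸′ # 2 ⋆ k) ⋆ c ⊜ # 0) refl (+ k) c

N₀-zero : ∀ k j → k ℕ.< j → N₀ k j ≡ 0ℤ
N₀-zero k j k<j = prod-zero j _ k k<j (factor-zero k _)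

N₁-zero : ∀ k j → k ℕ.< j → N₁ k j ≡ 0ℤ
N₁-zero k j k<j = prod-zero j _ k k<j (factor-zero k _)

sum₀-last : ∀ n f → (∀ i → i ℕ.< n → f i ≡ 0ℤ) → sum₀ n f ≡ f n
sum₀-last zero    f z = refl
sum₀-last (suc n) f z = trans (cong (_+ f (suc n)) (zeros n (λ i i≤n → z i (s≤s i≤n)))) (ℤP.+-identityˡ (f (suc n)))
  where
  zeros : ∀ n → (∀ i → i ℕ.≤ n → f i ≡ 0ℤ) → sum₀ n f ≡ 0ℤ
  zeros zero    q = q 0 z≤n
  zeros (suc n) q = cong₂ _+_ (zeros n (λ i i≤n → q i (ℕP.m≤n⇒m≤1+n i≤n))) (q (suc n) ℕP.≤-refl)

sum₀-first : ∀ n f → (∀ i → f (suc i) ≡ 0ℤ) → sum₀ n f ≡ f 0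
sum₀-first zero    f z = refl
sum₀-first (suc n) f z = trans (cong₂ _+_ (sum₀-first n f z) (z n)) (ℤP.+-identityʳ (f 0))

module Whipple (m : ℕ) (pp : Prime (suc (m ℕ.+ m))) (2≤m : 2 ℕ.≤ m) where
  open Prime-odd m pp
  open Harmonic m pp 2≤m

  -- Four times the Pochhammer factors of the pairs (1 ± p)/2, 1 ± p/2, (1 ± ip)/2 and 1 ± ip/2.
  -- Keeping each pair together keeps the factors integral and real.
  o⁻ e⁻ o⁺ e⁺ : ℕ → ℤ
  o⁻ i = sq (o i) - sq π
  e⁻ i = sq (e i) - sq π
  o⁺ i = sq (o i) + sq π
  e⁺ i = sq (e i) + sq π

  unit-⁻ : ∀ {z} → Unit π z → Unit π (sq z - sq π)
  unit-⁻ {z} U = subst (Unit π) (ZS.solve 2 (λ z p → z ⋆ z ⊹ ∸′ # 1 ⋆ (p ⋆ p) ⊜ z ⋆ z ∸′ p ⋆ p) refl z π) (unit-sq-+ (- 1ℤ) U)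

  unit-⁺ : ∀ {z} → Unit π z → Unit π (sq z + sq π)
  unit-⁺ {z} U = subst (Unit π) (ZS.solve 2 (λ z p → z ⋆ z ⊹ # 1 ⋆ (p ⋆ p) ⊜ z ⋆ z ⊹ p ⋆ p) refl z π) (unit-sq-+ 1ℤ U)

  -- `F` and `B` are the two halves of the replaced fourth power; `γ` is the part of Saalschütz's
  -- summand that does not depend on k.
  open Ratio {π⁴} m o⁻ e⁻ (λ i i<m → lift (unit-⁻ (unit-e i i<m))) renaming (ratio to F; ratio-rec to F-rec) using ()
  open Ratio {π⁴} m o⁺ e⁺ (λ i i<m → lift (unit-⁺ (unit-e i i<m))) renaming (ratio to B; ratio-rec to B-rec) using ()
  open Ratio {π⁴} m o (λ i → e i · e⁺ i) (λ i i<m → lift (unit-* (unit-e i i<m) (unit-⁺ (unit-e i i<m)))) renaming (ratio to γ; ratio-rec to γ-rec) using ()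

  O : ℕ → ℤ
  O j = prod j o⁻

  b⁴-rec : ∀ i → i ℕ.< m → sq (sq (e i)) · b⁴ (suc i) ≡ sq (sq (o i)) · b⁴ i ⟪ π⁴ ⟫
  b⁴-rec i i<m = ≋-trans (≋-reflexive (ZS.solve 2 (λ e b → e ⋆ e ⋆ (e ⋆ e) ⋆ (b ⋆ b ⋆ (b ⋆ b)) ⊜ (e ⋆ b) ⋆ (e ⋆ b) ⋆ ((e ⋆ b) ⋆ (e ⋆ b))) refl (e i) (b (suc i))))
    (≋-trans (≋-* (≋-* q q) (≋-* q q)) (≋-reflexive (ZS.solve 2 (λ e b → (e ⋆ b) ⋆ (e ⋆ b) ⋆ ((e ⋆ b) ⋆ (e ⋆ b)) ⊜ e ⋆ e ⋆ (e ⋆ e) ⋆ (b ⋆ b ⋆ (b ⋆ b))) refl (o i) (b i))))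
    where
    q : e i · b (suc i) ≡ o i · b i ⟪ π⁴ ⟫
    q = b-rec i i<m

  difference-of-squares : ∀ x → sq (sq x) ≡ (sq x - sq π) · (sq x + sq π) ⟪ π⁴ ⟫
  difference-of-squares x = cong-by 1ℤ (ZS.solve 2 (λ x p → x ⋆ x ⋆ (x ⋆ x) ⊜ (x ⋆ x ∸′ p ⋆ p) ⋆ (x ⋆ x ⊹ p ⋆ p) ⊹ # 1 ⋆ (p ⋆ p ⋆ p ⋆ p)) refl x π)

  F*B : ∀ k → k ℕ.≤ m → F k · B k ≡ b⁴ k ⟪ π⁴ ⟫
  F*B k k≤m = ≋-trans (seq-unique m (λ i → sq (sq (e i))) (λ i → sq (sq (o i))) (λ i i<m → let U = lift (unit-e i i<m) in unit-* (unit-* U U) (unit-* U U))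
      {λ k → F k · B k} {b⁴} rec b⁴-rec 1ℤ ≋-refl k k≤m) (≋-reflexive (ℤP.*-identityˡ (b⁴ k)))
    where
    rec : ∀ i → i ℕ.< m → sq (sq (e i)) · (F (suc i) · B (suc i)) ≡ sq (sq (o i)) · (F i · B i) ⟪ π⁴ ⟫
    rec i i<m = begin
      sq (sq (e i)) · (F (suc i) · B (suc i))
        ≈⟨ ≋-*ʳ (F (suc i) · B (suc i)) (difference-of-squares (e i)) ⟩
      e⁻ i · e⁺ i · (F (suc i) · B (suc i))
        ≈⟨ ≋-reflexive (ZS.solve 4 (λ a b c d → a ⋆ b ⋆ (c ⋆ d) ⊜ (a ⋆ c) ⋆ (b ⋆ d)) refl (e⁻ i) (e⁺ i) (F (suc i)) (B (suc i))) ⟩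
      e⁻ i · F (suc i) · (e⁺ i · B (suc i))
        ≈⟨ ≋-* (F-rec i i<m) (B-rec i i<m) ⟩
      o⁻ i · F i · (o⁺ i · B i)
        ≈⟨ ≋-reflexive (ZS.solve 4 (λ a b c d → (a ⋆ c) ⋆ (b ⋆ d) ⊜ a ⋆ b ⋆ (c ⋆ d)) refl (o⁻ i) (o⁺ i) (F i) (B i)) ⟩
      o⁻ i · o⁺ i · (F i · B i)
        ≈⟨ ≋-*ʳ (F i · B i) (≋-sym (difference-of-squares (o i))) ⟩
      sq (sq (o i)) · (F i · B i) ∎
      where open ≋R π⁴

  -- Zeilberger's method: the right-hand side is the telescoped partial sum.
  saalschütz-certificate : ∀ k J → J ℕ.≤ m →
    e⁺ k · sum₀ J (λ j → N₀ (suc k) j · γ j) - o⁺ k · sum₀ J (λ j → N₀ k j · γ j) ≡ (+ 4 · + k + + 3) · (o J · γ J · N₁ k J) ⟪ π⁴ ⟫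
  saalschütz-certificate k zero _ = ≋-reflexive (ZS.solve 2 (λ k p → ((# 2 ⋆ (# 1 ⊹ k)) ⋆ (# 2 ⋆ (# 1 ⊹ k)) ⊹ p ⋆ p) ⋆ # 1 ∸′ ((# 2 ⋆ k ⊹ # 1) ⋆ (# 2 ⋆ k ⊹ # 1) ⊹ p ⋆ p) ⋆ # 1 ⊜ (# 4 ⋆ k ⊹ # 3) ⋆ # 1) refl (+ k) π)
  saalschütz-certificate k (suc J) J<m = begin
    e⁺ k · (S₁ + N₀ (suc k) (suc J) · γ (suc J)) - o⁺ k · (S₀ + N₀ k (suc J) · γ (suc J))
      ≈⟨ ≋-reflexive (trans (cong₂ (λ x y → e⁺ k · (S₁ + x · γ (suc J)) - o⁺ k · (S₀ + y · γ (suc J))) (N₀-shift′ k J) (N₀-shift k J))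
           (ZS.solve 8 (λ a b s t x y N g → a ⋆ (s ⊹ N ⋆ x ⋆ g) ∸′ b ⋆ (t ⊹ N ⋆ y ⋆ g) ⊜ (a ⋆ s ∸′ b ⋆ t) ⊹ (a ⋆ x ∸′ b ⋆ y) ⋆ N ⋆ g) refl (e⁺ k) (o⁺ k) S₁ S₀ x y (N₁ k J) (γ (suc J)))) ⟩
    (e⁺ k · S₁ - o⁺ k · S₀) + (e⁺ k · x - o⁺ k · y) · N₁ k J · γ (suc J)
      ≈⟨ ≋-+ʳ ((e⁺ k · x - o⁺ k · y) · N₁ k J · γ (suc J)) (≋-trans (saalschütz-certificate k J (ℕP.<⇒≤ J<m)) (≋-*ˡ (+ 4 · + k + + 3) (≋-*ʳ (N₁ k J) (≋-sym (γ-rec J J<m))))) ⟩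
    (+ 4 · + k + + 3) · (e J · e⁺ J · γ (suc J) · N₁ k J) + (e⁺ k · x - o⁺ k · y) · N₁ k J · γ (suc J)
      ≈⟨ ≋-reflexive (ZS.solve 5 (λ k J p g N →
           let ek = # 2 ⋆ (# 1 ⊹ k)
               eJ = # 2 ⋆ (# 1 ⊹ J)
               ok = # 2 ⋆ k ⊹ # 1
           in (# 4 ⋆ k ⊹ # 3) ⋆ (eJ ⋆ (eJ ⋆ eJ ⊹ p ⋆ p) ⋆ g ⋆ N)
                ⊹ ((ek ⋆ ek ⊹ p ⋆ p) ⋆ ((∸′ ek) ⋆ (# 2 ⋆ k ⊹ # 3 ⊹ # 2 ⋆ J)) ∸′ (ok ⋆ ok ⊹ p ⋆ p) ⋆ ((# 2 ⋆ J ∸′ # 2 ⋆ k) ⋆ (# 2 ⋆ k ⊹ # 1))) ⋆ N ⋆ g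
              ⊜ (# 4 ⋆ k ⊹ # 3) ⋆ ((# 2 ⋆ (# 1 ⊹ J) ⊹ # 1) ⋆ g ⋆ (N ⋆ ((# 2 ⋆ J ∸′ # 2 ⋆ k) ⋆ (# 2 ⋆ k ⊹ # 3 ⊹ # 2 ⋆ J))))) refl (+ k) (+ J) π (γ (suc J)) (N₁ k J)) ⟩
    (+ 4 · + k + + 3) · (o (suc J) · γ (suc J) · N₁ k (suc J)) ∎
    where
    open ≋R π⁴
    S₀ S₁ x y : ℤ
    S₀ = sum₀ J (λ j → N₀ k j · γ j)
    S₁ = sum₀ J (λ j → N₀ (suc k) j · γ j)
    x = - (+ 2 · + suc k) · (+ 2 · + k + + 3 + + 2 · + J)
    y = (+ 2 · + J - + 2 · + k) · (+ 2 · + k + 1ℤ)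

  -- The Pfaff-Saalschütz sum ₃F₂(-k, k + 1/2, 1/2; 1 + ip/2, 1 - ip/2; 1). At J = m the certificate
  -- vanishes, since `N₁ i m` contains a zero factor for i < m, and the recurrence of `B` is left.
  saalschütz : ∀ k → k ℕ.≤ m → sum₀ m (λ j → N₀ k j · γ j) ≡ B k ⟪ π⁴ ⟫
  saalschütz k k≤m = ≋-trans (seq-unique m e⁺ o⁺ (λ i i<m → lift (unit-⁺ (unit-e i i<m))) {λ k → sum₀ m (λ j → N₀ k j · γ j)} {B} rec B-rec 1ℤ (≋-reflexive base) k k≤m) (≋-reflexive (ℤP.*-identityˡ (B k)))
    where
    base : sum₀ m (λ j → N₀ 0 j · γ j) ≡ 1ℤ
    base = sum₀-first m (λ j → N₀ 0 j · γ j) (λ j → trans (cong (_· γ (suc j)) (N₀-zero 0 (suc j) (s≤s z≤n))) (ℤP.*-zeroˡ (γ (suc j))))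
    rec : ∀ i → i ℕ.< m → e⁺ i · sum₀ m (λ j → N₀ (suc i) j · γ j) ≡ o⁺ i · sum₀ m (λ j → N₀ i j · γ j) ⟪ π⁴ ⟫
    rec i i<m = begin
      s
        ≈⟨ ≋-reflexive (ZS.solve 2 (λ s t → s ⊜ (s ∸′ t) ⊹ t) refl s t) ⟩
      (s - t) + t
        ≈⟨ ≋-+ʳ t (≋-trans (saalschütz-certificate i m ℕP.≤-refl) (≋-reflexive (trans (cong (λ z → (+ 4 · + i + + 3) · (o m · γ m · z)) (N₁-zero i m i<m))
             (ZS.solve 2 (λ a b → a ⋆ (b ⋆ # 0) ⊜ # 0) refl (+ 4 · + i + + 3) (o m · γ m))))) ⟩
      0ℤ + t
        ≈⟨ ≋-reflexive (ℤP.+-identityˡ t) ⟩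
      t ∎
      where
      open ≋R π⁴
      s t : ℤ
      s = e⁺ i · sum₀ m (λ j → N₀ (suc i) j · γ j)
      t = o⁺ i · sum₀ m (λ j → N₀ i j · γ j)

  t : ℕ → ℤ
  t k = (+ 4 · + k + 1ℤ) · (sq (b k) · F k)

  -- The inner sum that remains when Saalschütz's sum replaces `B` and the summations are exchanged:
  -- a very well-poised series.
  I : ℕ → ℤ
  I j = sum₀ m (λ k → t k · N₀ k j)

  -- The term ratio in k of the summand of `I j` without its factor 4k + 1. It rewrites the right
  -- side of the certificate at k through the summand at k + 1.
  x-rec : ∀ k j → k ℕ.< m → o k · o⁻ k · (o k + + 2 · + j) · (sq (b k) · F k · N₀ k j) ≡ e k · e⁻ k · (e k - + 2 · + j) · (sq (b (suc k)) · F (suc k) · N₀ (suc k) j) ⟪ π⁴ ⟫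
  x-rec k j k<m = unit-cancel (lift (unit-o k k<m)) (begin
    o k · (o k · o⁻ k · (o k + + 2 · + j) · (sq (b k) · F k · N₀ k j))
      ≈⟨ ≋-reflexive (ZS.solve 6 (λ o O j b f n → o ⋆ (o ⋆ O ⋆ (o ⊹ # 2 ⋆ j) ⋆ (b ⋆ b ⋆ f ⋆ n)) ⊜ (o ⋆ b) ⋆ (o ⋆ b) ⋆ (O ⋆ f) ⋆ ((o ⊹ # 2 ⋆ j) ⋆ n)) refl (o k) (o⁻ k) (+ j) (b k) (F k) (N₀ k j)) ⟩
    o k · b k · (o k · b k) · (o⁻ k · F k) · ((o k + + 2 · + j) · N₀ k j)
      ≈⟨ ≋-*ʳ ((o k + + 2 · + j) · N₀ k j) (≋-* (≋-* (≋-sym (b-rec k k<m)) (≋-sym (b-rec k k<m))) (≋-sym (F-rec k k<m))) ⟩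
    e k · b (suc k) · (e k · b (suc k)) · (e⁻ k · F (suc k)) · ((o k + + 2 · + j) · N₀ k j)
      ≈⟨ ≋-reflexive (ZS.solve 6 (λ e E z b f y → (e ⋆ b) ⋆ (e ⋆ b) ⋆ (E ⋆ f) ⋆ (z ⋆ y) ⊜ e ⋆ E ⋆ (b ⋆ b) ⋆ f ⋆ (e ⋆ z ⋆ y)) refl (e k) (e⁻ k) (o k + + 2 · + j) (b (suc k)) (F (suc k)) (N₀ k j)) ⟩
    e k · e⁻ k · sq (b (suc k)) · F (suc k) · (e k · (o k + + 2 · + j) · N₀ k j)
      ≈⟨ ≋-reflexive (cong (e k · e⁻ k · sq (b (suc k)) · F (suc k) ·_) (sym (N₀-ratio k j))) ⟩
    e k · e⁻ k · sq (b (suc k)) · F (suc k) · ((e k - + 2 · + j) · o k · N₀ (suc k) j)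
      ≈⟨ ≋-reflexive (ZS.solve 7 (λ e E o j b f n → e ⋆ E ⋆ b ⋆ f ⋆ ((e ∸′ # 2 ⋆ j) ⋆ o ⋆ n) ⊜ o ⋆ (e ⋆ E ⋆ (e ∸′ # 2 ⋆ j) ⋆ (b ⋆ f ⋆ n))) refl (e k) (e⁻ k) (o k) (+ j) (sq (b (suc k))) (F (suc k)) (N₀ (suc k) j)) ⟩
    o k · (e k · e⁻ k · (e k - + 2 · + j) · (sq (b (suc k)) · F (suc k) · N₀ (suc k) j)) ∎)
    where open ≋R π⁴

  -- Telescoping in k with j as the parameter: by `x-rec` the summand on the left is the difference
  -- of two consecutive values of the right side.
  well-poised-certificate : ∀ j K → K ℕ.≤ m → sum₀ K (λ k → o j · o⁻ j · (t k · N₀ k j) - e j · (t k · N₀ k (suc j))) ≡ o K · o⁻ K · (o K + + 2 · + j) · (sq (b K) · F K · N₀ K j) ⟪ π⁴ ⟫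
  well-poised-certificate j zero _ = ≋-reflexive (ZS.solve 3 (λ j p n →
      let oj = # 2 ⋆ j ⊹ # 1
      in oj ⋆ (oj ⋆ oj ∸′ p ⋆ p) ⋆ (# 1 ⋆ # 1 ⋆ n) ∸′ # 2 ⋆ (# 1 ⊹ j) ⋆ (# 1 ⋆ # 1 ⋆ (n ⋆ ((# 2 ⋆ j ∸′ # 0) ⋆ (# 1 ⊹ # 2 ⋆ j))))
         ⊜ # 1 ⋆ (# 1 ∸′ p ⋆ p) ⋆ (# 1 ⊹ # 2 ⋆ j) ⋆ (# 1 ⋆ # 1 ⋆ n)) refl (+ j) π (N₀ 0 j))
  well-poised-certificate j (suc K) K<m = begin
    S + (o j · o⁻ j · (t (suc K) · N₀ (suc K) j) - e j · (t (suc K) · N₀ (suc K) (suc j)))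
      ≈⟨ ≋-+ʳ (o j · o⁻ j · (t (suc K) · N₀ (suc K) j) - e j · (t (suc K) · N₀ (suc K) (suc j))) (≋-trans (well-poised-certificate j K (ℕP.<⇒≤ K<m)) (x-rec K j K<m)) ⟩
    e K · e⁻ K · (e K - + 2 · + j) · (sq (b (suc K)) · F (suc K) · N₀ (suc K) j) + (o j · o⁻ j · (t (suc K) · N₀ (suc K) j) - e j · (t (suc K) · N₀ (suc K) (suc j)))
      ≈⟨ ≋-reflexive (ZS.solve 5 (λ j k p x n →
           let k′ = # 1 ⊹ k
               ek = # 2 ⋆ k′
               oj = # 2 ⋆ j ⊹ # 1
               ok = # 2 ⋆ k′ ⊹ # 1
               tk = (# 4 ⋆ k′ ⊹ # 1) ⋆ x
           in ek ⋆ (ek ⋆ ek ∸′ p ⋆ p) ⋆ (ek ∸′ # 2 ⋆ j) ⋆ (x ⋆ n) ⊹ (oj ⋆ (oj ⋆ oj ∸′ p ⋆ p) ⋆ (tk ⋆ n) ∸′ # 2 ⋆ (# 1 ⊹ j) ⋆ (tk ⋆ (n ⋆ ((# 2 ⋆ j ∸′ # 2 ⋆ k′) ⋆ (# 2 ⋆ k′ ⊹ # 1 ⊹ # 2 ⋆ j)))))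
              ⊜ ok ⋆ (ok ⋆ ok ∸′ p ⋆ p) ⋆ (ok ⊹ # 2 ⋆ j) ⋆ (x ⋆ n)) refl (+ j) (+ K) π (sq (b (suc K)) · F (suc K)) (N₀ (suc K) j)) ⟩
    o (suc K) · o⁻ (suc K) · (o (suc K) + + 2 · + j) · (sq (b (suc K)) · F (suc K) · N₀ (suc K) j) ∎
    where
    open ≋R π⁴
    S : ℤ
    S = sum₀ K (λ k → o j · o⁻ j · (t k · N₀ k j) - e j · (t k · N₀ k (suc j)))

  -- The sum stops at m without a boundary term because o m = p, that is o⁻ m = 0.
  I-rec : ∀ j → e j · I (suc j) ≡ o j · o⁻ j · I j ⟪ π⁴ ⟫
  I-rec j = begin
    e j · I (suc j)
      ≈⟨ ≋-reflexive (ZS.solve 2 (λ a b → a ⊜ b ∸′ (b ⊹ ∸′ # 1 ⋆ a)) refl (e j · I (suc j)) (o j · o⁻ j · I j)) ⟩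
    o j · o⁻ j · I j - (o j · o⁻ j · I j + - 1ℤ · (e j · I (suc j)))
      ≈⟨ ≋-+ˡ (o j · o⁻ j · I j) (≋-neg (≋-trans (≋-reflexive collect) (≋-trans (well-poised-certificate j m ℕP.≤-refl) (≋-reflexive vanish)))) ⟩
    o j · o⁻ j · I j - 0ℤ
      ≈⟨ ≋-reflexive (ZS.solve 1 (λ a → a ∸′ # 0 ⊜ a) refl (o j · o⁻ j · I j)) ⟩
    o j · o⁻ j · I j ∎
    where
    open ≋R π⁴
    f g : ℕ → ℤ
    f k = t k · N₀ k j
    g k = t k · N₀ k (suc j)
    collect : o j · o⁻ j · I j + - 1ℤ · (e j · I (suc j)) ≡ sum₀ m (λ k → o j · o⁻ j · f k - e j · g k)
    collect = trans (cong₂ _+_ (sym (sum₀-* m (o j · o⁻ j) f)) (trans (cong (- 1ℤ ·_) (sym (sum₀-* m (e j) g))) (sym (sum₀-* m (- 1ℤ) (λ k → e j · g k)))))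
      (trans (sym (sum₀-+ m (λ k → o j · o⁻ j · f k) (λ k → - 1ℤ · (e j · g k)))) (sum₀-≡ m (λ k → ZS.solve 2 (λ a b → a ⊹ ∸′ # 1 ⋆ b ⊜ a ∸′ b) refl (o j · o⁻ j · f k) (e j · g k))))
      where
      sum₀-≡ : ∀ n {f g} → (∀ i → f i ≡ g i) → sum₀ n f ≡ sum₀ n g
      sum₀-≡ zero    p = p 0
      sum₀-≡ (suc n) p = cong₂ _+_ (sum₀-≡ n p) (p (suc n))
    vanish : o m · o⁻ m · (o m + + 2 · + j) · (sq (b m) · F m · N₀ m j) ≡ 0ℤ
    vanish = trans (cong (λ z → o m · (sq (o m) - sq z) · (o m + + 2 · + j) · (sq (b m) · F m · N₀ m j)) π-m)
      (ZS.solve 3 (λ o y z → o ⋆ (o ⋆ o ∸′ o ⋆ o) ⋆ y ⋆ z ⊜ # 0) refl (o m) (o m + + 2 · + j) (sq (b m) · F m · N₀ m j))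

  b-prod : ∀ k → k ℕ.≤ m → b k · prod k e ≡ prod k o ⟪ π⁴ ⟫
  b-prod zero    _   = ≋-refl
  b-prod (suc k) k<m = begin
    b (suc k) · (prod k e · e k)   ≈⟨ ≋-reflexive (ZS.solve 3 (λ b p e → b ⋆ (p ⋆ e) ⊜ e ⋆ b ⋆ p) refl (b (suc k)) (prod k e) (e k)) ⟩
    e k · b (suc k) · prod k e     ≈⟨ ≋-*ʳ (prod k e) (b-rec k k<m) ⟩
    o k · b k · prod k e           ≈⟨ ≋-reflexive (ZS.solve 3 (λ o b p → o ⋆ b ⋆ p ⊜ b ⋆ p ⋆ o) refl (o k) (b k) (prod k e)) ⟩
    b k · prod k e · o k           ≈⟨ ≋-*ʳ (o k) (b-prod k (ℕP.<⇒≤ k<m)) ⟩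
    prod k o · o k                 ∎
    where open ≋R π⁴

  F-prod : ∀ k → k ℕ.≤ m → F k · prod k e⁻ ≡ O k ⟪ π⁴ ⟫
  F-prod zero    _   = ≋-refl
  F-prod (suc k) k<m = begin
    F (suc k) · (prod k e⁻ · e⁻ k)   ≈⟨ ≋-reflexive (ZS.solve 3 (λ b p e → b ⋆ (p ⋆ e) ⊜ e ⋆ b ⋆ p) refl (F (suc k)) (prod k e⁻) (e⁻ k)) ⟩
    e⁻ k · F (suc k) · prod k e⁻     ≈⟨ ≋-*ʳ (prod k e⁻) (F-rec k k<m) ⟩
    o⁻ k · F k · prod k e⁻           ≈⟨ ≋-reflexive (ZS.solve 3 (λ o b p → o ⋆ b ⋆ p ⊜ b ⋆ p ⋆ o) refl (o⁻ k) (F k) (prod k e⁻)) ⟩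
    F k · prod k e⁻ · o⁻ k           ≈⟨ ≋-*ʳ (o⁻ k) (F-prod k (ℕP.<⇒≤ k<m)) ⟩
    O (suc k)                        ∎
    where open ≋R π⁴

  -- The factor p of the theorem arises here. The product of 2m + 1 + 2i over i ≤ m begins with 2m +
  -- 1 = p; its other factors are e i + p and pair with e i - p to give e⁻ i.
  top : (+ 4 · + m + 1ℤ) · (b m · N₀ m m) ≡ π · prod m e⁻ ⟪ π⁴ ⟫
  top = begin
    (+ 4 · + m + 1ℤ) · (b m · N₀ m m)
      ≈⟨ ≋-reflexive (cong (λ z → (+ 4 · + m + 1ℤ) · (b m · z)) (trans (prod-* m (λ i → + 2 · + i - + 2 · + m) q) (cong (_· prod m q) (trans (prod-reverse-even m) (trans (prod-cong m (λ i _ → neg (e i))) (prod-* m (λ _ → - 1ℤ) e)))))) ⟩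
    (+ 4 · + m + 1ℤ) · (b m · (s · prod m e · prod m q))
      ≈⟨ ≋-reflexive (ZS.solve 5 (λ c b s e q → c ⋆ (b ⋆ (s ⋆ e ⋆ q)) ⊜ (b ⋆ e) ⋆ (s ⋆ (q ⋆ c))) refl (+ 4 · + m + 1ℤ) (b m) s (prod m e) (prod m q)) ⟩
    b m · prod m e · (s · (prod m q · (+ 4 · + m + 1ℤ)))
      ≈⟨ ≋-*ʳ (s · (prod m q · (+ 4 · + m + 1ℤ))) (b-prod m ℕP.≤-refl) ⟩
    prod m o · (s · (prod m q · (+ 4 · + m + 1ℤ)))
      ≈⟨ ≋-reflexive (cong (λ z → prod m o · (s · z)) (trans (cong (prod m q ·_) (ZS.solve 1 (λ m → # 4 ⋆ m ⊹ # 1 ⊜ # 2 ⋆ m ⊹ # 1 ⊹ # 2 ⋆ m) refl (+ m))) (telescope m))) ⟩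
    prod m o · (s · (o m · prod m q′))
      ≈⟨ ≋-reflexive (trans (ZS.solve 4 (λ o s p q → o ⋆ (s ⋆ (p ⋆ q)) ⊜ p ⋆ (s ⋆ o ⋆ q)) refl (prod m o) s (o m) (prod m q′)) (cong₂ (λ x y → x · (y · prod m q′)) (sym π-m)
           (trans (sym (prod-* m (λ _ → - 1ℤ) o)) (trans (prod-cong m (λ i _ → sym (neg (o i)))) (sym prod-e-π))))) ⟩
    π · (prod m (λ i → e i - π) · prod m q′)
      ≈⟨ ≋-reflexive (cong (π ·_) (trans (sym (prod-* m (λ i → e i - π) q′)) (prod-cong m (λ i _ → trans (cong (λ z → (e i - π) · (+ 2 · + i + + 2 + z)) (sym π-m)) (ZS.solve 2 (λ i p → (# 2 ⋆ (# 1 ⊹ i) ∸′ p) ⋆ (# 2 ⋆ i ⊹ # 2 ⊹ p) ⊜ (# 2 ⋆ (# 1 ⊹ i)) ⋆ (# 2 ⋆ (# 1 ⊹ i)) ∸′ p ⋆ p) refl (+ i) π))))) ⟩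
    π · prod m e⁻ ∎
    where
    open ≋R π⁴
    q q′ : ℕ → ℤ
    q i  = + 2 · + m + 1ℤ + + 2 · + i
    q′ i = + 2 · + i + + 2 + o m
    s : ℤ
    s = prod m (λ _ → - 1ℤ)
    neg : ∀ x → - x ≡ - 1ℤ · x
    neg x = ZS.solve 1 (λ x → ∸′ x ⊜ ∸′ # 1 ⋆ x) refl x
    telescope : ∀ j → prod j q · (+ 2 · + m + 1ℤ + + 2 · + j) ≡ o m · prod j q′
    telescope zero    = ZS.solve 1 (λ m → # 1 ⋆ (# 2 ⋆ m ⊹ # 1 ⊹ # 0) ⊜ (# 2 ⋆ m ⊹ # 1) ⋆ # 1) refl (+ m)
    telescope (suc j) = trans (cong₂ _·_ (telescope j) (ZS.solve 2 (λ m j → # 2 ⋆ m ⊹ # 1 ⊹ # 2 ⋆ (# 1 ⊹ j) ⊜ # 2 ⋆ j ⊹ # 2 ⊹ (# 2 ⋆ m ⊹ # 1)) refl (+ m) (+ j))) (ℤP.*-assoc (o m) (prod j q′) (q′ j))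

  -- Induction from j = m downwards: only k = m contributes to `I m`, and o j · o⁻ j is invertible
  -- for j < m.
  I-closed : ∀ d → d ℕ.≤ m → I (m ∸ d) ≡ π · (b (m ∸ d) · O (m ∸ d)) ⟪ π⁴ ⟫
  I-closed zero _ = begin
    I m
      ≈⟨ ≋-reflexive (sum₀-last m (λ k → t k · N₀ k m) (λ k k<m → trans (cong (t k ·_) (N₀-zero k m k<m)) (ℤP.*-zeroʳ (t k)))) ⟩
    (+ 4 · + m + 1ℤ) · (sq (b m) · F m) · N₀ m m
      ≈⟨ ≋-reflexive (ZS.solve 4 (λ c b f n → c ⋆ (b ⋆ b ⋆ f) ⋆ n ⊜ (b ⋆ f) ⋆ (c ⋆ (b ⋆ n))) refl (+ 4 · + m + 1ℤ) (b m) (F m) (N₀ m m)) ⟩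
    b m · F m · ((+ 4 · + m + 1ℤ) · (b m · N₀ m m))
      ≈⟨ ≋-*ˡ (b m · F m) top ⟩
    b m · F m · (π · prod m e⁻)
      ≈⟨ ≋-reflexive (ZS.solve 4 (λ b f p e → b ⋆ f ⋆ (p ⋆ e) ⊜ p ⋆ b ⋆ (f ⋆ e)) refl (b m) (F m) π (prod m e⁻)) ⟩
    π · b m · (F m · prod m e⁻)
      ≈⟨ ≋-*ˡ (π · b m) (F-prod m ℕP.≤-refl) ⟩
    π · b m · O m
      ≈⟨ ≋-reflexive (ℤP.*-assoc π (b m) (O m)) ⟩
    π · (b m · O m) ∎
    where open ≋R π⁴
  I-closed (suc d) d<m = unit-cancel (lift (unit-* (unit-o j j<m) (unit-⁻ (unit-o j j<m)))) (begin
    o j · o⁻ j · I j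
      ≈⟨ ≋-sym (I-rec j) ⟩
    e j · I (suc j)
      ≈⟨ ≋-*ˡ (e j) (subst (λ i → I i ≡ π · (b i · O i) ⟪ π⁴ ⟫) sj (I-closed d (ℕP.<⇒≤ d<m))) ⟩
    e j · (π · (b (suc j) · (O j · o⁻ j)))
      ≈⟨ ≋-reflexive (ZS.solve 5 (λ e p b O o → e ⋆ (p ⋆ (b ⋆ (O ⋆ o))) ⊜ e ⋆ b ⋆ (p ⋆ O ⋆ o)) refl (e j) π (b (suc j)) (O j) (o⁻ j)) ⟩
    e j · b (suc j) · (π · O j · o⁻ j)
      ≈⟨ ≋-*ʳ (π · O j · o⁻ j) (b-rec j j<m) ⟩
    o j · b j · (π · O j · o⁻ j)
      ≈⟨ ≋-reflexive (ZS.solve 5 (λ o b p O o′ → o ⋆ b ⋆ (p ⋆ O ⋆ o′) ⊜ o ⋆ o′ ⋆ (p ⋆ (b ⋆ O))) refl (o j) (b j) π (O j) (o⁻ j)) ⟩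
    o j · o⁻ j · (π · (b j · O j)) ∎)
    where
    open ≋R π⁴
    j : ℕ
    j = m ∸ suc d
    sj : m ∸ d ≡ suc j
    sj = ℕP.+-∸-assoc 1 d<m
    j<m : j ℕ.< m
    j<m = ℕP.≤-trans (ℕP.≤-reflexive (sym sj)) (ℕP.m∸n≤m m d)

  -- The summand of the balanced series ₄F₃(1/2, 1/2, (1 + p)/2, (1 - p)/2; 1, 1 + ip/2, 1 - ip/2;
  -- 1).
  c : ℕ → ℤ
  c j = γ j · (b j · O j)

  -- In b⁴ ≡ F · B the factor `B` is expanded by Saalschütz's sum; after the exchange of summations
  -- the inner sum is the well-poised one, already in closed form.
  whipple : sum₀ m (λ k → (+ 4 · + k + 1ℤ) · (sq (b k) · b⁴ k)) ≡ π · sum₀ m c ⟪ π⁴ ⟫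
  whipple = begin
    sum₀ m (λ k → (+ 4 · + k + 1ℤ) · (sq (b k) · b⁴ k))
      ≈⟨ sum₀-cong m (λ k k≤m → ≋-sym (≋-trans (≋-*ˡ (t k) (saalschütz k k≤m)) (≋-trans (≋-reflexive (ZS.solve 4 (λ a b f B → a ⋆ (b ⋆ f) ⋆ B ⊜ a ⋆ (b ⋆ (f ⋆ B))) refl (+ 4 · + k + 1ℤ) (sq (b k)) (F k) (B k))) (≋-*ˡ (+ 4 · + k + 1ℤ) (≋-*ˡ (sq (b k)) (F*B k k≤m)))))) ⟩
    sum₀ m (λ k → t k · sum₀ m (λ j → N₀ k j · γ j))
      ≈⟨ sum₀-cong m (λ k _ → ≋-reflexive (sym (sum₀-* m (t k) (λ j → N₀ k j · γ j)))) ⟩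
    sum₀ m (λ k → sum₀ m (λ j → t k · (N₀ k j · γ j)))
      ≈⟨ ≋-reflexive (sum₀-swap m m (λ k j → t k · (N₀ k j · γ j))) ⟩
    sum₀ m (λ j → sum₀ m (λ k → t k · (N₀ k j · γ j)))
      ≈⟨ sum₀-cong m (λ j j≤m → ≋-trans (sum₀-cong m (λ k _ → ≋-reflexive (ZS.solve 3 (λ t n g → t ⋆ (n ⋆ g) ⊜ g ⋆ (t ⋆ n)) refl (t k) (N₀ k j) (γ j)))) (≋-trans (≋-reflexive (sum₀-* m (γ j) (λ k → t k · N₀ k j)))
           (≋-trans (≋-*ˡ (γ j) (subst (λ i → I i ≡ π · (b i · O i) ⟪ π⁴ ⟫) (ℕP.m∸[m∸n]≡n j≤m) (I-closed (m ∸ j) (ℕP.m∸n≤m m j)))) (≋-reflexive (ZS.solve 3 (λ g p x → g ⋆ (p ⋆ x) ⊜ p ⋆ (g ⋆ x)) refl (γ j) π (b j · O j)))))) ⟩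
    sum₀ m (λ j → π · c j)
      ≈⟨ ≋-reflexive (sum₀-* m π c) ⟩
    π · sum₀ m c ∎
    where open ≋R π⁴

  -- The quotient of c j by b⁴ j is the product of (1 - p²/o²)/(1 + p²/e²). To first order in p²
  -- each factor subtracts p²/o² + p²/e², two consecutive terms of p² · `H`.
  c-expansion : ∀ j → j ℕ.≤ m → c j ≡ b⁴ j · (1ℤ - sq π · H (j ℕ.+ j)) ⟪ π⁴ ⟫
  c-expansion j j≤m = ≋-trans (seq-unique m (λ i → sq (e i) · e⁺ i) (λ i → sq (o i) · o⁻ i) (λ i i<m → let U = unit-e i i<m in lift (unit-* (unit-* U U) (unit-⁺ U)))
      {c} {λ j → b⁴ j · (1ℤ - sq π · H (j ℕ.+ j))} rec₁ rec₂ 1ℤ (≋-reflexive (ZS.solve 1 (λ p → # 1 ⊜ # 1 ⋆ (# 1 ⋆ (# 1 ∸′ p ⋆ p ⋆ # 0))) refl π)) j j≤m)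
    (≋-reflexive (ℤP.*-identityˡ (b⁴ j · (1ℤ - sq π · H (j ℕ.+ j)))))
    where
    open ≋R π⁴
    rec₁ : ∀ i → i ℕ.< m → sq (e i) · e⁺ i · c (suc i) ≡ sq (o i) · o⁻ i · c i ⟪ π⁴ ⟫
    rec₁ i i<m = begin
      sq (e i) · e⁺ i · (γ (suc i) · (b (suc i) · (O i · o⁻ i)))
        ≈⟨ ≋-reflexive (ZS.solve 6 (λ e E g b O o → e ⋆ e ⋆ E ⋆ (g ⋆ (b ⋆ (O ⋆ o))) ⊜ (e ⋆ E ⋆ g) ⋆ (e ⋆ b) ⋆ (O ⋆ o)) refl (e i) (e⁺ i) (γ (suc i)) (b (suc i)) (O i) (o⁻ i)) ⟩
      e i · e⁺ i · γ (suc i) · (e i · b (suc i)) · (O i · o⁻ i)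
        ≈⟨ ≋-*ʳ (O i · o⁻ i) (≋-* (γ-rec i i<m) (b-rec i i<m)) ⟩
      o i · γ i · (o i · b i) · (O i · o⁻ i)
        ≈⟨ ≋-reflexive (ZS.solve 5 (λ o g b O o′ → o ⋆ g ⋆ (o ⋆ b) ⋆ (O ⋆ o′) ⊜ o ⋆ o ⋆ o′ ⋆ (g ⋆ (b ⋆ O))) refl (o i) (γ i) (b i) (O i) (o⁻ i)) ⟩
      sq (o i) · o⁻ i · c i ∎
    rec₂ : ∀ i → i ℕ.< m → sq (e i) · e⁺ i · (b⁴ (suc i) · (1ℤ - sq π · H (suc i ℕ.+ suc i))) ≡ sq (o i) · o⁻ i · (b⁴ i · (1ℤ - sq π · H (i ℕ.+ i))) ⟪ π⁴ ⟫
    rec₂ i i<m = begin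
      sq (e i) · e⁺ i · (b⁴ (suc i) · (1ℤ - sq π · H (suc i ℕ.+ suc i)))
        ≈⟨ ≋-reflexive (cong (λ z → sq (e i) · e⁺ i · (b⁴ (suc i) · (1ℤ - sq π · z))) H-suc) ⟩
      sq (e i) · e⁺ i · (b⁴ (suc i) · (1ℤ - sq π · (h + sq x + sq y)))
        ≈⟨ ≋-sym (shift (e i) (b⁴ (suc i)) y (h + sq x) ey) ⟩
      sq (sq (e i)) · b⁴ (suc i) · (1ℤ - sq π · (h + sq x))
        ≈⟨ ≋-*ʳ (1ℤ - sq π · (h + sq x)) (b⁴-rec i i<m) ⟩
      sq (sq (o i)) · b⁴ i · (1ℤ - sq π · (h + sq x))
        ≈⟨ shift′ (o i) (b⁴ i) x h ox ⟩
      sq (o i) · o⁻ i · (b⁴ i · (1ℤ - sq π · h)) ∎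
      where
      h x y : ℤ
      h = H (i ℕ.+ i)
      x = w (suc (i ℕ.+ i))
      y = w (suc (suc (i ℕ.+ i)))
      H-suc : H (suc i ℕ.+ suc i) ≡ h + sq x + sq y
      H-suc = cong H (ℕP.+-suc (suc i) i)
      i+i<2m : suc (suc (i ℕ.+ i)) ℕ.≤ m ℕ.+ m
      i+i<2m = ℕP.≤-trans (ℕP.≤-reflexive (sym (ℕP.+-suc (suc i) i))) (ℕP.+-mono-≤ i<m i<m)
      ey : e i · y ≡ 1ℤ ⟪ π⁴ ⟫
      ey = ≋-trans (≋-reflexive (cong (_· y) (ZS.solve 1 (λ i → # 2 ⋆ (# 1 ⊹ i) ⊜ # 2 ⊹ (i ⊹ i)) refl (+ i)))) (w-inv (suc (suc (i ℕ.+ i))) (s≤s z≤n) i+i<2m)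
      ox : o i · x ≡ 1ℤ ⟪ π⁴ ⟫
      ox = ≋-trans (≋-reflexive (cong (_· x) (ZS.solve 1 (λ i → # 2 ⋆ i ⊹ # 1 ⊜ # 1 ⊹ (i ⊹ i)) refl (+ i)))) (w-inv (suc (i ℕ.+ i)) (s≤s z≤n) (ℕP.≤-trans (ℕP.n≤1+n _) i+i<2m))
      -- z²(z² + π²)(1 - π²(H + 1/z²)) and z⁴(1 - π²H) differ by a multiple of π⁴
      shift : ∀ z B v H → z · v ≡ 1ℤ ⟪ π⁴ ⟫ → sq (sq z) · B · (1ℤ - sq π · H) ≡ sq z · (sq z + sq π) · (B · (1ℤ - sq π · (H + sq v))) ⟪ π⁴ ⟫
      shift z B v H q = ≋-trans (cong-by (sq z · B · (H + sq v)) (ZS.solve 5 (λ z B v H p → z ⋆ z ⋆ (z ⋆ z) ⋆ B ⋆ (# 1 ∸′ p ⋆ p ⋆ H) ⊜ z ⋆ z ⋆ (z ⋆ z ⊹ p ⋆ p) ⋆ (B ⋆ (# 1 ∸′ p ⋆ p ⋆ (H ⊹ v ⋆ v))) ⊹ z ⋆ z ⋆ B ⋆ (p ⋆ p) ⋆ ((z ⋆ v) ⋆ (z ⋆ v) ∸′ # 1) ⊹ z ⋆ z ⋆ B ⋆ (H ⊹ v ⋆ v) ⋆ (p ⋆ p ⋆ p ⋆ p)) refl z B v H π))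
        (≋-trans (≋-+ˡ A (≋-*ˡ (sq z · B · sq π) (≋-+ʳ (- 1ℤ) (≋-* q q)))) (≋-reflexive (ZS.solve 2 (λ a x → a ⊹ x ⋆ (# 1 ⋆ # 1 ∸′ # 1) ⊜ a) refl A (sq z · B · sq π))))
        where
        A : ℤ
        A = sq z · (sq z + sq π) · (B · (1ℤ - sq π · (H + sq v)))
      shift′ : ∀ z B v H → z · v ≡ 1ℤ ⟪ π⁴ ⟫ → sq (sq z) · B · (1ℤ - sq π · (H + sq v)) ≡ sq z · (sq z - sq π) · (B · (1ℤ - sq π · H)) ⟪ π⁴ ⟫
      shift′ z B v H q = ≋-trans (cong-by (- (sq z · B · H)) (ZS.solve 5 (λ z B v H p → z ⋆ z ⋆ (z ⋆ z) ⋆ B ⋆ (# 1 ∸′ p ⋆ p ⋆ (H ⊹ v ⋆ v)) ⊜ z ⋆ z ⋆ (z ⋆ z ∸′ p ⋆ p) ⋆ (B ⋆ (# 1 ∸′ p ⋆ p ⋆ H)) ⊹ (∸′ (z ⋆ z ⋆ B ⋆ (p ⋆ p))) ⋆ ((z ⋆ v) ⋆ (z ⋆ v) ∸′ # 1) ⊹ (∸′ (z ⋆ z ⋆ B ⋆ H)) ⋆ (p ⋆ p ⋆ p ⋆ p)) refl z B v H π))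
        (≋-trans (≋-+ˡ A (≋-*ˡ (- (sq z · B · sq π)) (≋-+ʳ (- 1ℤ) (≋-* q q)))) (≋-reflexive (ZS.solve 2 (λ a x → a ⊹ x ⋆ (# 1 ⋆ # 1 ∸′ # 1) ⊜ a) refl A (- (sq z · B · sq π)))))
        where
        A : ℤ
        A = sq z · (sq z - sq π) · (B · (1ℤ - sq π · H))

  -- The modulus p³ is enough because Whipple's transformation multiplies this sum by p.
  sum-c : sum₀ m c ≡ sum₀ m b⁴ ⟪ π³ ⟫
  sum-c = begin
    sum₀ m c
      ≈⟨ sum₀-cong m (λ j j≤m → ≋-trans (≋-reduce π (c-expansion j j≤m)) (≋-reflexive (ZS.solve 3 (λ b p h → b ⋆ (# 1 ∸′ p ⋆ p ⋆ h) ⊜ b ⊹ (∸′ (p ⋆ p)) ⋆ (b ⋆ h)) refl (b⁴ j) π (H (j ℕ.+ j))))) ⟩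
    sum₀ m (λ j → b⁴ j + - sq π · (b⁴ j · H (j ℕ.+ j)))
      ≈⟨ ≋-reflexive (trans (sum₀-+ m b⁴ (λ j → - sq π · (b⁴ j · H (j ℕ.+ j)))) (cong (λ z → sum₀ m b⁴ + z) (sum₀-* m (- sq π) (λ j → b⁴ j · H (j ℕ.+ j))))) ⟩
    sum₀ m b⁴ + - sq π · sum₀ m (λ j → b⁴ j · H (j ℕ.+ j))
      ≈⟨ ≋-+ˡ (sum₀ m b⁴) (drop b⁴H-sum) ⟩
    sum₀ m b⁴ + 0ℤ
      ≈⟨ ≋-reflexive (ℤP.+-identityʳ (sum₀ m b⁴)) ⟩
    sum₀ m b⁴ ∎
    where
    open ≋R π³
    drop : ∀ {x} → x ≡ 0ℤ ⟪ π ⟫ → - sq π · x ≡ 0ℤ ⟪ π³ ⟫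
    drop (cong-by k refl) = cong-by (- k) (ZS.solve 2 (λ p k → (∸′ (p ⋆ p)) ⋆ (# 0 ⊹ k ⋆ p) ⊜ # 0 ⊹ (∸′ k) ⋆ (p ⋆ p ⋆ p)) refl π k)

  sixth-powers : sum₀ m (λ k → (+ 4 · + k + 1ℤ) · (sq (b k) · b⁴ k)) ≡ π · sum₀ m b⁴ ⟪ π⁴ ⟫
  sixth-powers = ≋-trans whipple (≋-scale π sum-c)

-- The two halves combined

⊗-≋ : ∀ {P} h v n → (∀ i → i ℕ.< n → v (suc i) ≡ 0ℤ ⟪ P ⟫) → (h ⊗ v) n ≡ v 0 · h n ⟪ P ⟫
⊗-≋ {P} h v n z = ≋-trans (≋-reflexive (⊗-commᵃ h v n)) (go n z)
  where
  vanish : ∀ f n → (∀ i → i ℕ.≤ n → f i ≡ 0ℤ ⟪ P ⟫) → (f ⊗ h) n ≡ 0ℤ ⟪ P ⟫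
  vanish f zero    q = ≋-trans (≋-reflexive (⊗-zero f h)) (≋-*ʳ (h 0) (q 0 z≤n))
  vanish f (suc n) q = ≋-trans (≋-reflexive (⊗-suc f h n)) (≋-+ (≋-trans (≋-*ʳ (h (suc n)) (q 0 z≤n)) (≋-reflexive (ℤP.*-zeroˡ (h (suc n))))) (vanish (tail f) n (λ i i≤n → q (suc i) (s≤s i≤n))))
  go : ∀ n → (∀ i → i ℕ.< n → v (suc i) ≡ 0ℤ ⟪ P ⟫) → (v ⊗ h) n ≡ v 0 · h n ⟪ P ⟫
  go zero    q = ≋-reflexive (⊗-zero v h)
  go (suc n) q = ≋-trans (≋-reflexive (⊗-suc v h n)) (≋-trans (≋-+ˡ (v 0 · h (suc n)) (vanish (tail v) n (λ i i≤n → q i (s≤s i≤n)))) (≋-reflexive (ℤP.+-identityʳ (v 0 · h (suc n)))))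

module Kilbourn (m : ℕ) (pp : Prime (suc (m ℕ.+ m))) (2≤m : 2 ℕ.≤ m) where
  open Prime-odd m pp
  open Harmonic m pp 2≤m
  open Whipple m pp 2≤m using (b⁴-rec)
  private
    module Fr = Truncated m
  open Fr using (res; h)

  g : ℕ → ℤ
  g i = - (+ 64 · cube (e i))

  -- The solution of `C-rec` with its denominators cleared. At j = m the product of the `g` is
  -- empty, and the cube of a product of odd numbers below p remains, a unit.
  C : ℕ → ℤ
  C j = prod (m ∸ j) (λ i → g (j ℕ.+ i)) · cube (prod j o)

  C-rec : ∀ j → j ℕ.< m → g j · C (suc j) ≡ cube (o j) · C j
  C-rec j j<m = sym (trans (cong (λ z → cube (o j) · (z · cube (prod j o))) tailG)
    (ZS.solve 4 (λ o g G p → o ⋆ o ⋆ o ⋆ (g ⋆ G ⋆ (p ⋆ p ⋆ p)) ⊜ g ⋆ (G ⋆ (p ⋆ o ⋆ (p ⋆ o) ⋆ (p ⋆ o)))) refl (o j) (g j) G (prod j o)))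
    where
    G : ℤ
    G = prod (m ∸ suc j) (λ i → g (suc j ℕ.+ i))
    tailG : prod (m ∸ j) (λ i → g (j ℕ.+ i)) ≡ g j · G
    tailG = trans (cong (λ t → prod t (λ i → g (j ℕ.+ i))) (ℕP.+-∸-assoc 1 j<m)) (trans (prod-head (m ∸ suc j) (λ i → g (j ℕ.+ i)))
      (cong₂ _·_ (cong g (ℕP.+-identityʳ j)) (prod-cong (m ∸ suc j) (λ i _ → cong (λ t → g t) {j ℕ.+ suc i} {suc j ℕ.+ i} (ℕP.+-suc j i)))))

  v : PS
  v = Fr.v C C-rec m

  -- In `v-coeff` the factor (2n - p)³ is a unit for 0 < n ≤ m, because 2n is one.
  v-vanish : ∀ i → i ℕ.< m → v (suc i) ≡ 0ℤ ⟪ π³ ⟫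
  v-vanish i i<m = unit-cancel (unit-* (unit-* U U) U) (≋-trans (≋-reflexive (Fr.v-coeff C C-rec (suc i) i<m))
      (≋-trans (cong-by {cube (o m) · q} {0ℤ} q (trans (cong (λ z → cube z · q) (sym π-m)) (ZS.solve 2 (λ p q → p ⋆ p ⋆ p ⋆ q ⊜ # 0 ⊹ q ⋆ (p ⋆ p ⋆ p)) refl π q)))
        (≋-reflexive (sym (ℤP.*-zeroʳ (cube (e i - o m)))))))
    where
    q : ℤ
    q = - C m · (Fr.E ⊗ Fr.z m) (suc i)
    U : Unit π³ (e i - o m)
    U = subst (λ z → Unit π³ (e i - z)) π-m (unit-reduce π (lift (unit-≋ (cong-by (- 1ℤ) (ZS.solve 2 (λ e p → e ∸′ p ⊜ e ⊹ ∸′ # 1 ⋆ p) refl (e i) π)) (unit-e i i<m))))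

  x : ℕ → ℤ
  x j = C j · res j

  -- Three powers of o/e come from `C` and one from `res`; the constants 1/(-64) and -64 cancel.
  x-rec : ∀ j → j ℕ.< m → sq (sq (e j)) · x (suc j) ≡ sq (sq (o j)) · x j
  x-rec j j<m = ℤP.*-cancelˡ-≡ (- + 32) _ _ (begin
    (- + 32) · (sq (sq (e j)) · (C (suc j) · res (suc j)))
      ≡⟨ ZS.solve 3 (λ n c r → ∸′ # 32 ⋆ ((# 2 ⋆ n) ⋆ (# 2 ⋆ n) ⋆ ((# 2 ⋆ n) ⋆ (# 2 ⋆ n)) ⋆ (c ⋆ r)) ⊜ (∸′ (# 64 ⋆ ((# 2 ⋆ n) ⋆ (# 2 ⋆ n) ⋆ (# 2 ⋆ n)))) ⋆ c ⋆ (n ⋆ r)) refl (+ suc j) (C (suc j)) (res (suc j)) ⟩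
    g j · C (suc j) · (+ suc j · res (suc j))
      ≡⟨ cong₂ _·_ (C-rec j j<m) (Fr.res-suc j j<m) ⟩
    cube (o j) · C j · (- (+ 32 · o j) · res j)
      ≡⟨ ZS.solve 3 (λ o c r → o ⋆ o ⋆ o ⋆ c ⋆ ((∸′ (# 32 ⋆ o)) ⋆ r) ⊜ ∸′ # 32 ⋆ (o ⋆ o ⋆ (o ⋆ o) ⋆ (c ⋆ r))) refl (o j) (C j) (res j) ⟩
    (- + 32) · (sq (sq (o j)) · x j) ∎)
    where open ≡-Reasoning

  x-b⁴ : ∀ j → j ℕ.≤ m → x j ≡ x 0 · b⁴ j ⟪ π⁴ ⟫
  x-b⁴ = seq-unique m (λ i → sq (sq (e i))) (λ i → sq (sq (o i))) (λ i i<m → let U = lift (unit-e i i<m) in unit-* (unit-* U U) (unit-* U U))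
    {x} {b⁴} (λ i i<m → ≋-reflexive (x-rec i i<m)) b⁴-rec (x 0) (≋-reflexive (sym (ℤP.*-identityʳ (x 0))))

  C-m : C m ≡ cube (prod m o)
  C-m = trans (cong (λ t → prod t (λ i → g (m ℕ.+ i)) · cube (prod m o)) (ℕP.n∸n≡0 m)) (ℤP.*-identityˡ (cube (prod m o)))

  x-0 : x 0 ≡ prod m g
  x-0 = trans (cong (prod m g · cube 1ℤ ·_) Fr.res-0) (ZS.solve 1 (λ x → x ⋆ # 1 ⋆ # 1 ⊜ x) refl (prod m g))

  -- x 0 is the product of the -(4e)³ and C m that of the o³, so this is the cube of Morley's
  -- congruence up to signs, which agree on both sides.
  x-0-C-m : x 0 ≡ C m ⟪ π³ ⟫
  x-0-C-m = begin
    x 0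
      ≈⟨ ≋-reflexive (trans x-0 (trans (prod-cong m (λ i _ → ZS.solve 1 (λ e → ∸′ (# 64 ⋆ (e ⋆ e ⋆ e)) ⊜ ∸′ # 1 ⋆ ((# 4 ⋆ e) ⋆ (# 4 ⋆ e) ⋆ (# 4 ⋆ e))) refl (e i)))
           (trans (prod-* m (λ _ → - 1ℤ) (λ i → cube (+ 4 · e i))) (cong (s ·_) (prod-cube m (λ i → + 4 · e i)))))) ⟩
    s · cube (prod m (λ i → + 4 · e i))
      ≈⟨ ≋-*ˡ s (≋-sym (≋-* (≋-* morley morley) morley)) ⟩
    s · cube ν
      ≈⟨ ≋-reflexive (trans (cong (λ z → s · cube z) (trans (prod-cong m (λ i _ → ZS.solve 1 (λ x → ∸′ x ⊜ ∸′ # 1 ⋆ x) refl (o i))) (prod-* m (λ _ → - 1ℤ) o)))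
           (trans (ZS.solve 2 (λ s p → s ⋆ ((s ⋆ p) ⋆ (s ⋆ p) ⋆ (s ⋆ p)) ⊜ (s ⋆ s) ⋆ (s ⋆ s) ⋆ (p ⋆ p ⋆ p)) refl s (prod m o))
             (trans (cong (λ z → z · z · cube (prod m o)) (s² m)) (trans (ℤP.*-identityˡ (cube (prod m o))) (sym C-m))))) ⟩
    C m ∎
    where
    open ≋R π³
    s : ℤ
    s = prod m (λ _ → - 1ℤ)
    s² : ∀ n → prod n (λ _ → - 1ℤ) · prod n (λ _ → - 1ℤ) ≡ 1ℤ
    s² n = trans (sym (prod-* n (λ _ → - 1ℤ) (λ _ → - 1ℤ))) (ones n)
      where
      ones : ∀ n → prod n (λ _ → 1ℤ) ≡ 1ℤ
      ones zero    = refl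
      ones (suc n) = trans (ℤP.*-identityʳ (prod n (λ _ → 1ℤ))) (ones n)
    prod-cube : ∀ n f → prod n (λ i → cube (f i)) ≡ cube (prod n f)
    prod-cube n f = trans (prod-* n (λ i → f i · f i) f) (cong (_· prod n f) (prod-* n f f))

  kilbourn : a (suc (m ℕ.+ m)) ≡ sum₀ m b⁴ ⟪ π³ ⟫
  kilbourn = unit-cancel unit-C (begin
    C m · a (suc (m ℕ.+ m))
      ≈⟨ ≋-reflexive (cong₂ _·_ (sym (Fr.v-0 C C-rec)) (a-coeff m)) ⟩
    v 0 · h m
      ≈⟨ ≋-sym (⊗-≋ h v m v-vanish) ⟩
    (h ⊗ v) m
      ≈⟨ ≋-reflexive (Fr.h-v C C-rec m ℕP.≤-refl) ⟩
    sum₀ m x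
      ≈⟨ sum₀-cong m (λ j j≤m → ≋-trans (≋-reduce π (x-b⁴ j j≤m)) (≋-*ʳ (b⁴ j) x-0-C-m)) ⟩
    sum₀ m (λ j → C m · b⁴ j)
      ≈⟨ ≋-reflexive (sum₀-* m (C m) b⁴) ⟩
    C m · sum₀ m b⁴ ∎)
    where
    open ≋R π³
    unit-C : Unit π³ (C m)
    unit-C = subst (Unit π³) (sym C-m) (let U = prod-unit m o (λ i i<m → unit-reduce π (lift (unit-o i i<m))) in unit-* (unit-* U U) U)

-- The rationals of the statement and their residues modulo p⁴

module Assembly (m : ℕ) (pp : Prime (suc (m ℕ.+ m))) (2≤m : 2 ℕ.≤ m) where
  open Prime-odd m pp
  open Harmonic m pp 2≤m
  open Whipple m pp 2≤m using (sixth-powers)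
  open Kilbourn m pp 2≤m using (kilbourn)

  2≤2m : 2 ℕ.≤ m ℕ.+ m
  2≤2m = ℕP.≤-trans 2≤m (ℕP.m≤m+n m m)

  -- Residues of (1/2)ₖ and of 1/k!, where `w 2` stands for 1/2.
  ρ ι : ℕ → ℤ
  ρ zero    = 1ℤ
  ρ (suc k) = ρ k · (w 2 + + k)
  ι zero    = 1ℤ
  ι (suc k) = ι k · w (suc k)

  rep-½ : Rep π⁴ ½ (w 2)
  rep-½ = rep-/ 1ℤ 2 (w 2) (lift (unit-nat 2 (s≤s z≤n) 2≤2m)) (≋-trans (≋-reflexive (ℤP.*-comm (w 2) (+ 2))) (w-inv 2 (s≤s z≤n) 2≤2m))

  rep-rising : ∀ k → Rep π⁴ (rising ½ k) (ρ k)
  rep-rising zero    = rep-int 1ℤ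
  rep-rising (suc k) = rep-* {x = rising ½ k} {½ ℚ.+ (+ k) ℚ./ 1} (rep-rising k) (rep-+ {x = ½} {(+ k) ℚ./ 1} rep-½ (rep-int (+ k)))

  ι-! : ∀ k → k ℕ.≤ m → ι k · + (k !) ≡ 1ℤ ⟪ π⁴ ⟫
  ι-! zero    _   = ≋-refl
  ι-! (suc k) k<m = ≋-trans (≋-reflexive (trans (cong (ι k · w (suc k) ·_) (ℤP.pos-* (suc k) (k !))) (ZS.solve 4 (λ i w n f → i ⋆ w ⋆ (n ⋆ f) ⊜ i ⋆ f ⋆ (n ⋆ w)) refl (ι k) (w (suc k)) (+ suc k) (+ (k !)))))
    (≋-* (ι-! k (ℕP.<⇒≤ k<m)) (w-inv (suc k) (s≤s z≤n) (ℕP.≤-trans k<m (ℕP.m≤m+n m m))))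

  rep-inv! : ∀ k → k ℕ.≤ m → Rep π⁴ (inv! k) (ι k)
  rep-inv! k k≤m = rep-/ 1ℤ (k !) {{ℕP._!≢0 k}} (ι k) (unit (ι k) (≋-trans (≋-reflexive (ℤP.*-comm (+ (k !)) (ι k))) (ι-! k k≤m))) (ι-! k k≤m)

  ρι-b : ∀ k → k ℕ.≤ m → ρ k · ι k ≡ b k ⟪ π⁴ ⟫
  ρι-b k k≤m = ≋-trans (seq-unique m e o (λ i i<m → lift (unit-e i i<m)) {λ k → ρ k · ι k} {b} rec b-rec 1ℤ ≋-refl k k≤m) (≋-reflexive (ℤP.*-identityˡ (b k)))
    where
    open ≋R π⁴
    rec : ∀ i → i ℕ.< m → e i · (ρ (suc i) · ι (suc i)) ≡ o i · (ρ i · ι i) ⟪ π⁴ ⟫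
    rec i i<m = begin
      e i · (ρ i · (w 2 + + i) · (ι i · w (suc i)))
        ≈⟨ ≋-reflexive (ZS.solve 6 (λ n r h i ι w → # 2 ⋆ n ⋆ (r ⋆ (h ⊹ i) ⋆ (ι ⋆ w)) ⊜ (# 2 ⋆ h ⊹ # 2 ⋆ i) ⋆ (n ⋆ w) ⋆ (r ⋆ ι)) refl (+ suc i) (ρ i) (w 2) (+ i) (ι i) (w (suc i))) ⟩
      (+ 2 · w 2 + + 2 · + i) · (+ suc i · w (suc i)) · (ρ i · ι i)
        ≈⟨ ≋-*ʳ (ρ i · ι i) (≋-* (≋-+ʳ (+ 2 · + i) (w-inv 2 (s≤s z≤n) 2≤2m)) (w-inv (suc i) (s≤s z≤n) (ℕP.≤-trans i<m (ℕP.m≤m+n m m)))) ⟩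
      (1ℤ + + 2 · + i) · 1ℤ · (ρ i · ι i)
        ≈⟨ ≋-reflexive (ZS.solve 2 (λ i r → (# 1 ⊹ # 2 ⋆ i) ⋆ # 1 ⋆ r ⊜ (# 2 ⋆ i ⊹ # 1) ⋆ r) refl (+ i) (ρ i · ι i)) ⟩
      o i · (ρ i · ι i) ∎

  rep-sumTo : ∀ n {f : ℕ → ℚ} {g : ℕ → ℤ} → (∀ k → k ℕ.≤ n → Rep π⁴ (f k) (g k)) → Rep π⁴ (sumTo n f) (sum₀ n g)
  rep-sumTo zero    p = p 0 z≤n
  rep-sumTo (suc n) {f} p = rep-+ {x = sumTo n f} {f (suc n)} (rep-sumTo n (λ k k≤n → p k (ℕP.m≤n⇒m≤1+n k≤n))) (p (suc n) ℕP.≤-refl)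

  rep-lhs : Rep π⁴ (lhs m) (sum₀ m (λ k → (+ 4 · + k + 1ℤ) · (sq (b k) · b⁴ k)))
  rep-lhs = rep-sumTo m λ k k≤m → rep-≋ (≋-reflexive (cong₂ _·_ (trans (ℤP.pos-+ (4 ℕ.* k) 1) (cong (_+ 1ℤ) (ℤP.pos-* 4 k))) (ZS.solve 1 (λ b → b ⋆ (b ⋆ (b ⋆ (b ⋆ (b ⋆ (b ⋆ # 1))))) ⊜ b ⋆ b ⋆ (b ⋆ b ⋆ (b ⋆ b))) refl (b k))))
    (rep-* {x = (+ (4 ℕ.* k ℕ.+ 1)) ℚ./ 1} {powℚ (rising ½ k ℚ.* inv! k) 6} (rep-int (+ (4 ℕ.* k ℕ.+ 1)))
      (rep-pow {x = rising ½ k ℚ.* inv! k} (rep-≋ (ρι-b k k≤m) (rep-* {x = rising ½ k} {inv! k} (rep-rising k) (rep-inv! k k≤m))) 6))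

  conclusion : lhs m ≡ ((+ suc (m ℕ.+ m)) ℚ./ 1) ℚ.* ((a (suc (m ℕ.+ m))) ℚ./ 1) [modℚ suc (m ℕ.+ m) ^ 4 ]
  conclusion = ≡-modℚ pp rep-lhs (rep-* {x = (+ suc (m ℕ.+ m)) ℚ./ 1} {(a (suc (m ℕ.+ m))) ℚ./ 1} (rep-int π) (rep-int (a (suc (m ℕ.+ m)))))
    (≋-trans sixth-powers (≋-sym (≋-scale π kilbourn)))

parity : ∀ n → ∃ λ m → n ≡ m ℕ.+ m ⊎ n ≡ suc (m ℕ.+ m)
parity zero    = 0 , inj₁ refl
parity (suc n) with parity n
... | m , inj₁ refl = m , inj₂ refl
... | m , inj₂ refl = suc m , inj₁ (cong suc (sym (ℕP.+-suc m m)))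

double : ∀ m → m ℕ.+ m ≡ m ℕ.* 2
double m = trans (cong (λ z → m ℕ.+ z) (sym (ℕP.+-identityʳ m))) (ℕP.*-comm 2 m)

theorem2 : (p : ℕ) → Prime p → p > 3 →
    lhs ((p ∸ 1) Data.Nat./ 2) ≡ ((+ p) Data.Rational./ 1) * ((a p) Data.Rational./ 1) [modℚ p ^ 4 ]
theorem2 p pp p>3 with parity p
... | m , inj₁ refl with prime⇒irreducible pp (ℕD.divides m (double m))
... | inj₂ 2≡p = ⊥-elim (ℕP.<⇒≱ p>3 (ℕP.≤-trans (ℕP.≤-reflexive (sym 2≡p)) (s≤s (s≤s z≤n))))
theorem2 p pp p>3 | m , inj₂ refl = subst (λ n → lhs n ≡ ((+ p) ℚ./ 1) ℚ.* ((a p) ℚ./ 1) [modℚ p ^ 4 ]) (sym half) (Assembly.conclusion m pp (2≤ m p>3))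
  where
  half : (m ℕ.+ m) ℕ./ 2 ≡ m
  half = trans (cong (ℕ._/ 2) (double m)) (ℕDM.m*n/n≡m m 2)
  2≤ : ∀ m → suc (m ℕ.+ m) ℕ.> 3 → 2 ℕ.≤ m
  2≤ zero          (s≤s ())
  2≤ (suc zero)    (s≤s (s≤s (s≤s ())))
  2≤ (suc (suc m)) _ = s≤s (s≤s z≤n)
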